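{- There exist constants $c>0$ and $k_0$ such that for every $n$, every $T\subseteq V_n$ with $|T|$ even and $|T|\ge k_0$, and every vertex $v$ of $P^{\uparrow}_{T\text{ -cut}}(n)$, the radial cone of $P^{\uparrow}_{T\text{ -cut}}(n)$ at $v$ satisfies $\mathrm{xc}(K_{P^{\uparrow}_{T\text{ -cut}}(n)}(v))\ge 2^{c|T|}$ (i.e. the extension complexity is $2^{\Omega(|T|)}$).
   Context: $K_n=(V_n,E_n)$ is the complete graph on $n$ nodes; $\delta(S)=\{\{u,w\}\in E_n: u\in S, w\notin S\}$. For $T\subseteq V_n$ with $|T|$ even, a $T$-cut is a set $\delta(S)$ with $S\subseteq V_n$ and $|S\cap T|$ odd. The $T$-cut polyhedron is $P^{\uparrow}_{T\text{ -cut}}(n)=\mathrm{conv}\{\chi(C): C \text{ a } T\text{ -cut}\}+\mathbb{R}^{E_n}_+$. The radial cone $K_P(v)$ of a polyhedron $P$ at $v\in P$ is the polyhedron defined by all linear inequalities valid for $P$ and tight at $v$ (equivalently $\mathrm{cone}(P-v)+v$). $\mathrm{xc}(P)$ is the extension complexity: the minimum number of facets of a polyhedron $Q$ such that $P=\pi(Q)$ for some linear map $\pi$. -}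

module Defs where

open import Level using (0ℓ)
open import Data.Nat using (ℕ; zero; suc; _%_)
open import Data.Fin using (Fin; _<_)
open import Data.Fin.Properties using (_<?_)
open import Data.Fin.Subset using (Subset; Side; inside; outside; _∩_; ∣_∣)
open import Data.Vec using (lookup)
open import Data.List using (List; []; _∷_)
open import Data.List.Relation.Unary.All using (All)
open import Data.Product using (Σ; Σ-syntax; ∃; ∃-syntax; _×_; _,_; proj₁; proj₂)
open import Data.Sum using (_⊎_)
open import Relation.Nullary using (¬_; yes; no)
open import Relation.Binary.PropositionalEquality using (_≡_)
open import Algebra.Bundles using (CommutativeRing)

-- Ordered fields (the reals are one; the statement is quantified over all
-- of them).

record OrderedField : Set₁ where
  field
    cring : CommutativeRing 0ℓ 0ℓ
  open CommutativeRing cring public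
  field
    _≤_      : Carrier → Carrier → Set
    ≤-refl   : ∀ x → x ≤ x
    ≤-trans  : ∀ {x y z} → x ≤ y → y ≤ z → x ≤ z
    ≤-antisym : ∀ {x y} → x ≤ y → y ≤ x → x ≈ y
    ≤-total  : ∀ x y → x ≤ y ⊎ y ≤ x
    ≤-resp-≈ : ∀ {x x′ y y′} → x ≈ x′ → y ≈ y′ → x ≤ y → x′ ≤ y′
    +-mono-≤ : ∀ {x y} z → x ≤ y → (x + z) ≤ (y + z)
    *-nonneg : ∀ {x y} → 0# ≤ x → 0# ≤ y → 0# ≤ (x * y)
    0≉1      : ¬ (0# ≈ 1#)
    inverse  : ∀ x → ¬ (x ≈ 0#) → Σ Carrier (λ y → (x * y) ≈ 1#)

Edge : ℕ → Set
Edge n = Σ (Fin n) λ i → Σ (Fin n) λ j → i < j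

inS : {n : ℕ} → Subset n → Fin n → Side
inS S i = lookup S i

Odd : ℕ → Set
Odd k = k % 2 ≡ 1

Even : ℕ → Set
Even k = k % 2 ≡ 0

IsTCutShore : {n : ℕ} → Subset n → Subset n → Set
IsTCutShore T S = Odd ∣ S ∩ T ∣

module OF (F : OrderedField) where
  open OrderedField F

  sumF : (k : ℕ) → (Fin k → Carrier) → Carrier
  sumF zero    f = 0#
  sumF (suc k) f = f Data.Fin.zero + sumF k (λ i → f (Data.Fin.suc i))

  edgeTerm : {n : ℕ} → (Edge n → Carrier) → Fin n → Fin n → Carrier
  edgeTerm f i j with i <? j
  ... | yes p = f (i , j , p)
  ... | no _  = 0#

  sumE : (n : ℕ) → (Edge n → Carrier) → Carrier
  sumE n f = sumF n (λ i → sumF n (λ j → edgeTerm f i j))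

  VecE : ℕ → Set
  VecE n = Edge n → Carrier

  dotE : {n : ℕ} → VecE n → VecE n → Carrier
  dotE {n} a x = sumE n (λ e → a e * x e)

  side≠ : Side → Side → Carrier
  side≠ inside  inside  = 0#
  side≠ outside outside = 0#
  side≠ inside  outside = 1#
  side≠ outside inside  = 1#

  χδ : {n : ℕ} → Subset n → VecE n
  χδ S (i , j , _) = side≠ (inS S i) (inS S j)

  combo : {n : ℕ} → List (Subset n × Carrier) → VecE n
  combo []             e = 0#
  combo ((S , w) ∷ L)  e = (w * χδ S e) + combo L e

  weightSum : {n : ℕ} → List (Subset n × Carrier) → Carrier
  weightSum []            = 0#
  weightSum ((_ , w) ∷ L) = w + weightSum L

  -- x ∈ P↑_{T-cut}(n) = conv{χ(C) : C a T-cut} + R_+^{E_n}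
  InP : (n : ℕ) → Subset n → VecE n → Set
  InP n T x =
    Σ (List (Subset n × Carrier)) λ L →
      All (λ Sw → IsTCutShore T (proj₁ Sw)) L ×
      All (λ Sw → 0# ≤ proj₂ Sw) L ×
      weightSum L ≈ 1# ×
      (∀ e → combo L e ≤ x e)

  IsVertex : (n : ℕ) → Subset n → VecE n → Set
  IsVertex n T v =
    InP n T v ×
    (∀ y z → InP n T y → InP n T z →
       (∀ e → (v e + v e) ≈ (y e + z e)) → ∀ e → y e ≈ v e)

  InRadialCone : (n : ℕ) → Subset n → VecE n → VecE n → Set
  InRadialCone n T v x =
    ∀ (a : VecE n) (β : Carrier) →
      (∀ y → InP n T y → dotE a y ≤ β) →
      dotE a v ≈ β →
      dotE a x ≤ β

  -- An extension: a polyhedron Q = {y ∈ F^d : A y ≤ b, C y = d'} with m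
  -- inequalities (equations are free) and a linear map π = M : F^d → F^{E_n}.
  record Extension (n : ℕ) : Set where
    field
      dim  : ℕ
      size : ℕ
      neq  : ℕ
      A    : Fin size → Fin dim → Carrier
      b    : Fin size → Carrier
      Ceq  : Fin neq → Fin dim → Carrier
      deq  : Fin neq → Carrier
      M    : Edge n → Fin dim → Carrier

    InQ : (Fin dim → Carrier) → Set
    InQ y = (∀ r → sumF dim (λ k → A r k * y k) ≤ b r) ×
            (∀ r → sumF dim (λ k → Ceq r k * y k) ≈ deq r)

    π : (Fin dim → Carrier) → VecE n
    π y e = sumF dim (λ k → M e k * y k)

  IsExtensionOf : {n : ℕ} → Extension n → (VecE n → Set) → Set
  IsExtensionOf {n} X S =
    (∀ x → S x → Σ (Fin (Extension.dim X) → Carrier) λ y →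
                   Extension.InQ X y × (∀ e → Extension.π X y e ≈ x e)) ×
    (∀ y → Extension.InQ X y → S (Extension.π X y))

  extSize : {n : ℕ} → Extension n → ℕ
  extSize X = Extension.size X

{-# OPTIONS --safe #-}
module Submission where

-- A vertex of the polyhedron is the characteristic vector of a T-cut δ(V), and
-- one side of it contains an odd number of at least |T|/2 nodes of T.  All but
-- two of them are arranged as three nodes followed by m pairs, the remaining
-- two being a hub and the end u of an edge uw that is the only one crossing
-- δ(V).  A vector y ∈ {0,1}^m turns an arrangement into a T-join: the three
-- nodes and the pairs with y = 1 are joined to the hub, the pairs with y = 0
-- become edges.  A vector x gives a T-cut, whose shore consists of the three
-- nodes and the pairs with x = 1.  They meet in 3 + 2 |x ∧ y| edges, so Farkas'
-- lemma turns an extension of the radial cone with r inequalities into a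
-- nonnegative factorisation of size r + 1 of the matrix 2 + 2 |x ∧ y|.
--
-- As in Rothvoß' theorem, this matrix is compared on disjoint pairs (entries 2)
-- and on pairs meeting in one coordinate i (entries 4).  Restricting x and y to
-- complementary random coordinate sets, a rank-one term can only weigh the two
-- values of a coordinate unevenly at few coordinates, unless it is
-- exponentially small; so its mass on disjoint pairs is at most slightly more
-- than its mass on the pairs meeting in i.  But the pair i and the three
-- nodes form a 5-set, which can be rotated: for meeting pairs the cut and the
-- join do not change, while a cut and a join from disjoint pairs whose triples
-- share a single node have slack 0.  The five rotations thus form a 5-cycle of
-- which at most two contribute, and 5 · 2 > 2 · 4 forces exponentially many
-- terms.

-- A T-join meets every T-cut, so its edges satisfy the inequality `1 ≤ value`. This passes to the
-- radial cone only if it is tight at the vertex, so each join used may cross δ(V) in one edge only.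
-- All freedom is therefore kept on one side of V, the one that retains a linear number of nodes.
-- The cuts are not restricted in this way, since the whole polyhedron lies in the cone. The
-- right-hand side 1 is subtracted from the 3 + 2 |x ∧ y| crossings; with a single node in place of
-- three the disjoint entries would be 0, and nothing would be left to compare.
--
-- The masks decouple x from y: `x ⊓ A` and `y ⊓ ∁ A` are disjoint for all x and y, so a rank-one
-- term becomes a product of two independent sums. "Slightly more" is a factor ((s+1)/s)² and a loss
-- of relative order 1/s; what counts is that 5 s² exceeds 4 (s+1)² + 40 s, which holds from s = 49
-- on.
--
-- Equality in an ordered field need not be decidable, yet the argument tests for zero in many
-- places. It therefore runs with doubly negated relations and ends in an inequality of natural
-- numbers, where the negations can be removed.

open import Defs
open import Level using (0ℓ)
open import Data.Nat as ℕ using (ℕ; zero; suc)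
import Data.Nat.Properties as ℕP
open import Data.Bool as Bool using (Bool; true; false; not; if_then_else_; _xor_)
import Data.Bool.Properties as BoolP
open import Data.Empty using (⊥; ⊥-elim)
open import Data.Fin as Fin using (Fin; zero; suc)
import Data.Fin.Properties as FinP
open import Data.Fin.Subset using (Subset; _∩_; ∣_∣)
open import Data.Maybe using (Maybe; just; nothing)
open import Data.List as List using (List; []; _∷_; _++_; length; concatMap; allFin)
import Data.List.Properties as ListP
open import Data.List.Membership.Propositional using (_∈_; _∉_)
import Data.List.Membership.Propositional.Properties as ∈P
open import Data.List.Relation.Unary.All as All using (All; []; _∷_)
import Data.List.Relation.Unary.All.Properties as AllP
open import Data.List.Relation.Unary.Any as Any using (Any; here; there)
open import Data.List.Relation.Unary.AllPairs using ([]; _∷_)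
open import Data.List.Relation.Unary.Unique.Propositional using (Unique)
open import Data.List.Relation.Binary.Permutation.Propositional as Perm using (_↭_; prep; swap)
import Data.List.Relation.Binary.Permutation.Propositional.Properties as PermP
open import Data.Vec as Vec using (Vec; []; _∷_; lookup; insertAt; zipWith)
import Data.Vec.Properties as VecP
open import Data.Product as Product using (Σ; ∃; _×_; _,_; proj₁; proj₂)
open import Data.Sum as Sum using (_⊎_; inj₁; inj₂)
open import Data.Unit using (⊤; tt)
open import Function using (_∘_; id)
open import Relation.Nullary using (¬_; Dec; yes; no; does)
open import Relation.Nullary.Negation using (¬¬-map)
open import Relation.Nullary.Decidable using (decidable-stable; ¬¬-excluded-middle; dec-true; dec-false)
open import Relation.Binary.PropositionalEquality as ≡ using (_≡_; _≢_; cong; cong₂; subst)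
open import Relation.Binary.Bundles using (Preorder)
import Algebra.Solver.Ring.NaturalCoefficients.Default
import Algebra.Properties.Semiring.Mult.TCOptimised
import Algebra.Properties.Ring
import Relation.Binary.Reasoning.Preorder
open import Data.List.Membership.DecPropositional using (_∈?_)
open import Function.Bundles using (mk⇔)
open import Relation.Nullary.Decidable using (does-⇔)
import Data.List.Relation.Unary.Unique.Propositional.Properties as UniqueP
import Data.List.Relation.Binary.Permutation.Setoid.Properties as SetoidPerm

-- Ordered fields and finite sums

opaque
  -- Serves both as the Boolean cube and as the set of all sequences of blocks.
  vecs : {A : Set} → List A → (m : ℕ) → List (Vec A m)
  vecs as zero    = [] ∷ []
  vecs as (suc m) = concatMap (λ a → List.map (a ∷_) (vecs as m)) as

module Ordered (F : OrderedField) where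

  open OrderedField F public hiding (zero) renaming (_≤_ to infix 4 _≤_)
  open Algebra.Properties.Ring ring public using (-‿distribˡ-*; -‿distribʳ-*; -‿involutive; -0#≈0#; -‿+-comm)
  open Algebra.Properties.Semiring.Mult.TCOptimised semiring public using (×1-homo-*; ×-homo-+) renaming (_×_ to _·_)
  open Algebra.Solver.Ring.NaturalCoefficients.Default commutativeSemiring public using (solve; _:=_; _:+_; _:*_; con)

  ≤-reflexive : ∀ {x y} → x ≈ y → x ≤ y
  ≤-reflexive x≈y = ≤-resp-≈ refl x≈y (≤-refl _)

  ≤-preorder : Preorder 0ℓ 0ℓ 0ℓ
  ≤-preorder = record
    { _≈_ = _≈_ ; _≲_ = _≤_
    ; isPreorder = record { isEquivalence = isEquivalence ; reflexive = ≤-reflexive ; trans = ≤-trans } }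

  open Relation.Binary.Reasoning.Preorder ≤-preorder public

  ι : ℕ → Carrier
  ι n = n · 1#

  ι-+ : ∀ a b → ι (a ℕ.+ b) ≈ ι a + ι b
  ι-+ = ×-homo-+ 1#

  ι-* : ∀ a b → ι (a ℕ.* b) ≈ ι a * ι b
  ι-* = ×1-homo-*

  ι-suc : ∀ a → ι (suc a) ≈ 1# + ι a
  ι-suc = ι-+ 1

  ι-^-suc : ∀ a b → ι (a ℕ.^ suc b) ≈ ι a * ι (a ℕ.^ b)
  ι-^-suc a b = ι-* a (a ℕ.^ b)

  +-mono : ∀ {a b c d} → a ≤ b → c ≤ d → a + c ≤ b + d
  +-mono {a} {b} {c} {d} p q = ≤-trans (+-mono-≤ c p) (≤-resp-≈ (+-comm c b) (+-comm d b) (+-mono-≤ b q))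

  +-cancelʳ-≈ : ∀ {a b} c → a + c ≈ b + c → a ≈ b
  +-cancelʳ-≈ {a} {b} c p = trans (sym (lem a)) (trans (+-congʳ p) (lem b))
    where
    lem : ∀ z → (z + c) + - c ≈ z
    lem z = trans (+-assoc z c (- c)) (trans (+-congˡ (-‿inverseʳ c)) (+-identityʳ z))

  +-cancelʳ : ∀ {a b} c → a + c ≤ b + c → a ≤ b
  +-cancelʳ {a} {b} c p = ≤-resp-≈ (lem a) (lem b) (+-mono-≤ (- c) p)
    where
    lem : ∀ z → (z + c) + - c ≈ z
    lem z = trans (+-assoc z c (- c)) (trans (+-congˡ (-‿inverseʳ c)) (+-identityʳ z))

  +-nonneg : ∀ {a b} → 0# ≤ a → 0# ≤ b → 0# ≤ a + b
  +-nonneg p q = ≤-resp-≈ (+-identityʳ 0#) refl (+-mono p q)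

  ≤-diff : ∀ {a b} → a ≤ b → 0# ≤ b + - a
  ≤-diff {a} p = ≤-resp-≈ (-‿inverseʳ a) refl (+-mono-≤ (- a) p)

  diff-+ : ∀ a b → (b + - a) + a ≈ b
  diff-+ a b = trans (+-assoc _ _ _) (trans (+-congˡ (-‿inverseˡ a)) (+-identityʳ b))

  diff-≤ : ∀ {a b} → 0# ≤ b + - a → a ≤ b
  diff-≤ {a} {b} p = ≤-resp-≈ (+-identityˡ a) (diff-+ a b) (+-mono-≤ a p)

  x≤x+y : ∀ {x y} → 0# ≤ y → x ≤ x + y
  x≤x+y {x} q = ≤-resp-≈ (+-identityʳ x) refl (+-mono (≤-refl x) q)

  x≤y+x : ∀ {x y} → 0# ≤ y → x ≤ y + x
  x≤y+x {x} q = ≤-resp-≈ (+-identityˡ x) refl (+-mono q (≤-refl x))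

  *-monoˡ : ∀ {a b c} → 0# ≤ c → a ≤ b → c * a ≤ c * b
  *-monoˡ {a} {b} {c} 0≤c p = ≤-resp-≈ (+-identityˡ _) eq (+-mono-≤ (c * a) (*-nonneg 0≤c (≤-diff p)))
    where
    eq : c * (b + - a) + c * a ≈ c * b
    eq = trans (sym (distribˡ c _ _)) (*-congˡ (diff-+ a b))

  *-monoʳ : ∀ {a b c} → 0# ≤ c → a ≤ b → a * c ≤ b * c
  *-monoʳ {a} {b} {c} p q = ≤-resp-≈ (*-comm c a) (*-comm c b) (*-monoˡ p q)

  *-mono : ∀ {a b c d} → 0# ≤ a → 0# ≤ d → a ≤ b → c ≤ d → a * c ≤ b * d
  *-mono 0≤a 0≤d p q = ≤-trans (*-monoˡ 0≤a q) (*-monoʳ 0≤d p)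

  0≤1 : 0# ≤ 1#
  0≤1 with ≤-total 0# 1#
  ... | inj₁ p = p
  ... | inj₂ p = ≤-resp-≈ refl eq (*-nonneg q q)
    where
    q : 0# ≤ - 1#
    q = ≤-resp-≈ refl (+-identityˡ _) (≤-diff p)
    eq : - 1# * - 1# ≈ 1#
    eq = trans (sym (-‿distribˡ-* _ _)) (trans (-‿cong (*-identityˡ _)) (-‿involutive 1#))

  1≰0 : ¬ (1# ≤ 0#)
  1≰0 p = 0≉1 (≤-antisym 0≤1 p)

  ι-nonneg : ∀ n → 0# ≤ ι n
  ι-nonneg zero    = ≤-refl 0#
  ι-nonneg (suc n) = ≤-resp-≈ refl (sym (ι-suc n)) (+-nonneg 0≤1 (ι-nonneg n))

  ι-mono : ∀ {a b} → a ℕ.≤ b → ι a ≤ ι b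
  ι-mono {a} {b} a≤b = ≤-resp-≈ refl
    (trans (sym (ι-+ a (b ℕ.∸ a))) (reflexive (cong ι (ℕP.m+[n∸m]≡n a≤b))))
    (x≤x+y (ι-nonneg (b ℕ.∸ a)))

  ι-cancel-≤ : ∀ {a b} → ι a ≤ ι b → a ℕ.≤ b
  ι-cancel-≤ {a} {b} p with a ℕ.≤? b
  ... | yes q = q
  ... | no ¬q = ⊥-elim (1≰0 (+-cancelʳ (ι b) (begin
    1# + ι b      ≈⟨ sym (ι-suc b) ⟩
    ι (suc b)     ≲⟨ ι-mono (ℕP.≰⇒> ¬q) ⟩
    ι a           ≲⟨ p ⟩
    ι b           ≈⟨ sym (+-identityˡ _) ⟩
    0# + ι b      ∎)))

  neg-flip : ∀ {x} → x ≤ 0# → 0# ≤ - x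
  neg-flip p = ≤-resp-≈ refl (+-identityˡ _) (≤-diff p)

  neg-flip′ : ∀ {x} → 0# ≤ - x → x ≤ 0#
  neg-flip′ p = diff-≤ (≤-resp-≈ refl (sym (+-identityˡ _)) p)

  square-nonneg : ∀ x → 0# ≤ x * x
  square-nonneg x with ≤-total 0# x
  ... | inj₁ p = *-nonneg p p
  ... | inj₂ p = ≤-resp-≈ refl eq (*-nonneg (neg-flip p) (neg-flip p))
    where
    eq : - x * - x ≈ x * x
    eq = trans (sym (-‿distribˡ-* _ _)) (trans (-‿cong (sym (-‿distribʳ-* _ _))) (-‿involutive _))

  inverse-nonneg : ∀ {x y} → 0# ≤ x → x * y ≈ 1# → 0# ≤ y
  inverse-nonneg {x} {y} p q = ≤-resp-≈ refl eq (*-nonneg p (square-nonneg y))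
    where
    eq : x * (y * y) ≈ y
    eq = trans (sym (*-assoc _ _ _)) (trans (*-congʳ q) (*-identityˡ y))

  *-cancelˡ-pos : ∀ {c a b} → 0# ≤ c → ¬ (c ≈ 0#) → c * a ≤ c * b → a ≤ b
  *-cancelˡ-pos {c} {a} {b} 0≤c c≉0 p with inverse c c≉0
  ... | d , cd = ≤-resp-≈ (lem a) (lem b) (*-monoˡ (inverse-nonneg 0≤c cd) p)
    where
    lem : ∀ z → d * (c * z) ≈ z
    lem z = trans (sym (*-assoc _ _ _)) (trans (*-congʳ (trans (*-comm d c) cd)) (*-identityˡ z))

  ∑ : {A : Set} → List A → (A → Carrier) → Carrier
  ∑ []       φ = 0#
  ∑ (x ∷ xs) φ = φ x + ∑ xs φ

  ∑-cong : {A : Set} (xs : List A) {φ ψ : A → Carrier} → (∀ x → φ x ≈ ψ x) → ∑ xs φ ≈ ∑ xs ψ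
  ∑-cong []       h = refl
  ∑-cong (x ∷ xs) h = +-cong (h x) (∑-cong xs h)

  ∑-mono : {A : Set} (xs : List A) {φ ψ : A → Carrier} → (∀ x → φ x ≤ ψ x) → ∑ xs φ ≤ ∑ xs ψ
  ∑-mono []       h = ≤-refl 0#
  ∑-mono (x ∷ xs) h = +-mono (h x) (∑-mono xs h)

  ∑-zero : {A : Set} (xs : List A) {φ : A → Carrier} → (∀ x → φ x ≈ 0#) → ∑ xs φ ≈ 0#
  ∑-zero []       h = refl
  ∑-zero (x ∷ xs) h = trans (+-cong (h x) (∑-zero xs h)) (+-identityʳ 0#)

  ∑-nonneg : {A : Set} (xs : List A) {φ : A → Carrier} → (∀ x → 0# ≤ φ x) → 0# ≤ ∑ xs φ
  ∑-nonneg []       h = ≤-refl 0#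
  ∑-nonneg (x ∷ xs) h = +-nonneg (h x) (∑-nonneg xs h)

  ∑-distrib-+ : {A : Set} (xs : List A) (φ ψ : A → Carrier) → ∑ xs (λ x → φ x + ψ x) ≈ ∑ xs φ + ∑ xs ψ
  ∑-distrib-+ []       φ ψ = sym (+-identityʳ 0#)
  ∑-distrib-+ (x ∷ xs) φ ψ = trans (+-congˡ (∑-distrib-+ xs φ ψ))
    (solve 4 (λ a b c d → (a :+ b) :+ (c :+ d) := (a :+ c) :+ (b :+ d)) refl (φ x) (ψ x) (∑ xs φ) (∑ xs ψ))

  ∑-*ˡ : {A : Set} (xs : List A) (c : Carrier) (φ : A → Carrier) → ∑ xs (λ x → c * φ x) ≈ c * ∑ xs φ
  ∑-*ˡ []       c φ = sym (zeroʳ c)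
  ∑-*ˡ (x ∷ xs) c φ = trans (+-congˡ (∑-*ˡ xs c φ)) (sym (distribˡ c _ _))

  ∑-*ʳ : {A : Set} (xs : List A) (c : Carrier) (φ : A → Carrier) → ∑ xs (λ x → φ x * c) ≈ ∑ xs φ * c
  ∑-*ʳ xs c φ = trans (∑-cong xs (λ x → *-comm _ c)) (trans (∑-*ˡ xs c φ) (*-comm c _))

  ∑-*-∑ : {A B : Set} (xs : List A) (ys : List B) (φ : A → Carrier) (ψ : B → Carrier) →
          ∑ xs φ * ∑ ys ψ ≈ ∑ xs (λ x → ∑ ys (λ y → φ x * ψ y))
  ∑-*-∑ xs ys φ ψ = trans (sym (∑-*ʳ xs _ φ)) (∑-cong xs (λ x → sym (∑-*ˡ ys (φ x) ψ)))

  ∑-swap : {A B : Set} (xs : List A) (ys : List B) (φ : A → B → Carrier) →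
           ∑ xs (λ x → ∑ ys (φ x)) ≈ ∑ ys (λ y → ∑ xs (λ x → φ x y))
  ∑-swap []       ys φ = sym (∑-zero ys (λ _ → refl))
  ∑-swap (x ∷ xs) ys φ = trans (+-congˡ (∑-swap xs ys φ)) (sym (∑-distrib-+ ys (φ x) _))

  ∑-const : {A : Set} (xs : List A) (c : Carrier) → ∑ xs (λ _ → c) ≈ ι (length xs) * c
  ∑-const []       c = sym (zeroˡ c)
  ∑-const (x ∷ xs) c = trans (+-cong (sym (*-identityˡ c)) (∑-const xs c))
    (trans (sym (distribʳ c 1# _)) (*-congʳ (sym (ι-suc (length xs)))))

  ∑-++ : {A : Set} (xs ys : List A) (φ : A → Carrier) → ∑ (xs ++ ys) φ ≈ ∑ xs φ + ∑ ys φ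
  ∑-++ []       ys φ = sym (+-identityˡ _)
  ∑-++ (x ∷ xs) ys φ = trans (+-congˡ (∑-++ xs ys φ)) (sym (+-assoc _ _ _))

  ∑-map : {A B : Set} (h : A → B) (xs : List A) (φ : B → Carrier) → ∑ (List.map h xs) φ ≈ ∑ xs (φ ∘ h)
  ∑-map h []       φ = refl
  ∑-map h (x ∷ xs) φ = +-congˡ (∑-map h xs φ)

  ∑-concatMap : {A B : Set} (h : A → List B) (xs : List A) (φ : B → Carrier) →
                ∑ (concatMap h xs) φ ≈ ∑ xs (λ x → ∑ (h x) φ)
  ∑-concatMap h []       φ = refl
  ∑-concatMap h (x ∷ xs) φ = trans (∑-++ (h x) _ φ) (+-congˡ (∑-concatMap h xs φ))

  ∑-↭ : {A : Set} {xs ys : List A} → xs ↭ ys → (φ : A → Carrier) → ∑ xs φ ≈ ∑ ys φ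
  ∑-↭ Perm.refl        φ = refl
  ∑-↭ (prep x p)       φ = +-congˡ (∑-↭ p φ)
  ∑-↭ (swap x y p)     φ = trans (sym (+-assoc _ _ _)) (trans (+-cong (+-comm _ _) (∑-↭ p φ)) (+-assoc _ _ _))
  ∑-↭ (Perm.trans p q) φ = trans (∑-↭ p φ) (∑-↭ q φ)

  ∑-term : {A : Set} {xs : List A} {φ : A → Carrier} → (∀ x → 0# ≤ φ x) → ∀ {x} → x ∈ xs → φ x ≤ ∑ xs φ
  ∑-term {xs = _ ∷ xs} h (here ≡.refl) = x≤x+y (∑-nonneg xs h)
  ∑-term {xs = y ∷ _}  h (there p)     = ≤-trans (∑-term h p) (x≤y+x (h y))

  opaque
    unfolding vecs

    ∑-vecs-zero : {A : Set} (as : List A) (φ : Vec A 0 → Carrier) → ∑ (vecs as 0) φ ≈ φ []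
    ∑-vecs-zero as φ = +-identityʳ (φ [])

    ∑-vecs-suc : {A : Set} (as : List A) (m : ℕ) (φ : Vec A (suc m) → Carrier) →
                 ∑ (vecs as (suc m)) φ ≈ ∑ as (λ a → ∑ (vecs as m) (λ v → φ (a ∷ v)))
    ∑-vecs-suc as m φ = trans (∑-concatMap _ as φ) (∑-cong as (λ a → ∑-map (a ∷_) (vecs as m) φ))

  -- Any coordinate can be summed out first; this isolates the coordinate, or the block, at which
  -- cut and join meet.
  ∑-vecs-insertAt : {A : Set} (as : List A) (m : ℕ) (i : Fin (suc m)) (φ : Vec A (suc m) → Carrier) →
                    ∑ (vecs as (suc m)) φ ≈ ∑ as (λ a → ∑ (vecs as m) (λ v → φ (insertAt v i a)))
  ∑-vecs-insertAt as m       zero    φ = ∑-vecs-suc as m φ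
  ∑-vecs-insertAt as (suc m) (suc i) φ = begin-equality
    ∑ (vecs as (suc (suc m))) φ
      ≈⟨ ∑-vecs-suc as (suc m) φ ⟩
    ∑ as (λ b → ∑ (vecs as (suc m)) (λ v → φ (b ∷ v)))
      ≈⟨ ∑-cong as (λ b → ∑-vecs-insertAt as m i (λ v → φ (b ∷ v))) ⟩
    ∑ as (λ b → ∑ as (λ a → ∑ (vecs as m) (λ v → φ (b ∷ insertAt v i a))))
      ≈⟨ ∑-swap as as _ ⟩
    ∑ as (λ a → ∑ as (λ b → ∑ (vecs as m) (λ v → φ (b ∷ insertAt v i a))))
      ≈⟨ ∑-cong as (λ a → sym (∑-vecs-suc as m (λ v → φ (insertAt v (suc i) a)))) ⟩
    ∑ as (λ a → ∑ (vecs as (suc m)) (λ v → φ (insertAt v (suc i) a))) ∎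

  ∑-vecs-const : {A : Set} (as : List A) (m : ℕ) (c : Carrier) →
                 ∑ (vecs as m) (λ _ → c) ≈ ι (length as ℕ.^ m) * c
  ∑-vecs-const as zero    c = trans (∑-vecs-zero as _) (sym (*-identityˡ c))
  ∑-vecs-const as (suc m) c = begin-equality
    ∑ (vecs as (suc m)) (λ _ → c)               ≈⟨ ∑-vecs-suc as m _ ⟩
    ∑ as (λ _ → ∑ (vecs as m) (λ _ → c))        ≈⟨ ∑-cong as (λ _ → ∑-vecs-const as m c) ⟩
    ∑ as (λ _ → ι (length as ℕ.^ m) * c)        ≈⟨ ∑-const as _ ⟩
    ι (length as) * (ι (length as ℕ.^ m) * c)   ≈⟨ sym (*-assoc _ _ _) ⟩
    ι (length as) * ι (length as ℕ.^ m) * c     ≈⟨ *-congʳ (sym (ι-^-suc (length as) m)) ⟩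
    ι (length as ℕ.^ suc m) * c                 ∎

  ∑-allFin-suc : (n : ℕ) (φ : Fin (suc n) → Carrier) →
                 ∑ (allFin (suc n)) φ ≈ φ zero + ∑ (allFin n) (φ ∘ suc)
  ∑-allFin-suc n φ = +-congˡ (trans (reflexive (cong (λ xs → ∑ xs φ) (≡.sym (ListP.map-tabulate id suc))))
                                    (∑-map suc (allFin n) φ))

-- Weights on the cube

opaque
  bools : List Bool
  bools = false ∷ true ∷ []

  length-bools : length bools ≡ 2
  length-bools = ≡.refl

bit : Bool → ℕ
bit true  = 1
bit false = 0

ones zeros : ∀ {m} → Vec Bool m → Vec Bool m → ℕ
ones  []      []      = 0
ones  (b ∷ β) (a ∷ x) = bit (b Bool.∧ a) ℕ.+ ones β x
zeros []      []      = 0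
zeros (b ∷ β) (a ∷ x) = bit (b Bool.∧ not a) ℕ.+ zeros β x

bit-≤1 : ∀ b → bit b ℕ.≤ 1
bit-≤1 true  = ℕP.≤-refl
bit-≤1 false = ℕ.z≤n

zeros-≤ : ∀ {m} (β x : Vec Bool m) → zeros β x ℕ.≤ m
zeros-≤ []      []      = ℕ.z≤n
zeros-≤ (b ∷ β) (a ∷ x) = ℕP.+-mono-≤ (bit-≤1 (b Bool.∧ not a)) (zeros-≤ β x)

-- With p > q the weight Z β x is D^m (p/q)^(s·zeros − (s+1)·ones − m), so
-- it exceeds D^m as soon as the zeros outnumber the ones markedly, while its
-- mean over the cube is at most c^m, which is much smaller.
record Weights : Set where
  field
    s p q c P Q D : ℕ
    0<q     : 0 ℕ.< q
    0<c     : 0 ℕ.< c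
    q≤p     : q ℕ.≤ p
    -- With t = p/q the three laws read c = D/t, P = D t^(s-1) and Q = D t^(-s-2), cleared of
    -- denominators. The common factor 1/t is the share of each coordinate in the term -m of the
    -- exponent. The last condition says that a coordinate in β has no larger mean weight than one
    -- outside.
    c-law   : c ℕ.* p ≡ D ℕ.* q
    P-law   : P ℕ.* (p ℕ.* q ℕ.^ s) ≡ D ℕ.* (q ℕ.* p ℕ.^ s)
    Q-law   : Q ℕ.* (p ℕ.* p ℕ.^ suc s) ≡ D ℕ.* (q ℕ.* q ℕ.^ suc s)
    P+Q≤2c  : P ℕ.+ Q ℕ.≤ 2 ℕ.* c

  weight : Bool → Bool → ℕ
  weight false _     = c
  weight true  false = P
  weight true  true  = Q

  Z : ∀ {m} → Vec Bool m → Vec Bool m → ℕ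
  Z []      []      = 1
  Z (b ∷ β) (a ∷ x) = weight b a ℕ.* Z β x

  -- The exponent of p/q in Z / D^m is `upper` - `lower`; keeping the two parts separate avoids
  -- subtraction.
  lower upper : ∀ {m} → Vec Bool m → Vec Bool m → ℕ
  lower {m} β x = suc s ℕ.* ones β x ℕ.+ m
  upper     β x = s ℕ.* zeros β x

  lowerStep upperStep : Bool → Bool → ℕ
  lowerStep b a = suc s ℕ.* bit (b Bool.∧ a) ℕ.+ 1
  upperStep b a = s ℕ.* bit (b Bool.∧ not a)

  lower-∷ : ∀ {m} b a (β x : Vec Bool m) → lower (b ∷ β) (a ∷ x) ≡ lowerStep b a ℕ.+ lower β x
  lower-∷ {m} b a β x = lem (suc s) (bit (b Bool.∧ a)) (ones β x) m
    where
    open import Data.Nat.Solver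
    open +-*-Solver
    lem : ∀ t u o k → t ℕ.* (u ℕ.+ o) ℕ.+ suc k ≡ (t ℕ.* u ℕ.+ 1) ℕ.+ (t ℕ.* o ℕ.+ k)
    lem = solve 4 (λ t u o k → t :* (u :+ o) :+ (con 1 :+ k) := (t :* u :+ con 1) :+ (t :* o :+ k)) ≡.refl

  upper-∷ : ∀ {m} b a (β x : Vec Bool m) → upper (b ∷ β) (a ∷ x) ≡ upperStep b a ℕ.+ upper β x
  upper-∷ b a β x = ℕP.*-distribˡ-+ s (bit (b Bool.∧ not a)) (zeros β x)

  weight-law : ∀ b a → weight b a ℕ.* (p ℕ.^ lowerStep b a ℕ.* q ℕ.^ upperStep b a)
                       ≡ D ℕ.* (p ℕ.^ upperStep b a ℕ.* q ℕ.^ lowerStep b a)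
  weight-law false a rewrite ℕP.*-zeroʳ s = begin
    c ℕ.* (p ℕ.* 1 ℕ.* 1)       ≡⟨ cong (c ℕ.*_) (≡.trans (ℕP.*-identityʳ _) (ℕP.*-identityʳ p)) ⟩
    c ℕ.* p                     ≡⟨ c-law ⟩
    D ℕ.* q                     ≡⟨ cong (D ℕ.*_) (≡.sym (≡.trans (ℕP.*-identityˡ _) (ℕP.*-identityʳ q))) ⟩
    D ℕ.* (1 ℕ.* (q ℕ.* 1))     ∎
    where open ≡.≡-Reasoning
  weight-law true false rewrite ℕP.*-zeroʳ s | ℕP.*-identityʳ s
    | ℕP.*-identityʳ p | ℕP.*-identityʳ q | ℕP.*-comm (p ℕ.^ s) q = P-law
  weight-law true true rewrite ℕP.*-zeroʳ s | ℕP.*-identityʳ s | ℕP.+-comm s 1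
    | ℕP.*-identityʳ (p ℕ.* (p ℕ.* p ℕ.^ s)) | ℕP.+-identityʳ (q ℕ.* (q ℕ.* q ℕ.^ s)) = Q-law

  Z-law : ∀ {m} (β x : Vec Bool m) →
          Z β x ℕ.* (p ℕ.^ lower β x ℕ.* q ℕ.^ upper β x) ≡ D ℕ.^ m ℕ.* (p ℕ.^ upper β x ℕ.* q ℕ.^ lower β x)
  Z-law [] [] rewrite ℕP.*-zeroʳ s = ≡.refl
  Z-law {suc m} (b ∷ β) (a ∷ x)
    rewrite lower-∷ b a β x | upper-∷ b a β x
      | ℕP.^-distribˡ-+-* p (lowerStep b a) (lower β x) | ℕP.^-distribˡ-+-* q (upperStep b a) (upper β x)
      | ℕP.^-distribˡ-+-* p (upperStep b a) (upper β x) | ℕP.^-distribˡ-+-* q (lowerStep b a) (lower β x) = begin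
    w ℕ.* Z β x ℕ.* (pl₁ ℕ.* pl ℕ.* (qu₁ ℕ.* qu))         ≡⟨ exchange w (Z β x) pl₁ pl qu₁ qu ⟩
    w ℕ.* (pl₁ ℕ.* qu₁) ℕ.* (Z β x ℕ.* (pl ℕ.* qu))       ≡⟨ cong₂ ℕ._*_ (weight-law b a) (Z-law β x) ⟩
    D ℕ.* (pu₁ ℕ.* ql₁) ℕ.* (D ℕ.^ m ℕ.* (pu ℕ.* ql))     ≡⟨ exchange D (D ℕ.^ m) pu₁ pu ql₁ ql ⟨
    D ℕ.* D ℕ.^ m ℕ.* (pu₁ ℕ.* pu ℕ.* (ql₁ ℕ.* ql))       ∎
    where
    open import Data.Nat.Solver
    open +-*-Solver
    open ≡.≡-Reasoning
    w = weight b a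
    pl₁ = p ℕ.^ lowerStep b a
    pl  = p ℕ.^ lower β x
    qu₁ = q ℕ.^ upperStep b a
    qu  = q ℕ.^ upper β x
    pu₁ = p ℕ.^ upperStep b a
    pu  = p ℕ.^ upper β x
    ql₁ = q ℕ.^ lowerStep b a
    ql  = q ℕ.^ lower β x
    exchange : ∀ u v x₁ x y₁ y → u ℕ.* v ℕ.* (x₁ ℕ.* x ℕ.* (y₁ ℕ.* y)) ≡ u ℕ.* (x₁ ℕ.* y₁) ℕ.* (v ℕ.* (x ℕ.* y))
    exchange = solve 6 (λ u v x₁ x y₁ y → u :* v :* (x₁ :* x :* (y₁ :* y)) := u :* (x₁ :* y₁) :* (v :* (x :* y))) ≡.refl

  Z-large : ∀ {m} (β x : Vec Bool m) → lower β x ℕ.≤ upper β x → D ℕ.^ m ℕ.≤ Z β x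
  Z-large {m} β x l≤u = ℕP.*-cancelʳ-≤ (D ℕ.^ m) (Z β x) (p ℕ.^ l ℕ.* q ℕ.^ u) {{ℕ.>-nonZero pos}} (begin
    D ℕ.^ m ℕ.* (p ℕ.^ l ℕ.* q ℕ.^ u)                           ≡⟨ cong (λ t → D ℕ.^ m ℕ.* (p ℕ.^ l ℕ.* q ℕ.^ t)) u≡ ⟩
    D ℕ.^ m ℕ.* (p ℕ.^ l ℕ.* q ℕ.^ (d ℕ.+ l))                   ≡⟨ cong (λ t → D ℕ.^ m ℕ.* (p ℕ.^ l ℕ.* t)) (ℕP.^-distribˡ-+-* q d l) ⟩
    D ℕ.^ m ℕ.* (p ℕ.^ l ℕ.* (q ℕ.^ d ℕ.* q ℕ.^ l))             ≤⟨ ℕP.*-monoʳ-≤ (D ℕ.^ m) (ℕP.*-monoʳ-≤ (p ℕ.^ l) (ℕP.*-monoˡ-≤ (q ℕ.^ l) (ℕP.^-monoˡ-≤ d q≤p))) ⟩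
    D ℕ.^ m ℕ.* (p ℕ.^ l ℕ.* (p ℕ.^ d ℕ.* q ℕ.^ l))             ≡⟨ cong (D ℕ.^ m ℕ.*_) (≡.sym (ℕP.*-assoc (p ℕ.^ l) (p ℕ.^ d) (q ℕ.^ l))) ⟩
    D ℕ.^ m ℕ.* (p ℕ.^ l ℕ.* p ℕ.^ d ℕ.* q ℕ.^ l)               ≡⟨ cong (λ t → D ℕ.^ m ℕ.* (t ℕ.* q ℕ.^ l)) (≡.trans (≡.sym (ℕP.^-distribˡ-+-* p l d)) (cong (p ℕ.^_) (≡.trans (ℕP.+-comm l d) (≡.sym u≡)))) ⟩
    D ℕ.^ m ℕ.* (p ℕ.^ u ℕ.* q ℕ.^ l)                           ≡⟨ Z-law β x ⟨
    Z β x ℕ.* (p ℕ.^ l ℕ.* q ℕ.^ u)                             ∎)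
    where
    open ℕP.≤-Reasoning
    l = lower β x
    u = upper β x
    d = u ℕ.∸ l
    u≡ : u ≡ d ℕ.+ l
    u≡ = ≡.sym (ℕP.m∸n+n≡m l≤u)
    instance
      q≢0 : ℕ.NonZero q
      q≢0 = ℕ.>-nonZero 0<q
      p≢0 : ℕ.NonZero p
      p≢0 = ℕ.>-nonZero (ℕP.<-≤-trans 0<q q≤p)
    pos : 0 ℕ.< p ℕ.^ l ℕ.* q ℕ.^ u
    pos = ℕP.*-mono-< (ℕP.m^n>0 p l) (ℕP.m^n>0 q u)

  -- A pointwise Chernoff bound: either the exponent of Z is negative or zero and the first term
  -- suffices, or Z is at least D^m and pays for all of s · zeros, which is at most s · m.
  surplus-≤ : ∀ {m} (β x : Vec Bool m) →
              D ℕ.^ m ℕ.* (s ℕ.* zeros β x) ℕ.≤ D ℕ.^ m ℕ.* (suc s ℕ.* ones β x ℕ.+ m) ℕ.+ s ℕ.* m ℕ.* Z β x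
  surplus-≤ {m} β x with ℕP.≤-total (lower β x) (upper β x)
  ... | inj₂ u≤l = ℕP.≤-trans (ℕP.*-monoʳ-≤ (D ℕ.^ m) u≤l) (ℕP.m≤m+n _ _)
  ... | inj₁ l≤u = ℕP.≤-trans (begin
    D ℕ.^ m ℕ.* (s ℕ.* zeros β x)     ≤⟨ ℕP.*-mono-≤ (Z-large β x l≤u) (ℕP.*-monoʳ-≤ s (zeros-≤ β x)) ⟩
    Z β x ℕ.* (s ℕ.* m)               ≡⟨ ℕP.*-comm (Z β x) (s ℕ.* m) ⟩
    s ℕ.* m ℕ.* Z β x                 ∎) (ℕP.m≤n+m _ _)
    where open ℕP.≤-Reasoning

-- Functions on the cube

infixr 7 _⊓_
_⊓_ : ∀ {m} → Vec Bool m → Vec Bool m → Vec Bool m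
_⊓_ = zipWith Bool._∧_

∁ : ∀ {m} → Vec Bool m → Vec Bool m
∁ = Vec.map not


module Cube (F : OrderedField) (W : Weights) where

  open Ordered F
  open Weights W

  cube : (m : ℕ) → List (Vec Bool m)
  cube = vecs bools

  opaque
    unfolding bools

    ∑-bools : (φ : Bool → Carrier) → ∑ bools φ ≈ φ false + φ true
    ∑-bools φ = +-congˡ (+-identityʳ _)

  ∑-weight : ∀ b → ∑ bools (λ a → ι (weight b a)) ≤ ι (2 ℕ.* c)
  ∑-weight false = ≤-reflexive (trans (∑-bools _)
    (trans (sym (ι-+ c c)) (reflexive (cong ι (cong (c ℕ.+_) (≡.sym (ℕP.+-identityʳ c)))))))
  ∑-weight true  = ≤-resp-≈ (trans (ι-+ P Q) (sym (∑-bools _))) refl (ι-mono P+Q≤2c)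

  -- Z is a product over the coordinates and each factor has mean at most c, whatever β is. The
  -- bound must be uniform because β will depend on the rank-one term and on the mask.
  ∑-Z : ∀ {m} (β : Vec Bool m) → ∑ (cube m) (λ x → ι (Z β x)) ≤ ι ((2 ℕ.* c) ℕ.^ m)
  ∑-Z []                = ≤-reflexive (∑-vecs-zero bools _)
  ∑-Z {suc m} (b ∷ β) = begin
    ∑ (cube (suc m)) (λ x → ι (Z (b ∷ β) x))
      ≈⟨ ∑-vecs-suc bools m _ ⟩
    ∑ bools (λ a → ∑ (cube m) (λ x → ι (weight b a ℕ.* Z β x)))
      ≈⟨ ∑-cong bools (λ a → trans (∑-cong (cube m) (λ x → ι-* (weight b a) (Z β x))) (∑-*ˡ (cube m) _ _)) ⟩
    ∑ bools (λ a → ι (weight b a) * ∑ (cube m) (λ x → ι (Z β x)))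
      ≈⟨ ∑-*ʳ bools _ _ ⟩
    ∑ bools (λ a → ι (weight b a)) * ∑ (cube m) (λ x → ι (Z β x))
      ≲⟨ *-mono (∑-nonneg bools (λ a → ι-nonneg (weight b a))) (ι-nonneg ((2 ℕ.* c) ℕ.^ m)) (∑-weight b) (∑-Z β) ⟩
    ι (2 ℕ.* c) * ι ((2 ℕ.* c) ℕ.^ m)
      ≈⟨ sym (ι-^-suc (2 ℕ.* c) m) ⟩
    ι ((2 ℕ.* c) ℕ.^ suc m) ∎

  ones-∑ : ∀ {m} (β x : Vec Bool m) →
           ι (ones β x) ≈ ∑ (allFin m) (λ i → ι (bit (lookup β i Bool.∧ lookup x i)))
  ones-∑ []      []      = refl
  ones-∑ {suc m} (b ∷ β) (a ∷ x) =
    trans (ι-+ (bit (b Bool.∧ a)) _) (trans (+-congˡ (ones-∑ β x)) (sym (∑-allFin-suc m _)))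

  zeros-∑ : ∀ {m} (β x : Vec Bool m) →
            ι (zeros β x) ≈ ∑ (allFin m) (λ i → ι (bit (lookup β i Bool.∧ not (lookup x i))))
  zeros-∑ []      []      = refl
  zeros-∑ {suc m} (b ∷ β) (a ∷ x) =
    trans (ι-+ (bit (b Bool.∧ not a)) _) (trans (+-congˡ (zeros-∑ β x)) (sym (∑-allFin-suc m _)))

  half : ∀ {m} → (Vec Bool (suc m) → Carrier) → Fin (suc m) → Bool → Carrier
  half {m} h i a = ∑ (cube m) (λ x → h (insertAt x i a))

  ∑-coordinate : ∀ {m} (h : Vec Bool (suc m) → Carrier) (i : Fin (suc m)) (χ : Bool → Carrier) →
                 ∑ (cube (suc m)) (λ x → h x * χ (lookup x i)) ≈ half h i false * χ false + half h i true * χ true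
  ∑-coordinate {m} h i χ = trans (∑-vecs-insertAt bools m i _)
    (trans (∑-bools _) (+-cong (part false) (part true)))
    where
    part : ∀ a → ∑ (cube m) (λ x → h (insertAt x i a) * χ (lookup (insertAt x i a) i)) ≈ half h i a * χ a
    part a = trans (∑-cong (cube m) (λ x → *-congˡ (reflexive (cong χ (VecP.insertAt-lookup x i a)))))
                   (∑-*ʳ (cube m) (χ a) _)

  half-true : ∀ {m} (h : Vec Bool (suc m) → Carrier) (i : Fin (suc m)) b →
              ι (bit b) * half h i true ≈ ∑ (cube (suc m)) (λ x → h x * ι (bit (b Bool.∧ lookup x i)))
  half-true h i true  = sym (trans (∑-coordinate h i (λ a → ι (bit a)))
    (trans (+-cong (zeroʳ _) (*-comm _ _)) (+-identityˡ _)))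
  half-true h i false = sym (trans (∑-zero (cube _) (λ x → zeroʳ _)) (sym (zeroˡ _)))

  half-false : ∀ {m} (h : Vec Bool (suc m) → Carrier) (i : Fin (suc m)) b →
               ι (bit b) * half h i false ≈ ∑ (cube (suc m)) (λ x → h x * ι (bit (b Bool.∧ not (lookup x i))))
  half-false h i true  = sym (trans (∑-coordinate h i (λ a → ι (bit (not a))))
    (trans (+-cong (*-comm _ _) (zeroʳ _)) (+-identityʳ _)))
  half-false h i false = sym (trans (∑-zero (cube _) (λ x → zeroʳ _)) (sym (zeroˡ _)))

  -- For nonnegative `e` this is the positive part of s · half false - (s+1) · half true. The
  -- disjunction is data: its chosen side tells which coordinates are active, without deciding the
  -- order anew.
  Excess : ∀ {m} → (Vec Bool (suc m) → Carrier) → (Fin (suc m) → Carrier) → Set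
  Excess h e = ∀ i → (e i ≈ 0#) ⊎ (ι (suc s) * half h i true + e i ≈ ι s * half h i false)

  module _ {m : ℕ} (h : Vec Bool (suc m) → Carrier) (0≤h : ∀ x → 0# ≤ h x)
           (e : Fin (suc m) → Carrier) (excess : Excess h e) where

    private
      M = suc m

      active : ∀ i → (e i ≈ 0#) ⊎ (ι (suc s) * half h i true + e i ≈ ι s * half h i false) → Bool
      active i (inj₁ _) = false
      active i (inj₂ _) = true

      balance : ∀ i (d : (e i ≈ 0#) ⊎ (ι (suc s) * half h i true + e i ≈ ι s * half h i false)) →
                ι (suc s) * (ι (bit (active i d)) * half h i true) + e i ≈ ι s * (ι (bit (active i d)) * half h i false)
      balance i (inj₁ p) = trans (+-cong (trans (*-congˡ (zeroˡ _)) (zeroʳ _)) p)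
        (trans (+-identityʳ 0#) (sym (trans (*-congˡ (zeroˡ _)) (zeroʳ _))))
      balance i (inj₂ p) = trans (+-congʳ (*-congˡ (*-identityˡ _))) (trans p (sym (*-congˡ (*-identityˡ _))))

    activeSet : Vec Bool (suc m)
    activeSet = Vec.tabulate (λ i → active i (excess i))

    private
      β = activeSet

      balance′ : ∀ i → ι (suc s) * (ι (bit (lookup β i)) * half h i true) + e i ≈ ι s * (ι (bit (lookup β i)) * half h i false)
      balance′ i rewrite VecP.lookup∘tabulate (λ j → active j (excess j)) i = balance i (excess i)

      total : (χ : Vec Bool M → Carrier) (k : Fin M → Vec Bool M → Carrier) (g : Fin M → Carrier) →
              (∀ i → g i ≈ ∑ (cube M) (λ x → h x * k i x)) → (∀ x → χ x ≈ ∑ (allFin M) (λ i → k i x)) →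
              ∑ (allFin M) g ≈ ∑ (cube M) (λ x → h x * χ x)
      total χ k g p r = begin-equality
        ∑ (allFin M) g                                        ≈⟨ ∑-cong (allFin M) p ⟩
        ∑ (allFin M) (λ i → ∑ (cube M) (λ x → h x * k i x))   ≈⟨ ∑-swap (allFin M) (cube M) _ ⟩
        ∑ (cube M) (λ x → ∑ (allFin M) (λ i → h x * k i x))   ≈⟨ ∑-cong (cube M) (λ x → trans (∑-*ˡ (allFin M) (h x) _) (*-congˡ (sym (r x)))) ⟩
        ∑ (cube M) (λ x → h x * χ x)                          ∎

      O S : Carrier
      O = ∑ (cube M) (λ x → h x * ι (ones β x))
      S = ∑ (cube M) (λ x → h x * ι (zeros β x))

      E : Carrier
      E = ∑ (allFin M) e

      identity : ι (suc s) * O + E ≈ ι s * S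
      identity = begin-equality
        ι (suc s) * O + E
          ≈⟨ +-congʳ (trans (*-congˡ (sym (total _ _ _ (λ i → half-true h i (lookup β i)) (ones-∑ β)))) (sym (∑-*ˡ (allFin M) _ _))) ⟩
        ∑ (allFin M) (λ i → ι (suc s) * (ι (bit (lookup β i)) * half h i true)) + E
          ≈⟨ sym (∑-distrib-+ (allFin M) _ _) ⟩
        ∑ (allFin M) (λ i → ι (suc s) * (ι (bit (lookup β i)) * half h i true) + e i)
          ≈⟨ ∑-cong (allFin M) balance′ ⟩
        ∑ (allFin M) (λ i → ι s * (ι (bit (lookup β i)) * half h i false))
          ≈⟨ ∑-*ˡ (allFin M) _ _ ⟩
        ι s * ∑ (allFin M) (λ i → ι (bit (lookup β i)) * half h i false)
          ≈⟨ *-congˡ (total _ _ _ (λ i → half-false h i (lookup β i)) (zeros-∑ β)) ⟩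
        ι s * S ∎

      DM : Carrier
      DM = ι (D ℕ.^ M)

      pointwise : ∀ x → DM * (ι s * ι (zeros β x)) ≤ DM * (ι (suc s) * ι (ones β x) + ι M) + ι (s ℕ.* M) * ι (Z β x)
      pointwise x = ≤-resp-≈
        (trans (ι-* (D ℕ.^ M) _) (*-congˡ (ι-* s (zeros β x))))
        (trans (ι-+ (D ℕ.^ M ℕ.* (suc s ℕ.* ones β x ℕ.+ M)) _)
          (+-cong (trans (ι-* (D ℕ.^ M) _) (*-congˡ (trans (ι-+ (suc s ℕ.* ones β x) M) (+-congʳ (ι-* (suc s) (ones β x))))))
                  (ι-* (s ℕ.* M) (Z β x))))
        (ι-mono (surplus-≤ β x))

    -- Added up over the active coordinates, the excesses become the h-weighted sum of s · zeros -
    -- (s+1) · ones, which `surplus-≤` bounds point by point. The first term allows one unit of mass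
    -- per coordinate, small against the s units in the definition of the excess; the second is
    -- exponentially small unless h is concentrated.
    excess-sum-≤ : DM * E ≤ DM * (ι M * ∑ (cube M) h) + ι (s ℕ.* M) * ∑ (cube M) (λ x → h x * ι (Z β x))
    excess-sum-≤ = +-cancelʳ (DM * (ι (suc s) * O)) (begin
      DM * E + DM * (ι (suc s) * O)
        ≈⟨ trans (sym (distribˡ _ _ _)) (*-congˡ (trans (+-comm _ _) identity)) ⟩
      DM * (ι s * S)
        ≈⟨ trans (sym (*-assoc _ _ _)) (sym (∑-*ˡ (cube M) _ _)) ⟩
      ∑ (cube M) (λ x → DM * ι s * (h x * ι (zeros β x)))
        ≲⟨ ∑-mono (cube M) (λ x → ≤-resp-≈
             (solve 4 (λ d t u v → u :* (d :* (t :* v)) := d :* t :* (u :* v)) refl DM (ι s) (h x) (ι (zeros β x)))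
             (solve 7 (λ d t u o k v z → u :* (d :* (t :* o :+ k) :+ v :* z)
                         := (d :* (k :* u) :+ v :* (u :* z)) :+ d :* (t :* (u :* o)))
                refl DM (ι (suc s)) (h x) (ι (ones β x)) (ι M) (ι (s ℕ.* M)) (ι (Z β x)))
             (*-monoˡ (0≤h x) (pointwise x))) ⟩
      ∑ (cube M) (λ x → (DM * (ι M * h x) + ι (s ℕ.* M) * (h x * ι (Z β x))) + DM * (ι (suc s) * (h x * ι (ones β x))))
        ≈⟨ trans (∑-distrib-+ (cube M) _ _) (+-cong (trans (∑-distrib-+ (cube M) _ _)
             (+-cong (trans (∑-*ˡ (cube M) _ _) (*-congˡ (∑-*ˡ (cube M) _ _))) (∑-*ˡ (cube M) _ _)))
             (trans (∑-*ˡ (cube M) _ _) (*-congˡ (∑-*ˡ (cube M) _ _)))) ⟩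
      (DM * (ι M * ∑ (cube M) h) + ι (s ℕ.* M) * ∑ (cube M) (λ x → h x * ι (Z β x))) + DM * (ι (suc s) * O) ∎)

-- Restriction to complementary coordinate sets

zipWith-insertAt : {A B C : Set} (f : A → B → C) {m : ℕ} (u : Vec A m) (v : Vec B m) (i : Fin (suc m)) (a : A) (b : B) →
                   zipWith f (insertAt u i a) (insertAt v i b) ≡ insertAt (zipWith f u v) i (f a b)
zipWith-insertAt f u       v       zero    a b = ≡.refl
zipWith-insertAt f (x ∷ u) (y ∷ v) (suc i) a b = cong (f x y ∷_) (zipWith-insertAt f u v i a b)

ones-insertAt : ∀ {m} (u v : Vec Bool m) i a b → ones (insertAt u i a) (insertAt v i b) ≡ bit (a Bool.∧ b) ℕ.+ ones u v
ones-insertAt u       v       zero    a b = ≡.refl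
ones-insertAt (x ∷ u) (y ∷ v) (suc i) a b rewrite ones-insertAt u v i a b =
  ≡.trans (≡.sym (ℕP.+-assoc (bit (x Bool.∧ y)) (bit (a Bool.∧ b)) (ones u v)))
    (≡.trans (cong (ℕ._+ ones u v) (ℕP.+-comm (bit (x Bool.∧ y)) (bit (a Bool.∧ b))))
      (ℕP.+-assoc (bit (a Bool.∧ b)) (bit (x Bool.∧ y)) (ones u v)))

ones-masked : ∀ {m} (x y A : Vec Bool m) → ones (x ⊓ A) (y ⊓ ∁ A) ≡ 0
ones-masked []      []      []          = ≡.refl
ones-masked (a ∷ x) (b ∷ y) (true ∷ A)  rewrite BoolP.∧-zeroʳ b | BoolP.∧-zeroʳ (a Bool.∧ true) = ones-masked x y A
ones-masked (a ∷ x) (b ∷ y) (false ∷ A) rewrite BoolP.∧-zeroʳ a = ones-masked x y A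

∁-involutive : ∀ {m} (A : Vec Bool m) → ∁ (∁ A) ≡ A
∁-involutive []      = ≡.refl
∁-involutive (a ∷ A) = cong₂ _∷_ (BoolP.not-involutive a) (∁-involutive A)

ones-comm : ∀ {m} (x y : Vec Bool m) → ones x y ≡ ones y x
ones-comm []      []      = ≡.refl
ones-comm (a ∷ x) (b ∷ y) = cong₂ (λ t u → bit t ℕ.+ u) (BoolP.∧-comm a b) (ones-comm x y)

^-distribʳ-* : ∀ m a b → (a ℕ.* b) ℕ.^ m ≡ a ℕ.^ m ℕ.* b ℕ.^ m
^-distribʳ-* zero    a b = ≡.refl
^-distribʳ-* (suc m) a b = ≡.trans (cong (a ℕ.* b ℕ.*_) (^-distribʳ-* m a b))
  (ℕP.[m*n]*[o*p]≡[m*o]*[n*p] a b (a ℕ.^ m) (b ℕ.^ m))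

module Masked (F : OrderedField) (W : Weights) where

  open Ordered F
  open Weights W
  open Cube F W

  pos : Carrier → Carrier → Carrier
  pos a b with ≤-total a b
  ... | inj₁ _ = 0#
  ... | inj₂ _ = a + - b

  pos-nonneg : ∀ a b → 0# ≤ pos a b
  pos-nonneg a b with ≤-total a b
  ... | inj₁ _   = ≤-refl 0#
  ... | inj₂ b≤a = ≤-diff b≤a

  pos-bound : ∀ a b → a ≤ b + pos a b
  pos-bound a b with ≤-total a b
  ... | inj₁ a≤b = ≤-resp-≈ refl (sym (+-identityʳ b)) a≤b
  ... | inj₂ _   = ≤-reflexive (sym (trans (+-comm b _) (diff-+ b a)))

  pos-cases : ∀ a b → (pos a b ≈ 0#) ⊎ (b + pos a b ≈ a)
  pos-cases a b with ≤-total a b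
  ... | inj₁ _ = inj₁ refl
  ... | inj₂ _ = inj₂ (trans (+-comm b _) (diff-+ b a))

  slice : ∀ {m} → (Vec Bool (suc m) → Carrier) → Fin (suc m) → Bool → Vec Bool m → Carrier
  slice {m} φ i a A = ∑ (cube m) (λ x → φ (insertAt (x ⊓ A) i a))

  masked : ∀ {m} → (Vec Bool m → Carrier) → Vec Bool m → Vec Bool m → Carrier
  masked φ A x = φ (x ⊓ A)

  -- The amount by which s · half false ≤ (s+1) · half true fails at i for the masked function.
  surplus : ∀ {m} → (Vec Bool (suc m) → Carrier) → Vec Bool (suc m) → Fin (suc m) → Carrier
  surplus φ A i = pos (ι s * half (masked φ A) i false) (ι (suc s) * half (masked φ A) i true)

  slice-half : ∀ {m} (φ : Vec Bool (suc m) → Carrier) i a (A : Vec Bool m) →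
               half (masked φ (insertAt A i true)) i a ≈ slice φ i a A
  slice-half {m} φ i a A = ∑-cong (cube m) (λ x → reflexive (cong φ
    (≡.trans (zipWith-insertAt Bool._∧_ x A i a true) (cong (insertAt (x ⊓ A) i) (BoolP.∧-identityʳ a)))))

  slice-bound : ∀ {m} (φ : Vec Bool (suc m) → Carrier) i (A : Vec Bool m) →
                ι s * slice φ i false A ≤ ι (suc s) * slice φ i true A + surplus φ (insertAt A i true) i
  slice-bound φ i A = ≤-resp-≈ (*-congˡ (slice-half φ i false A)) (+-congʳ (*-congˡ (slice-half φ i true A)))
    (pos-bound _ _)

  slice-nonneg : ∀ {m} {φ : Vec Bool (suc m) → Carrier} → (∀ x → 0# ≤ φ x) → ∀ i a A → 0# ≤ slice φ i a A
  slice-nonneg {m} 0≤φ i a A = ∑-nonneg (cube m) (λ x → 0≤φ _)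

  module _ {m : ℕ} (R : ℕ) (φ ψ : Fin R → Vec Bool (suc m) → Carrier)
           (0≤φ : ∀ r x → 0# ≤ φ r x) (0≤ψ : ∀ r y → 0# ≤ ψ r y)
           (slack : ∀ x y → ones x y ≡ 0 → ∑ (allFin R) (λ r → φ r x * ψ r y) ≈ ι 2) where

    private
      M = suc m
      K DM : Carrier
      K = ι (2 ℕ.^ M)
      DM = ι (D ℕ.^ M)

      rs : List (Fin R)
      rs = allFin R

    -- Each surplus of `φ r` is weighted by the mass that `ψ r` has on the complementary mask. Since
    -- i belongs to the mask of φ, the argument of ψ is `false` at i.
    excessTotal : Carrier
    excessTotal = ∑ (allFin M) (λ i → ∑ (cube m) (λ A →
      ∑ rs (λ r → surplus (φ r) (insertAt A i true) i * slice (ψ r) i false (∁ A))))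

    private
      Ψ : Vec Bool M → Fin R → Carrier
      Ψ A r = ∑ (cube M) (λ y → ψ r (y ⊓ ∁ A))

      0≤Ψ : ∀ A r → 0# ≤ Ψ A r
      0≤Ψ A r = ∑-nonneg (cube M) (λ y → 0≤ψ r _)

      cube-const : ∀ k c′ → ∑ (cube k) (λ _ → c′) ≈ ι (2 ℕ.^ k) * c′
      cube-const k c′ = trans (∑-vecs-const bools k c′) (*-congʳ (reflexive (cong (λ t → ι (t ℕ.^ k)) length-bools)))

      0≤surplus : ∀ r A i → 0# ≤ surplus (φ r) A i
      0≤surplus r A i = pos-nonneg _ _

      -- The complementary mask erases coordinate i, so both values of that bit of y give the same
      -- argument.
      double-slice : ∀ r i (A : Vec Bool m) → Ψ (insertAt A i true) r ≈ ι 2 * slice (ψ r) i false (∁ A)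
      double-slice r i A = begin-equality
        Ψ (insertAt A i true) r
          ≈⟨ ∑-vecs-insertAt bools m i _ ⟩
        ∑ bools (λ b → ∑ (cube m) (λ y → ψ r (insertAt y i b ⊓ ∁ (insertAt A i true))))
          ≈⟨ ∑-cong bools (λ b → ∑-cong (cube m) (λ y → reflexive (cong (ψ r) (eq b y)))) ⟩
        ∑ bools (λ b → slice (ψ r) i false (∁ A))
          ≈⟨ ∑-const bools _ ⟩
        ι (length bools) * slice (ψ r) i false (∁ A)
          ≈⟨ *-congʳ (reflexive (cong ι length-bools)) ⟩
        ι 2 * slice (ψ r) i false (∁ A) ∎
        where
        eq : ∀ b y → insertAt y i b ⊓ ∁ (insertAt A i true) ≡ insertAt (y ⊓ ∁ A) i false
        eq b y = ≡.trans (cong (insertAt y i b ⊓_) (VecP.map-insertAt not true A i))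
          (≡.trans (zipWith-insertAt Bool._∧_ y (∁ A) i b false) (cong (insertAt (y ⊓ ∁ A) i) (BoolP.∧-zeroʳ b)))

      -- Masked vectors never meet, so after summing over r every entry is 2.
      mass : ∀ A x → ∑ rs (λ r → masked (φ r) A x * Ψ A r) ≈ K * ι 2
      mass A x = begin-equality
        ∑ rs (λ r → φ r (x ⊓ A) * Ψ A r)
          ≈⟨ ∑-cong rs (λ r → sym (∑-*ˡ (cube M) _ _)) ⟩
        ∑ rs (λ r → ∑ (cube M) (λ y → φ r (x ⊓ A) * ψ r (y ⊓ ∁ A)))
          ≈⟨ ∑-swap rs (cube M) _ ⟩
        ∑ (cube M) (λ y → ∑ rs (λ r → φ r (x ⊓ A) * ψ r (y ⊓ ∁ A)))
          ≈⟨ ∑-cong (cube M) (λ y → slack _ _ (ones-masked x y A)) ⟩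
        ∑ (cube M) (λ y → ι 2)
          ≈⟨ cube-const M (ι 2) ⟩
        K * ι 2 ∎

      excess : ∀ A r → Excess (masked (φ r) A) (surplus (φ r) A)
      excess A r i = pos-cases _ _

      β : ∀ A r → Vec Bool M
      β A r = activeSet (masked (φ r) A) (λ x → 0≤φ r _) (surplus (φ r) A) (excess A r)

      B : Carrier
      B = DM * (ι M * (K * (K * ι 2))) + ι (s ℕ.* M) * (ι R * ((K * ι 2) * ι ((2 ℕ.* c) ℕ.^ M)))

      -- The weights `Ψ A r` turn the masses of the terms into their share of the matrix. The
      -- allowance of one unit per coordinate then costs the total mass once, independently of R;
      -- only the exponentially small part is paid R times.
      perMask : ∀ A → ∑ rs (λ r → DM * (∑ (allFin M) (surplus (φ r) A) * Ψ A r)) ≤ B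
      perMask A = begin
        ∑ rs (λ r → DM * (∑ (allFin M) (surplus (φ r) A) * Ψ A r))
          ≲⟨ ∑-mono rs (λ r → ≤-resp-≈ (*-assoc _ _ _) (trans (distribʳ _ _ _)
               (+-cong (solve 4 (λ d k h p → d :* (k :* h) :* p := d :* (k :* (h :* p))) refl DM (ι M) _ (Ψ A r)) (*-assoc _ _ _)))
               (*-monoʳ (0≤Ψ A r) (excess-sum-≤ (masked (φ r) A) (λ x → 0≤φ r _) (surplus (φ r) A) (excess A r)))) ⟩
        ∑ rs (λ r → DM * (ι M * (∑ (cube M) (masked (φ r) A) * Ψ A r))
                    + ι (s ℕ.* M) * (∑ (cube M) (λ x → masked (φ r) A x * ι (Z (β A r) x)) * Ψ A r))
          ≈⟨ trans (∑-distrib-+ rs _ _) (+-cong (trans (∑-*ˡ rs _ _) (*-congˡ (∑-*ˡ rs _ _))) (∑-*ˡ rs _ _)) ⟩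
        DM * (ι M * ∑ rs (λ r → ∑ (cube M) (masked (φ r) A) * Ψ A r))
          + ι (s ℕ.* M) * ∑ rs (λ r → ∑ (cube M) (λ x → masked (φ r) A x * ι (Z (β A r) x)) * Ψ A r)
          ≲⟨ +-mono (≤-reflexive (*-congˡ (*-congˡ first))) (*-monoˡ (ι-nonneg (s ℕ.* M)) second) ⟩
        B ∎
        where
        first : ∑ rs (λ r → ∑ (cube M) (masked (φ r) A) * Ψ A r) ≈ K * (K * ι 2)
        first = begin-equality
          ∑ rs (λ r → ∑ (cube M) (masked (φ r) A) * Ψ A r)
            ≈⟨ ∑-cong rs (λ r → sym (∑-*ʳ (cube M) _ _)) ⟩
          ∑ rs (λ r → ∑ (cube M) (λ x → masked (φ r) A x * Ψ A r))
            ≈⟨ ∑-swap rs (cube M) _ ⟩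
          ∑ (cube M) (λ x → ∑ rs (λ r → masked (φ r) A x * Ψ A r))
            ≈⟨ ∑-cong (cube M) (mass A) ⟩
          ∑ (cube M) (λ x → K * ι 2)
            ≈⟨ cube-const M _ ⟩
          K * (K * ι 2) ∎
        -- A single nonnegative term is at most the whole sum. This prevents a rank-one term from
        -- concentrating on the few x where Z is large.
        entry : ∀ r x → masked (φ r) A x * Ψ A r ≤ K * ι 2
        entry r x = ≤-resp-≈ refl (mass A x)
          (∑-term {φ = λ r → masked (φ r) A x * Ψ A r} (λ r → *-nonneg (0≤φ r _) (0≤Ψ A r)) (∈P.∈-allFin r))
        0≤K2 : 0# ≤ K * ι 2
        0≤K2 = *-nonneg (ι-nonneg (2 ℕ.^ M)) (ι-nonneg 2)
        second : ∑ rs (λ r → ∑ (cube M) (λ x → masked (φ r) A x * ι (Z (β A r) x)) * Ψ A r)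
                 ≤ ι R * ((K * ι 2) * ι ((2 ℕ.* c) ℕ.^ M))
        second = begin
          ∑ rs (λ r → ∑ (cube M) (λ x → masked (φ r) A x * ι (Z (β A r) x)) * Ψ A r)
            ≈⟨ ∑-cong rs (λ r → trans (sym (∑-*ʳ (cube M) _ _))
                 (∑-cong (cube M) (λ x → solve 3 (λ a b d → a :* b :* d := a :* d :* b) refl _ _ _))) ⟩
          ∑ rs (λ r → ∑ (cube M) (λ x → masked (φ r) A x * Ψ A r * ι (Z (β A r) x)))
            ≲⟨ ∑-mono rs (λ r → ∑-mono (cube M) (λ x → *-monoʳ (ι-nonneg (Z (β A r) x)) (entry r x))) ⟩
          ∑ rs (λ r → ∑ (cube M) (λ x → K * ι 2 * ι (Z (β A r) x)))
            ≲⟨ ∑-mono rs (λ r → ≤-trans (≤-reflexive (∑-*ˡ (cube M) _ _)) (*-monoˡ 0≤K2 (∑-Z (β A r)))) ⟩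
          ∑ rs (λ r → (K * ι 2) * ι ((2 ℕ.* c) ℕ.^ M))
            ≈⟨ ∑-const rs _ ⟩
          ι (length rs) * ((K * ι 2) * ι ((2 ℕ.* c) ℕ.^ M))
            ≈⟨ *-congʳ (reflexive (cong ι (ListP.length-tabulate {n = R} id))) ⟩
          ι R * ((K * ι 2) * ι ((2 ℕ.* c) ℕ.^ M)) ∎

      forget-coordinate : (χ : Vec Bool M → Carrier) → (∀ A → 0# ≤ χ A) → ∀ i →
                          ∑ (cube m) (λ A → χ (insertAt A i true)) ≤ ∑ (cube M) χ
      forget-coordinate χ 0≤χ i = ≤-resp-≈ refl (sym (trans (∑-vecs-insertAt bools m i χ) (∑-bools _)))
        (x≤y+x (∑-nonneg (cube m) (λ A → 0≤χ _)))

    excessTotal-≤ : ι 2 * (DM * excessTotal) ≤ ι 2 * (K * (K * (K * (ι M * (DM + ι s * (ι R * ι (c ℕ.^ M)))))))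
    excessTotal-≤ = begin
      ι 2 * (DM * excessTotal)
        ≈⟨ solve 3 (λ a d x → a :* (d :* x) := d :* (a :* x)) refl (ι 2) DM excessTotal ⟩
      DM * (ι 2 * excessTotal)
        ≈⟨ *-congˡ (trans (sym (∑-*ˡ (allFin M) _ _)) (∑-cong (allFin M) (λ i → trans (sym (∑-*ˡ (cube m) _ _))
             (∑-cong (cube m) (λ A → trans (sym (∑-*ˡ rs _ _)) (∑-cong rs (λ r →
               trans (solve 3 (λ a x y → a :* (x :* y) := x :* (a :* y)) refl (ι 2) _ _) (*-congˡ (sym (double-slice r i A)))))))))) ⟩
      DM * ∑ (allFin M) (λ i → ∑ (cube m) (λ A → χ i (insertAt A i true)))
        ≲⟨ *-monoˡ (ι-nonneg (D ℕ.^ M)) (∑-mono (allFin M) (λ i →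
             forget-coordinate (χ i) (λ A → ∑-nonneg rs (λ r → *-nonneg (0≤surplus r A i) (0≤Ψ A r))) i)) ⟩
      DM * ∑ (allFin M) (λ i → ∑ (cube M) (χ i))
        ≈⟨ trans (*-congˡ (∑-swap (allFin M) (cube M) _)) (sym (∑-*ˡ (cube M) _ _)) ⟩
      ∑ (cube M) (λ A → DM * ∑ (allFin M) (λ i → χ i A))
        ≈⟨ ∑-cong (cube M) (λ A → trans (*-congˡ (trans (∑-swap (allFin M) rs _) (∑-cong rs (λ r → ∑-*ʳ (allFin M) _ _)))) (sym (∑-*ˡ rs _ _))) ⟩
      ∑ (cube M) (λ A → ∑ rs (λ r → DM * (∑ (allFin M) (surplus (φ r) A) * Ψ A r)))
        ≲⟨ ∑-mono (cube M) perMask ⟩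
      ∑ (cube M) (λ A → B)
        ≈⟨ cube-const M B ⟩
      K * B
        ≈⟨ *-congˡ (+-congˡ (*-cong (ι-* s M) (*-congˡ (*-congˡ
             (trans (reflexive (cong ι (^-distribʳ-* M 2 c))) (ι-* (2 ℕ.^ M) (c ℕ.^ M))))))) ⟩
      K * (DM * (ι M * (K * (K * ι 2))) + ι s * ι M * (ι R * ((K * ι 2) * (K * ι (c ℕ.^ M)))))
        ≈⟨ solve 7 (λ k d m′ two s′ r′ c′ → k :* (d :* (m′ :* (k :* (k :* two))) :+ s′ :* m′ :* (r′ :* ((k :* two) :* (k :* c′))))
             := two :* (k :* (k :* (k :* (m′ :* (d :+ s′ :* (r′ :* c′)))))))
             refl K DM (ι M) (ι 2) (ι s) (ι R) (ι (c ℕ.^ M)) ⟩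
      ι 2 * (K * (K * (K * (ι M * (DM + ι s * (ι R * ι (c ℕ.^ M))))))) ∎
      where
      χ : Fin M → Vec Bool M → Carrier
      χ i A = ∑ rs (λ r → surplus (φ r) A i * Ψ A r)

-- Arrangements

module Nodes (n : ℕ) where

  Node : Set
  Node = Fin n

  Triple : Set
  Triple = Node × Node × Node

  Blocks : ℕ → Set
  Blocks m = Vec (Node × Node) m

  Matching : ℕ → Set
  Matching m = Vec (Maybe (Node × Node)) m

  -- A bit vector forgets the order of the list, so that rearranged lists give equal sets and hence
  -- equal values of every function of a cut or a join.
  setOf : List Node → Subset n
  setOf xs = Vec.tabulate (λ j → does (_∈?_ FinP._≟_ j xs))

  setOf-↭ : ∀ {xs ys} → xs ↭ ys → setOf xs ≡ setOf ys
  setOf-↭ {xs} {ys} p = VecP.tabulate-cong (λ j →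
    does-⇔ (mk⇔ (PermP.∈-resp-↭ p) (PermP.∈-resp-↭ (Perm.↭-sym p))) (_∈?_ FinP._≟_ j xs) (_∈?_ FinP._≟_ j ys))

  blockNodes : ∀ {m} → Blocks m → List Node
  blockNodes []            = []
  blockNodes ((a , b) ∷ B) = a ∷ b ∷ blockNodes B

  chosen : ∀ {m} → Vec Bool m → Blocks m → List Node
  chosen []          []            = []
  chosen (true ∷ x)  ((a , b) ∷ B) = a ∷ b ∷ chosen x B
  chosen (false ∷ x) (_ ∷ B)       = chosen x B

  unchosen : ∀ {m} → Vec Bool m → Blocks m → Matching m
  unchosen = zipWith (λ b p → if b then nothing else just p)

  infixr 5 _◂_
  _◂_ : Triple → List Node → List Node
  (a , b , c) ◂ xs = a ∷ b ∷ c ∷ xs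

  -- A T-join is encoded by the set of the nodes joined to the hub and by the
  -- blocks that become edges.
  shore : ∀ {m} → Triple → Blocks m → Vec Bool m → Subset n
  shore h B x = setOf (h ◂ chosen x B)

  join : ∀ {m} → Triple → Blocks m → Vec Bool m → Subset n × Matching m
  join h B y = setOf (h ◂ chosen y B) , unchosen y B

  pull₂ : ∀ (a b d e : Node) {xs ys} → xs ↭ d ∷ e ∷ ys → a ∷ b ∷ xs ↭ d ∷ e ∷ a ∷ b ∷ ys
  pull₂ a b d e {xs} {ys} p = Perm.trans (prep a (prep b p))
    (Perm.trans (PermP.++⁺ʳ ys (PermP.++-comm (a ∷ b ∷ []) (d ∷ e ∷ []))) Perm.refl)

  chosen-insertAt-true : ∀ {m} (x : Vec Bool m) (B : Blocks m) i d e →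
                         chosen (insertAt x i true) (insertAt B i (d , e)) ↭ d ∷ e ∷ chosen x B
  chosen-insertAt-true x           B             zero    d e = Perm.refl
  chosen-insertAt-true (true ∷ x)  ((a , b) ∷ B) (suc i) d e = pull₂ a b d e (chosen-insertAt-true x B i d e)
  chosen-insertAt-true (false ∷ x) (_ ∷ B)       (suc i) d e = chosen-insertAt-true x B i d e

  chosen-insertAt-false : ∀ {m} (x : Vec Bool m) (B : Blocks m) i p →
                          chosen (insertAt x i false) (insertAt B i p) ≡ chosen x B
  chosen-insertAt-false x           B             zero    p = ≡.refl
  chosen-insertAt-false (true ∷ x)  ((a , b) ∷ B) (suc i) p = cong (λ l → a ∷ b ∷ l) (chosen-insertAt-false x B i p)
  chosen-insertAt-false (false ∷ x) (_ ∷ B)       (suc i) p = chosen-insertAt-false x B i p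

  blockNodes-insertAt : ∀ {m} (B : Blocks m) i d e → blockNodes (insertAt B i (d , e)) ↭ d ∷ e ∷ blockNodes B
  blockNodes-insertAt B             zero    d e = Perm.refl
  blockNodes-insertAt ((a , b) ∷ B) (suc i) d e = pull₂ a b d e (blockNodes-insertAt B i d e)

  Five : Set
  Five = Node × Node × Node × Node × Node

  rot : Five → Five
  rot (a , b , c , d , e) = b , c , d , e , a

  front : Five → Triple
  front (a , b , c , d , e) = a , b , c

  back : Five → Node × Node
  back (a , b , c , d , e) = d , e

  infixr 5 _◂₅_
  _◂₅_ : Five → List Node → List Node
  (a , b , c , d , e) ◂₅ xs = a ∷ b ∷ c ∷ d ∷ e ∷ xs

  rot-↭ : ∀ v xs → v ◂₅ xs ↭ rot v ◂₅ xs
  rot-↭ (a , b , c , d , e) xs = Perm.↭-sym (PermP.shift a (b ∷ c ∷ d ∷ e ∷ []) xs)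

  shore-full : ∀ {m} v (B : Blocks m) i x →
               shore (front v) (insertAt B i (back v)) (insertAt x i true) ≡ setOf (v ◂₅ chosen x B)
  shore-full (a , b , c , d , e) B i x = setOf-↭ (prep a (prep b (prep c (chosen-insertAt-true x B i d e))))

  -- With bit i set, all five nodes are joined to the hub and the matching holds `nothing` at i, so
  -- the encoding no longer shows which two of them formed the block.
  join-full : ∀ {m} v (B : Blocks m) i y →
              join (front v) (insertAt B i (back v)) (insertAt y i true)
              ≡ (setOf (v ◂₅ chosen y B) , insertAt (unchosen y B) i nothing)
  join-full v B i y = cong₂ _,_ (shore-full v B i y) (zipWith-insertAt _ y B i true (back v))

  shore-rot : ∀ {m} v (B : Blocks m) i x →
              shore (front v) (insertAt B i (back v)) (insertAt x i true)
              ≡ shore (front (rot v)) (insertAt B i (back (rot v))) (insertAt x i true)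
  shore-rot v B i x = ≡.trans (shore-full v B i x)
    (≡.trans (setOf-↭ (rot-↭ v (chosen x B))) (≡.sym (shore-full (rot v) B i x)))

  join-rot : ∀ {m} v (B : Blocks m) i y →
             join (front v) (insertAt B i (back v)) (insertAt y i true)
             ≡ join (front (rot v)) (insertAt B i (back (rot v))) (insertAt y i true)
  join-rot v B i y = ≡.trans (join-full v B i y)
    (≡.trans (cong (_, insertAt (unchosen y B) i nothing) (setOf-↭ (rot-↭ v (chosen y B)))) (≡.sym (join-full (rot v) B i y)))

-- Averaging over the rotations of a 5-set

module Symmetrisation (F : OrderedField) (stable : ∀ x y → ¬ ¬ (OrderedField._≤_ F x y) → OrderedField._≤_ F x y)
                      (W : Weights) (n : ℕ) (ts : List (Fin n)) where

  open Ordered F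
  open Weights W
  open Cube F W
  open Masked F W
  open Nodes n

  zero-product : ∀ {x y} → ¬ (x ≈ 0#) → x * y ≈ 0# → y ≈ 0#
  zero-product {x} {y} x≉0 p with inverse x x≉0
  ... | z , xz = begin-equality
    y             ≈⟨ sym (*-identityˡ y) ⟩
    1# * y        ≈⟨ *-congʳ (sym (trans (*-comm z x) xz)) ⟩
    z * x * y     ≈⟨ trans (*-assoc _ _ _) (*-congˡ p) ⟩
    z * 0#        ≈⟨ zeroʳ z ⟩
    0#            ∎

  module FiveCycle {V : Carrier} (0≤V : 0# ≤ V) where

    -- Of two adjacent values one vanishes. Which one is known only up to double negation, and this
    -- suffices because `≤` is stable.
    pair-bound : ∀ {t t′ e e′} → t * t′ ≈ 0# → t ≤ V + e → t′ ≤ V + e′ → 0# ≤ e → 0# ≤ e′ → t + t′ ≤ V + (e + e′)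
    pair-bound {t} {t′} {e} {e′} z p p′ q q′ = stable _ _ (¬¬-map by-cases ¬¬-excluded-middle)
      where
      by-cases : Dec (t ≈ 0#) → t + t′ ≤ V + (e + e′)
      by-cases (yes t≈0) = ≤-trans (≤-reflexive (trans (+-congʳ t≈0) (+-identityˡ _)))
        (≤-trans p′ (+-mono (≤-refl V) (x≤y+x q)))
      by-cases (no t≉0)  = ≤-trans (≤-reflexive (trans (+-congˡ (zero-product t≉0 z)) (+-identityʳ _)))
        (≤-trans p (+-mono (≤-refl V) (x≤x+y q′)))

    -- An independent set of a 5-cycle has at most two vertices.
    five-cycle : ∀ {t₀ t₁ t₂ t₃ t₄ e₀ e₁ e₂ e₃ e₄} →
      t₀ * t₁ ≈ 0# → t₁ * t₂ ≈ 0# → t₂ * t₃ ≈ 0# → t₃ * t₄ ≈ 0# → t₄ * t₀ ≈ 0# →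
      t₀ ≤ V + e₀ → t₁ ≤ V + e₁ → t₂ ≤ V + e₂ → t₃ ≤ V + e₃ → t₄ ≤ V + e₄ →
      0# ≤ e₀ → 0# ≤ e₁ → 0# ≤ e₂ → 0# ≤ e₃ → 0# ≤ e₄ →
      t₀ + (t₁ + (t₂ + (t₃ + t₄))) ≤ ι 2 * V + (e₀ + (e₁ + (e₂ + (e₃ + e₄))))
    five-cycle {t₀} {t₁} {t₂} {t₃} {t₄} {e₀} {e₁} {e₂} {e₃} {e₄} z₀ z₁ z₂ z₃ z₄ p₀ p₁ p₂ p₃ p₄ q₀ q₁ q₂ q₃ q₄ =
      stable _ _ (¬¬-map by-cases ¬¬-excluded-middle)
      where
      by-cases : Dec (t₀ ≈ 0#) → t₀ + (t₁ + (t₂ + (t₃ + t₄))) ≤ ι 2 * V + (e₀ + (e₁ + (e₂ + (e₃ + e₄))))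
      -- Without t₀ the cycle is a path on four vertices, which splits into two adjacent pairs.
      by-cases (yes t₀≈0) = begin
        t₀ + (t₁ + (t₂ + (t₃ + t₄)))
          ≈⟨ trans (+-congʳ t₀≈0) (trans (+-identityˡ _) (sym (+-assoc _ _ _))) ⟩
        (t₁ + t₂) + (t₃ + t₄)
          ≲⟨ +-mono (pair-bound z₁ p₁ p₂ q₁ q₂) (pair-bound z₃ p₃ p₄ q₃ q₄) ⟩
        (V + (e₁ + e₂)) + (V + (e₃ + e₄))
          ≲⟨ x≤y+x q₀ ⟩
        e₀ + ((V + (e₁ + e₂)) + (V + (e₃ + e₄)))
          ≈⟨ solve 6 (λ v a b c d e → a :+ ((v :+ (b :+ c)) :+ (v :+ (d :+ e))) := con 2 :* v :+ (a :+ (b :+ (c :+ (d :+ e)))))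
               refl V e₀ e₁ e₂ e₃ e₄ ⟩
        ι 2 * V + (e₀ + (e₁ + (e₂ + (e₃ + e₄)))) ∎
      -- Both neighbours of t₀ vanish, which leaves t₀ and the adjacent pair opposite to it.
      by-cases (no t₀≉0) = begin
        t₀ + (t₁ + (t₂ + (t₃ + t₄)))
          ≈⟨ +-congˡ (trans (+-cong t₁≈0 (+-congˡ (trans (+-congˡ t₄≈0) (+-identityʳ _)))) (+-identityˡ _)) ⟩
        t₀ + (t₂ + t₃)
          ≲⟨ +-mono p₀ (pair-bound z₂ p₂ p₃ q₂ q₃) ⟩
        (V + e₀) + (V + (e₂ + e₃))
          ≲⟨ x≤y+x (+-nonneg q₁ q₄) ⟩
        (e₁ + e₄) + ((V + e₀) + (V + (e₂ + e₃)))
          ≈⟨ solve 6 (λ v a b c d e → (b :+ e) :+ ((v :+ a) :+ (v :+ (c :+ d))) := con 2 :* v :+ (a :+ (b :+ (c :+ (d :+ e)))))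
               refl V e₀ e₁ e₂ e₃ e₄ ⟩
        ι 2 * V + (e₀ + (e₁ + (e₂ + (e₃ + e₄)))) ∎
        where
        t₁≈0 = zero-product t₀≉0 z₀
        t₄≈0 = zero-product t₀≉0 (trans (*-comm t₀ t₄) z₄)

  ∑-× : {A B : Set} (xs : List A) (ys : List B) (φ : A × B → Carrier) →
        ∑ (List.cartesianProduct xs ys) φ ≈ ∑ xs (λ x → ∑ ys (λ y → φ (x , y)))
  ∑-× []       ys φ = refl
  ∑-× (x ∷ xs) ys φ = trans (∑-++ (List.map (x ,_) ys) _ φ) (+-cong (∑-map (x ,_) ys φ) (∑-× xs ys φ))

  ∑₅ : (Five → Carrier) → Carrier
  ∑₅ φ = ∑ ts λ a → ∑ ts λ b → ∑ ts λ c → ∑ ts λ d → ∑ ts λ e → φ (a , b , c , d , e)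

  ∑₅-cong : {φ ψ : Five → Carrier} → (∀ v → φ v ≈ ψ v) → ∑₅ φ ≈ ∑₅ ψ
  ∑₅-cong h = ∑-cong ts λ a → ∑-cong ts λ b → ∑-cong ts λ c → ∑-cong ts λ d → ∑-cong ts λ e → h _

  ∑₅-mono : {φ ψ : Five → Carrier} → (∀ v → φ v ≤ ψ v) → ∑₅ φ ≤ ∑₅ ψ
  ∑₅-mono h = ∑-mono ts λ a → ∑-mono ts λ b → ∑-mono ts λ c → ∑-mono ts λ d → ∑-mono ts λ e → h _

  ∑₅-+ : (φ ψ : Five → Carrier) → ∑₅ (λ v → φ v + ψ v) ≈ ∑₅ φ + ∑₅ ψ
  ∑₅-+ φ ψ = push λ a → push λ b → push λ c → push λ d → ∑-distrib-+ ts _ _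
    where
    push : {φ ψ χ : Node → Carrier} → (∀ a → φ a ≈ ψ a + χ a) → ∑ ts φ ≈ ∑ ts ψ + ∑ ts χ
    push h = trans (∑-cong ts h) (∑-distrib-+ ts _ _)

  ∑₅-*ˡ : (k : Carrier) (φ : Five → Carrier) → ∑₅ (λ v → k * φ v) ≈ k * ∑₅ φ
  ∑₅-*ˡ k φ = push λ a → push λ b → push λ c → push λ d → ∑-*ˡ ts k _
    where
    push : {φ ψ : Node → Carrier} → (∀ a → φ a ≈ k * ψ a) → ∑ ts φ ≈ k * ∑ ts ψ
    push h = trans (∑-cong ts h) (∑-*ˡ ts k _)

  -- All five nodes range over the same list, so a rotation only changes the order of summation.
  ∑₅-rot : (φ : Five → Carrier) → ∑₅ (φ ∘ rot) ≈ ∑₅ φ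
  ∑₅-rot φ = trans (∑-swap ts ts _) (∑-cong ts λ b → trans (∑-swap ts ts _) (∑-cong ts λ c →
    trans (∑-swap ts ts _) (∑-cong ts λ d → ∑-swap ts ts _)))

  orbit : (Five → Carrier) → Five → Carrier
  orbit φ v = φ v + (φ (rot v) + (φ (rot (rot v)) + (φ (rot (rot (rot v))) + φ (rot (rot (rot (rot v)))))))

  ∑₅-orbit : (φ : Five → Carrier) → ∑₅ (orbit φ) ≈ ι 5 * ∑₅ φ
  ∑₅-orbit φ = begin-equality
    ∑₅ (orbit φ)
      ≈⟨ trans (∑₅-+ φ _) (+-congˡ (trans (∑₅-+ (φ ∘ rot) _) (+-cong r₁ (trans (∑₅-+ (φ ∘ rot ∘ rot) _)
           (+-cong r₂ (trans (∑₅-+ (φ ∘ rot ∘ rot ∘ rot) _) (+-cong r₃ r₄))))))) ⟩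
    ∑₅ φ + (∑₅ φ + (∑₅ φ + (∑₅ φ + ∑₅ φ)))
      ≈⟨ solve 1 (λ x → x :+ (x :+ (x :+ (x :+ x))) := con 5 :* x) refl (∑₅ φ) ⟩
    ι 5 * ∑₅ φ ∎
    where
    r₁ = ∑₅-rot φ
    r₂ = trans (∑₅-rot (φ ∘ rot)) r₁
    r₃ = trans (∑₅-rot (φ ∘ rot ∘ rot)) r₂
    r₄ = trans (∑₅-rot (φ ∘ rot ∘ rot ∘ rot)) r₃

  -- Summed over all 5-tuples, an orbit contributes each of its terms five times, because `∑₅` and χ
  -- are invariant under rotation; `v` stands outside the orbit sums and keeps its factor 2.
  rotation-average : (χ t v x : Five → Carrier) → (∀ F → χ (rot F) ≈ χ F) →
                     (∀ F → χ F * orbit t F ≤ χ F * (ι 2 * v F + orbit x F)) →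
                     ι 5 * ∑₅ (λ F → χ F * t F) ≤ ι 2 * ∑₅ (λ F → χ F * v F) + ι 5 * ∑₅ (λ F → χ F * x F)
  rotation-average χ t v x χ-rot h = begin
    ι 5 * ∑₅ (λ F → χ F * t F)
      ≈⟨ sym (∑₅-orbit _) ⟩
    ∑₅ (orbit (λ F → χ F * t F))
      ≈⟨ ∑₅-cong (orbit-* t) ⟩
    ∑₅ (λ F → χ F * orbit t F)
      ≲⟨ ∑₅-mono h ⟩
    ∑₅ (λ F → χ F * (ι 2 * v F + orbit x F))
      ≈⟨ ∑₅-cong (λ F → trans (distribˡ _ _ _) (+-cong
           (solve 3 (λ a b c → a :* (b :* c) := b :* (a :* c)) refl (χ F) (ι 2) (v F)) (sym (orbit-* x F)))) ⟩
    ∑₅ (λ F → ι 2 * (χ F * v F) + orbit (λ F → χ F * x F) F)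
      ≈⟨ trans (∑₅-+ _ _) (+-cong (∑₅-*ˡ (ι 2) _) (∑₅-orbit _)) ⟩
    ι 2 * ∑₅ (λ F → χ F * v F) + ι 5 * ∑₅ (λ F → χ F * x F) ∎
    where
    orbit-* : ∀ y F → orbit (λ F → χ F * y F) F ≈ χ F * orbit y F
    orbit-* y F = begin-equality
      orbit (λ F → χ F * y F) F
        ≈⟨ +-congˡ (+-cong (*-congʳ r₁) (+-cong (*-congʳ r₂) (+-cong (*-congʳ r₃) (*-congʳ r₄)))) ⟩
      χ F * y F + (χ F * y (rot F) + (χ F * y (rot (rot F)) + (χ F * y (rot (rot (rot F))) + χ F * y (rot (rot (rot (rot F)))))))
        ≈⟨ solve 6 (λ k a b c d e → k :* a :+ (k :* b :+ (k :* c :+ (k :* d :+ k :* e))) := k :* (a :+ (b :+ (c :+ (d :+ e)))))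
             refl (χ F) (y F) (y (rot F)) (y (rot (rot F))) (y (rot (rot (rot F)))) (y (rot (rot (rot (rot F))))) ⟩
      χ F * orbit y F ∎
      where
      r₁ = χ-rot F
      r₂ = trans (χ-rot (rot F)) r₁
      r₃ = trans (χ-rot (rot (rot F))) r₂
      r₄ = trans (χ-rot (rot (rot (rot F)))) r₃

-- The rank bound

module Core (F : OrderedField) (stable : ∀ x y → ¬ ¬ (OrderedField._≤_ F x y) → OrderedField._≤_ F x y)
            (W : Weights) (n : ℕ) (ts : List (Fin n)) (m : ℕ) (R : ℕ)
            (f : Fin R → Subset n → OrderedField.Carrier F)
            (g : Fin R → Subset n × Vec (Maybe (Fin n × Fin n)) (suc m) → OrderedField.Carrier F) where

  open Ordered F
  open Weights W
  open Cube F W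
  open Masked F W
  open Nodes n
  open Symmetrisation F stable W n ts

  -- Asking only that every node of `ts` occurs makes invariance under rotation immediate; for a
  -- list `ts` of the right length without repetitions it already makes the arrangement a
  -- permutation of `ts`.
  Valid : Triple → Blocks (suc m) → Set
  Valid h B = All (_∈ h ◂ blockNodes B) ts

  valid? : ∀ h B → Dec (Valid h B)
  valid? h B = All.all? (λ t → _∈?_ FinP._≟_ t (h ◂ blockNodes B)) ts

  indicator : ∀ h B → Carrier
  indicator h B = ι (bit (does (valid? h B)))

  arrange : Blocks m → Fin (suc m) → Five → Triple × Blocks (suc m)
  arrange B i v = front v , insertAt B i (back v)

  arrange-↭ : ∀ (B : Blocks m) i v → front v ◂ blockNodes (insertAt B i (back v)) ↭ v ◂₅ blockNodes B
  arrange-↭ B i (a , b , c , d , e) = prep a (prep b (prep c (blockNodes-insertAt B i d e)))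

  valid-resp-↭ : ∀ {xs ys} → xs ↭ ys → All (_∈ xs) ts → All (_∈ ys) ts
  valid-resp-↭ p = All.map (PermP.∈-resp-↭ p)

  arrange-rot-↭ : ∀ (B : Blocks m) i v → front v ◂ blockNodes (insertAt B i (back v))
                            ↭ front (rot v) ◂ blockNodes (insertAt B i (back (rot v)))
  arrange-rot-↭ B i v = Perm.trans (arrange-↭ B i v)
    (Perm.trans (rot-↭ v (blockNodes B)) (Perm.↭-sym (arrange-↭ B i (rot v))))

  module _
    (0≤f : ∀ r U → 0# ≤ f r U) (0≤g : ∀ r J → 0# ≤ g r J)
    (slack : ∀ h B → Valid h B → ∀ x y →
      ∑ (allFin R) (λ r → f r (shore h B x) * g r (join h B y)) ≈ ι (2 ℕ.+ 2 ℕ.* ones x y))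
    (tight : ∀ B i v → Valid (front v) (insertAt B i (back v)) → ∀ x y → ones x y ≡ 0 →
      ∑ (allFin R) (λ r → f r (shore (front v) (insertAt B i (back v)) (insertAt x i false))
                          * g r (join (front (rot (rot v))) (insertAt B i (back (rot (rot v)))) (insertAt y i false))) ≈ 0#)
    (h₀ : Triple) (h₀∈ : h₀ ∈ List.cartesianProduct ts (List.cartesianProduct ts ts))
    (B₀ : Blocks (suc m)) (B₀∈ : B₀ ∈ vecs (List.cartesianProduct ts ts) (suc m)) (valid₀ : Valid h₀ B₀) where

    private
      M = suc m

      rs : List (Fin R)
      rs = allFin R

      φ ψ : Triple × Blocks M → Fin R → Vec Bool M → Carrier
      φ (h , B) r x = f r (shore h B x)
      ψ (h , B) r y = g r (join h B y)

      χ : Triple × Blocks M → Carrier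
      χ (h , B) = indicator h B

      arrs : List (Triple × Blocks M)
      arrs = List.cartesianProduct (List.cartesianProduct ts (List.cartesianProduct ts ts))
                                   (vecs (List.cartesianProduct ts ts) M)

      𝕊 : (Triple × Blocks M → Carrier) → Carrier
      𝕊 τ = ∑ arrs (λ a → χ a * τ a)

      0≤χ : ∀ a → 0# ≤ χ a
      0≤χ (h , B) = ι-nonneg (bit (does (valid? h B)))

      onValid : ∀ a {x y} → (Valid (proj₁ a) (proj₂ a) → x ≤ y) → χ a * x ≤ χ a * y
      onValid (h , B) p with valid? h B
      ... | yes v = *-monoˡ 0≤1 (p v)
      ... | no  _ = ≤-reflexive (trans (zeroˡ _) (sym (zeroˡ _)))

      -- Arrangements are summed over a full product and validity enters only as the weight χ.
      -- Hence, for every i, the triple and block i can be separated from the other blocks by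
      -- exchanging sums, without any bijection of permutations.
      𝕊-view : ∀ i τ → 𝕊 τ ≈ ∑ (vecs (List.cartesianProduct ts ts) m) (λ B → ∑₅ (λ v → χ (arrange B i v) * τ (arrange B i v)))
      𝕊-view i τ = begin-equality
        𝕊 τ
          ≈⟨ ∑-× hs (vecs ps M) _ ⟩
        ∑ hs (λ h → ∑ (vecs ps M) (λ B → σ (h , B)))
          ≈⟨ ∑-cong hs (λ h → trans (∑-vecs-insertAt ps m i _) (∑-swap ps (vecs ps m) _)) ⟩
        ∑ hs (λ h → ∑ (vecs ps m) (λ B → ∑ ps (λ p → σ (h , insertAt B i p))))
          ≈⟨ ∑-swap hs (vecs ps m) _ ⟩
        ∑ (vecs ps m) (λ B → ∑ hs (λ h → ∑ ps (λ p → σ (h , insertAt B i p))))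
          ≈⟨ ∑-cong (vecs ps m) (λ B → trans (∑-× ts _ _) (∑-cong ts λ a → trans (∑-× ts ts _)
               (∑-cong ts λ b → ∑-cong ts λ c → ∑-× ts ts _))) ⟩
        ∑ (vecs ps m) (λ B → ∑₅ (λ v → σ (arrange B i v))) ∎
        where
        ps = List.cartesianProduct ts ts
        hs = List.cartesianProduct ts ps
        σ : Triple × Blocks M → Carrier
        σ a = χ a * τ a

      χ-rot : ∀ B i v → χ (arrange B i (rot v)) ≈ χ (arrange B i v)
      χ-rot B i v = reflexive (cong (ι ∘ bit) (does-⇔
        (mk⇔ (valid-resp-↭ (Perm.↭-sym (arrange-rot-↭ B i v))) (valid-resp-↭ (arrange-rot-↭ B i v)))
        (valid? (proj₁ (arrange B i (rot v))) (proj₂ (arrange B i (rot v))))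
        (valid? (proj₁ (arrange B i v)) (proj₂ (arrange B i v)))))

      -- The share of the term r on disjoint pairs that are both 0 at i, and on pairs that meet
      -- exactly at i; the masks keep the other coordinates disjoint.
      off on : Fin M → Vec Bool m → Fin R → Triple × Blocks M → Carrier
      off i A r a = slice (φ a r) i false A * slice (ψ a r) i false (∁ A)
      on  i A r a = slice (φ a r) i true A * slice (ψ a r) i true (∁ A)

      lossφ lossψ loss : Fin M → Vec Bool m → Fin R → Triple × Blocks M → Carrier
      lossφ i A r a = surplus (φ a r) (insertAt A i true) i * slice (ψ a r) i false (∁ A)
      lossψ i A r a = surplus (ψ a r) (insertAt (∁ A) i true) i * slice (φ a r) i false A
      loss i A r a = lossφ i A r a + lossψ i A r a

      0≤slice-φ : ∀ a r i b A → 0# ≤ slice (φ a r) i b A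
      0≤slice-φ a r = slice-nonneg {φ = φ a r} (λ x → 0≤f r _)

      0≤slice-ψ : ∀ a r i b A → 0# ≤ slice (ψ a r) i b A
      0≤slice-ψ a r = slice-nonneg {φ = ψ a r} (λ x → 0≤g r _)

      0≤loss : ∀ i A r a → 0# ≤ loss i A r a
      0≤loss i A r a = +-nonneg (*-nonneg (pos-nonneg _ _) (0≤slice-ψ a r i false (∁ A)))
                                (*-nonneg (pos-nonneg _ _) (0≤slice-φ a r i false A))

      -- Multiplying the two hypotheses directly would leave the terms e · e′, l a₁ · e′ and e · l
      -- b₁. Comparing k a₀ with l a₁ first ensures that each error is multiplied only by a₀ or b₀,
      -- and these are the products that `excessTotal` controls.
      product-bound : ∀ {k l a₀ a₁ b₀ b₁ e e′} → 0# ≤ k → 0# ≤ l → 0# ≤ a₀ → 0# ≤ a₁ → 0# ≤ b₀ → 0# ≤ b₁ → 0# ≤ e → 0# ≤ e′ →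
                      k * a₀ ≤ l * a₁ + e → k * b₀ ≤ l * b₁ + e′ →
                      (k * k) * (a₀ * b₀) ≤ (l * l) * (a₁ * b₁) + k * (e * b₀ + e′ * a₀)
      product-bound {k} {l} {a₀} {a₁} {b₀} {b₁} {e} {e′} 0≤k 0≤l 0≤a₀ 0≤a₁ 0≤b₀ 0≤b₁ 0≤e 0≤e′ p q
        with ≤-total (k * a₀) (l * a₁)
      ... | inj₁ p′ = begin
        (k * k) * (a₀ * b₀)                          ≈⟨ solve 3 (λ k a b → (k :* k) :* (a :* b) := (k :* a) :* (k :* b)) refl k a₀ b₀ ⟩
        (k * a₀) * (k * b₀)                          ≲⟨ *-monoˡ (*-nonneg 0≤k 0≤a₀) q ⟩
        (k * a₀) * (l * b₁ + e′)                     ≈⟨ distribˡ _ _ _ ⟩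
        (k * a₀) * (l * b₁) + (k * a₀) * e′          ≲⟨ +-mono (*-monoʳ (*-nonneg 0≤l 0≤b₁) p′) (x≤y+x (*-nonneg 0≤k (*-nonneg 0≤e 0≤b₀))) ⟩
        (l * a₁) * (l * b₁) + (k * (e * b₀) + (k * a₀) * e′)
          ≈⟨ solve 7 (λ k l a a₁ b₁ b e′,e → (l :* a₁) :* (l :* b₁) :+ (k :* b :+ (k :* a) :* e′,e) := (l :* l) :* (a₁ :* b₁) :+ k :* (b :+ e′,e :* a))
               refl k l a₀ a₁ b₁ (e * b₀) e′ ⟩
        (l * l) * (a₁ * b₁) + k * (e * b₀ + e′ * a₀) ∎
      ... | inj₂ p′ = begin
        (k * k) * (a₀ * b₀)                          ≈⟨ solve 3 (λ k a b → (k :* k) :* (a :* b) := (k :* a) :* (k :* b)) refl k a₀ b₀ ⟩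
        (k * a₀) * (k * b₀)                          ≲⟨ *-monoʳ (*-nonneg 0≤k 0≤b₀) p ⟩
        (l * a₁ + e) * (k * b₀)                      ≈⟨ distribʳ _ _ _ ⟩
        (l * a₁) * (k * b₀) + e * (k * b₀)           ≲⟨ +-mono (*-monoˡ (*-nonneg 0≤l 0≤a₁) q) (≤-refl _) ⟩
        (l * a₁) * (l * b₁ + e′) + e * (k * b₀)      ≈⟨ +-congʳ (distribˡ _ _ _) ⟩
        ((l * a₁) * (l * b₁) + (l * a₁) * e′) + e * (k * b₀)
                                                     ≲⟨ +-mono (+-mono (≤-refl _) (*-monoʳ 0≤e′ p′)) (≤-refl _) ⟩
        ((l * a₁) * (l * b₁) + (k * a₀) * e′) + e * (k * b₀)
          ≈⟨ solve 8 (λ k l a a₁ b b₁ e e′ → ((l :* a₁) :* (l :* b₁) :+ (k :* a) :* e′) :+ e :* (k :* b) := (l :* l) :* (a₁ :* b₁) :+ k :* (e :* b :+ e′ :* a))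
               refl k l a₀ a₁ b₀ b₁ e e′ ⟩
        (l * l) * (a₁ * b₁) + k * (e * b₀ + e′ * a₀) ∎

      off-bound : ∀ i A r a → (ι s * ι s) * off i A r a ≤ (ι (suc s) * ι (suc s)) * on i A r a + ι s * loss i A r a
      off-bound i A r a = product-bound (ι-nonneg s) (ι-nonneg (suc s))
        (0≤slice-φ a r i false A) (0≤slice-φ a r i true A) (0≤slice-ψ a r i false (∁ A)) (0≤slice-ψ a r i true (∁ A))
        (pos-nonneg _ _) (pos-nonneg _ _) (slice-bound (φ a r) i A) (slice-bound (ψ a r) i (∁ A))

      on-rot : ∀ i A r B v → on i A r (arrange B i v) ≈ on i A r (arrange B i (rot v))
      on-rot i A r B v = *-cong
        (∑-cong (cube m) (λ x → reflexive (cong (f r) (shore-rot v B i _))))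
        (∑-cong (cube m) (λ y → reflexive (cong (g r) (join-rot v B i _))))

      -- The product contains the factor α β′, made of cuts from `v` and joins from its double
      -- rotation. These pairs have slack 0, so by nonnegativity each rank-one term vanishes on
      -- them.
      off-off : ∀ i A r B v → Valid (front v) (insertAt B i (back v)) →
                off i A r (arrange B i v) * off i A r (arrange B i (rot (rot v))) ≈ 0#
      off-off i A r B v val = begin-equality
        (α * β) * (α′ * β′)
          ≈⟨ solve 4 (λ a b c d → (a :* b) :* (c :* d) := (a :* d) :* (b :* c)) refl α β α′ β′ ⟩
        (α * β′) * (β * α′)
          ≈⟨ *-congʳ (trans (∑-*-∑ (cube m) (cube m) _ _) (∑-zero (cube m) (λ x → ∑-zero (cube m) (λ y → term (x ⊓ A) (y ⊓ ∁ A) (ones-masked x y A))))) ⟩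
        0# * (β * α′)
          ≈⟨ zeroˡ _ ⟩
        0# ∎
        where
        α  = slice (φ (arrange B i v) r) i false A
        β  = slice (ψ (arrange B i v) r) i false (∁ A)
        α′ = slice (φ (arrange B i (rot (rot v))) r) i false A
        β′ = slice (ψ (arrange B i (rot (rot v))) r) i false (∁ A)
        term : ∀ x y → ones x y ≡ 0 → φ (arrange B i v) r (insertAt x i false) * ψ (arrange B i (rot (rot v))) r (insertAt y i false) ≈ 0#
        term x y disjoint = ≤-antisym
          (≤-resp-≈ refl (tight B i v val x y disjoint)
            (∑-term {φ = λ r → φ (arrange B i v) r (insertAt x i false) * ψ (arrange B i (rot (rot v))) r (insertAt y i false)}
              (λ r → *-nonneg (0≤f r _) (0≤g r _)) (∈P.∈-allFin r)))
          (*-nonneg (0≤f r _) (0≤g r _))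

      l² k² : Carrier
      l² = ι (suc s) * ι (suc s)
      k² = ι s * ι s

      orbit-bound : ∀ i A r B v → Valid (front v) (insertAt B i (back v)) →
        orbit (λ u → k² * off i A r (arrange B i u)) v
        ≤ ι 2 * (l² * on i A r (arrange B i v)) + orbit (λ u → ι s * loss i A r (arrange B i u)) v
      orbit-bound i A r B v val = ≤-resp-≈
        (solve 5 (λ a b c d e → a :+ (c :+ (e :+ (b :+ d))) := a :+ (b :+ (c :+ (d :+ e)))) refl _ _ _ _ _)
        (+-congˡ (solve 5 (λ a b c d e → a :+ (c :+ (e :+ (b :+ d))) := a :+ (b :+ (c :+ (d :+ e)))) refl _ _ _ _ _))
        -- Tightness relates a tuple to its double rotation, so the 5-cycle runs through `v`, `v₂`,
        -- `v₄`, `v₁`, `v₃`; it closes because five rotations are the identity.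
        (five-cycle (z v val) (z v₂ val₂) (z v₄ val₄) (z v₁ val₁) (z v₃ val₃)
          (off-bound i A r (arrange B i v))
          (bound v₂ (trans (on-rot i A r B v) (on-rot i A r B v₁)))
          (bound v₄ (trans (trans (on-rot i A r B v) (on-rot i A r B v₁)) (trans (on-rot i A r B v₂) (on-rot i A r B v₃))))
          (bound v₁ (on-rot i A r B v))
          (bound v₃ (trans (trans (on-rot i A r B v) (on-rot i A r B v₁)) (on-rot i A r B v₂)))
          (nonneg v) (nonneg v₂) (nonneg v₄) (nonneg v₁) (nonneg v₃))
        where
        v₁ = rot v
        v₂ = rot v₁
        v₃ = rot v₂
        v₄ = rot v₃
        step : ∀ u → Valid (front u) (insertAt B i (back u)) → Valid (front (rot u)) (insertAt B i (back (rot u)))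
        step u = valid-resp-↭ (arrange-rot-↭ B i u)
        val₁ = step v val
        val₂ = step v₁ val₁
        val₃ = step v₂ val₂
        val₄ = step v₃ val₃
        open FiveCycle {l² * on i A r (arrange B i v)}
          (*-nonneg (*-nonneg (ι-nonneg (suc s)) (ι-nonneg (suc s))) (*-nonneg (0≤slice-φ _ r i true A) (0≤slice-ψ _ r i true (∁ A))))
        z : ∀ u → Valid (front u) (insertAt B i (back u)) →
            (k² * off i A r (arrange B i u)) * (k² * off i A r (arrange B i (rot (rot u)))) ≈ 0#
        z u w = trans (solve 3 (λ k a b → (k :* a) :* (k :* b) := k :* k :* (a :* b)) refl k² _ _)
                      (trans (*-congˡ (off-off i A r B u w)) (zeroʳ _))
        bound : ∀ u → on i A r (arrange B i v) ≈ on i A r (arrange B i u) →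
                k² * off i A r (arrange B i u) ≤ l² * on i A r (arrange B i v) + ι s * loss i A r (arrange B i u)
        bound u p = ≤-trans (off-bound i A r (arrange B i u)) (≤-reflexive (+-congʳ (*-congˡ (sym p))))
        nonneg : ∀ u → 0# ≤ ι s * loss i A r (arrange B i u)
        nonneg u = *-nonneg (ι-nonneg s) (0≤loss i A r (arrange B i u))

      averaged : ∀ i A r → ι 5 * 𝕊 (λ a → k² * off i A r a)
                           ≤ ι 2 * 𝕊 (λ a → l² * on i A r a) + ι 5 * 𝕊 (λ a → ι s * loss i A r a)
      averaged i A r = begin
        ι 5 * 𝕊 (λ a → k² * off i A r a)
          ≈⟨ trans (*-congˡ (𝕊-view i _)) (sym (∑-*ˡ Bs _ _)) ⟩
        ∑ Bs (λ B → ι 5 * ∑₅ (λ v → χ (arrange B i v) * (k² * off i A r (arrange B i v))))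
          ≲⟨ ∑-mono Bs (λ B → rotation-average (χ ∘ arrange B i) _ _ _ (χ-rot B i) (λ v → onValid (arrange B i v) (orbit-bound i A r B v))) ⟩
        ∑ Bs (λ B → ι 2 * ∑₅ (λ v → χ (arrange B i v) * (l² * on i A r (arrange B i v)))
                    + ι 5 * ∑₅ (λ v → χ (arrange B i v) * (ι s * loss i A r (arrange B i v))))
          ≈⟨ trans (∑-distrib-+ Bs _ _) (+-cong (trans (∑-*ˡ Bs _ _) (*-congˡ (sym (𝕊-view i _))))
                                                (trans (∑-*ˡ Bs _ _) (*-congˡ (sym (𝕊-view i _))))) ⟩
        ι 2 * 𝕊 (λ a → l² * on i A r a) + ι 5 * 𝕊 (λ a → ι s * loss i A r a) ∎
        where
        Bs = vecs (List.cartesianProduct ts ts) m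

      𝕀 : (Fin M → Vec Bool m → Fin R → Carrier) → Carrier
      𝕀 τ = ∑ (allFin M) (λ i → ∑ (cube m) (λ A → ∑ rs (τ i A)))

      𝕀-mono : ∀ {τ υ} → (∀ i A r → τ i A r ≤ υ i A r) → 𝕀 τ ≤ 𝕀 υ
      𝕀-mono h = ∑-mono (allFin M) λ i → ∑-mono (cube m) λ A → ∑-mono rs λ r → h i A r

      𝕀-+ : ∀ τ υ → 𝕀 (λ i A r → τ i A r + υ i A r) ≈ 𝕀 τ + 𝕀 υ
      𝕀-+ τ υ = trans (∑-cong (allFin M) λ i → trans (∑-cong (cube m) λ A → ∑-distrib-+ rs _ _) (∑-distrib-+ (cube m) _ _))
                      (∑-distrib-+ (allFin M) _ _)

      𝕀-*ˡ : ∀ k τ → 𝕀 (λ i A r → k * τ i A r) ≈ k * 𝕀 τ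
      𝕀-*ˡ k τ = trans (∑-cong (allFin M) λ i → trans (∑-cong (cube m) λ A → ∑-*ˡ rs k _) (∑-*ˡ (cube m) k _)) (∑-*ˡ (allFin M) k _)

      𝕀-𝕊 : ∀ k (τ : Fin M → Vec Bool m → Fin R → Triple × Blocks M → Carrier) →
            𝕀 (λ i A r → 𝕊 (λ a → k * τ i A r a)) ≈ k * 𝕊 (λ a → 𝕀 (λ i A r → τ i A r a))
      𝕀-𝕊 k τ = begin-equality
        𝕀 (λ i A r → 𝕊 (λ a → k * τ i A r a))
          ≈⟨ ∑-cong (allFin M) (λ i → trans (∑-cong (cube m) (λ A → ∑-swap rs arrs _)) (∑-swap (cube m) arrs _)) ⟩
        ∑ (allFin M) (λ i → ∑ arrs (λ a → ∑ (cube m) (λ A → ∑ rs (λ r → χ a * (k * τ i A r a)))))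
          ≈⟨ ∑-swap (allFin M) arrs _ ⟩
        ∑ arrs (λ a → 𝕀 (λ i A r → χ a * (k * τ i A r a)))
          ≈⟨ ∑-cong arrs (λ a → trans (𝕀-*ˡ (χ a) _) (*-congˡ (𝕀-*ˡ k _))) ⟩
        ∑ arrs (λ a → χ a * (k * 𝕀 (λ i A r → τ i A r a)))
          ≈⟨ trans (∑-cong arrs (λ a → solve 3 (λ x y z → x :* (y :* z) := y :* (x :* z)) refl (χ a) k _)) (∑-*ˡ arrs k _) ⟩
        k * 𝕊 (λ a → 𝕀 (λ i A r → τ i A r a)) ∎

      total : ι 5 * (k² * 𝕊 (λ a → 𝕀 (λ i A r → off i A r a)))
              ≤ ι 2 * (l² * 𝕊 (λ a → 𝕀 (λ i A r → on i A r a))) + ι 5 * (ι s * 𝕊 (λ a → 𝕀 (λ i A r → loss i A r a)))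
      total = ≤-resp-≈
        (trans (𝕀-*ˡ (ι 5) _) (*-congˡ (𝕀-𝕊 k² off)))
        (trans (𝕀-+ _ _) (+-cong (trans (𝕀-*ˡ (ι 2) _) (*-congˡ (𝕀-𝕊 l² on))) (trans (𝕀-*ˡ (ι 5) _) (*-congˡ (𝕀-𝕊 (ι s) loss)))))
        (𝕀-mono averaged)

      k : Carrier
      k = ι (2 ℕ.^ m)

      cube-const : ∀ c′ → ∑ (cube m) (λ _ → c′) ≈ k * c′
      cube-const c′ = trans (∑-vecs-const bools m c′) (*-congʳ (reflexive (cong (λ t → ι (t ℕ.^ m)) length-bools)))

      volume : Carrier
      volume = ι M * (k * (k * k))

      -- Summing over r before x and y recovers matrix entries, all equal to l; the volume counts
      -- coordinates, masks and pairs of vectors.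
      constant-sum : ∀ b l a → Valid (proj₁ a) (proj₂ a) →
                     (∀ i A x y → 2 ℕ.+ 2 ℕ.* ones (insertAt (x ⊓ A) i b) (insertAt (y ⊓ ∁ A) i b) ≡ l) →
                     𝕀 (λ i A r → slice (φ a r) i b A * slice (ψ a r) i b (∁ A)) ≈ volume * ι l
      constant-sum b l a val h = begin-equality
        𝕀 (λ i A r → slice (φ a r) i b A * slice (ψ a r) i b (∁ A))
          ≈⟨ ∑-cong (allFin M) (λ i → ∑-cong (cube m) (λ A → inner i A)) ⟩
        ∑ (allFin M) (λ i → ∑ (cube m) (λ A → k * (k * ι l)))
          ≈⟨ trans (∑-cong (allFin M) (λ i → cube-const _)) (∑-const (allFin M) _) ⟩
        ι (length (allFin M)) * (k * (k * (k * ι l)))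
          ≈⟨ *-congʳ (reflexive (cong ι (ListP.length-tabulate {n = M} id))) ⟩
        ι M * (k * (k * (k * ι l)))
          ≈⟨ solve 3 (λ m k l → m :* (k :* (k :* (k :* l))) := m :* (k :* (k :* k)) :* l) refl (ι M) k (ι l) ⟩
        volume * ι l ∎
        where
        inner : ∀ i A → ∑ rs (λ r → slice (φ a r) i b A * slice (ψ a r) i b (∁ A)) ≈ k * (k * ι l)
        inner i A = begin-equality
          ∑ rs (λ r → slice (φ a r) i b A * slice (ψ a r) i b (∁ A))
            ≈⟨ ∑-cong rs (λ r → ∑-*-∑ (cube m) (cube m) _ _) ⟩
          ∑ rs (λ r → ∑ (cube m) (λ x → ∑ (cube m) (λ y → τ r x y)))
            ≈⟨ trans (∑-swap rs (cube m) _) (∑-cong (cube m) (λ x → ∑-swap rs (cube m) _)) ⟩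
          ∑ (cube m) (λ x → ∑ (cube m) (λ y → ∑ rs (λ r → τ r x y)))
            ≈⟨ ∑-cong (cube m) (λ x → ∑-cong (cube m) (λ y →
                 trans (slack _ _ val (insertAt (x ⊓ A) i b) (insertAt (y ⊓ ∁ A) i b)) (reflexive (cong ι (h i A x y))))) ⟩
          ∑ (cube m) (λ x → ∑ (cube m) (λ y → ι l))
            ≈⟨ trans (∑-cong (cube m) (λ x → cube-const _)) (cube-const _) ⟩
          k * (k * ι l) ∎
          where
          τ : Fin R → Vec Bool m → Vec Bool m → Carrier
          τ r x y = φ a r (insertAt (x ⊓ A) i b) * ψ a r (insertAt (y ⊓ ∁ A) i b)

      sum-off : ∀ a → Valid (proj₁ a) (proj₂ a) → 𝕀 (λ i A r → off i A r a) ≈ volume * ι 2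
      sum-off a val = constant-sum false 2 a val (λ i A x y →
        cong (λ t → 2 ℕ.+ 2 ℕ.* t) (≡.trans (ones-insertAt (x ⊓ A) (y ⊓ ∁ A) i false false) (ones-masked x y A)))

      sum-on : ∀ a → Valid (proj₁ a) (proj₂ a) → 𝕀 (λ i A r → on i A r a) ≈ volume * ι 4
      sum-on a val = constant-sum true 4 a val (λ i A x y →
        cong (λ t → 2 ℕ.+ 2 ℕ.* t) (≡.trans (ones-insertAt (x ⊓ A) (y ⊓ ∁ A) i true true) (cong suc (ones-masked x y A))))

      G : Carrier
      G = ι (D ℕ.^ M) + ι s * (ι R * ι (c ℕ.^ M))

      K≈2k : ι (2 ℕ.^ M) ≈ ι 2 * k
      K≈2k = ι-^-suc 2 m

      -- Stated for any two families so that it applies again with cuts and joins exchanged. The 16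
      -- is 2 · 2³, as three full cubes are compared with cubes of one dimension less.
      one-loss : ∀ (φ′ ψ′ : Fin R → Vec Bool M → Carrier) (p : ∀ r x → 0# ≤ φ′ r x) (q : ∀ r y → 0# ≤ ψ′ r y)
                 (sl : ∀ x y → ones x y ≡ 0 → ∑ (allFin R) (λ r → φ′ r x * ψ′ r y) ≈ ι 2) →
                 ι 2 * (ι (D ℕ.^ M) * excessTotal R φ′ ψ′ p q sl) ≤ ι 16 * (volume * G)
      one-loss φ′ ψ′ p q sl = ≤-trans (excessTotal-≤ R φ′ ψ′ p q sl) (≤-reflexive (begin-equality
        ι 2 * (ι (2 ℕ.^ M) * (ι (2 ℕ.^ M) * (ι (2 ℕ.^ M) * (ι M * G))))
          ≈⟨ *-congˡ (*-cong K≈2k (*-cong K≈2k (*-congʳ K≈2k))) ⟩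
        ι 2 * (ι 2 * k * (ι 2 * k * (ι 2 * k * (ι M * G))))
          ≈⟨ solve 3 (λ k m g → con 2 :* (con 2 :* k :* (con 2 :* k :* (con 2 :* k :* (m :* g)))) := con 16 :* (m :* (k :* (k :* k)) :* g))
               refl k (ι M) G ⟩
        ι 16 * (volume * G) ∎))

      slack₀ : ∀ a → Valid (proj₁ a) (proj₂ a) → ∀ x y → ones x y ≡ 0 → ∑ rs (λ r → φ a r x * ψ a r y) ≈ ι 2
      slack₀ a val x y p = trans (slack _ _ val x y) (reflexive (cong (λ t → ι (2 ℕ.+ 2 ℕ.* t)) p))

      slack₀′ : ∀ a → Valid (proj₁ a) (proj₂ a) → ∀ x y → ones x y ≡ 0 → ∑ rs (λ r → ψ a r x * φ a r y) ≈ ι 2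
      slack₀′ a val x y p = trans (∑-cong rs (λ r → *-comm _ _)) (slack₀ a val y x (≡.trans (ones-comm y x) p))

      ∑-cube-∁ : ∀ {l} (τ : Vec Bool l → Carrier) → ∑ (cube l) (τ ∘ ∁) ≈ ∑ (cube l) τ
      ∑-cube-∁ {zero}  τ = trans (∑-vecs-zero bools _) (sym (∑-vecs-zero bools _))
      ∑-cube-∁ {suc l} τ = begin-equality
        ∑ (cube (suc l)) (τ ∘ ∁)
          ≈⟨ trans (∑-vecs-suc bools l _) (∑-bools _) ⟩
        ∑ (cube l) (λ v → τ (true ∷ ∁ v)) + ∑ (cube l) (λ v → τ (false ∷ ∁ v))
          ≈⟨ trans (+-cong (∑-cube-∁ (λ v → τ (true ∷ v))) (∑-cube-∁ (λ v → τ (false ∷ v)))) (+-comm _ _) ⟩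
        ∑ (cube l) (λ v → τ (false ∷ v)) + ∑ (cube l) (λ v → τ (true ∷ v))
          ≈⟨ sym (trans (∑-vecs-suc bools l _) (∑-bools _)) ⟩
        ∑ (cube (suc l)) τ ∎

      sum-loss : ∀ a → Valid (proj₁ a) (proj₂ a) →
                 ι 2 * (ι (D ℕ.^ M) * 𝕀 (λ i A r → loss i A r a)) ≤ ι 32 * (volume * G)
      sum-loss a val = begin
        ι 2 * (ι (D ℕ.^ M) * 𝕀 (λ i A r → loss i A r a))
          ≈⟨ *-congˡ (*-congˡ (trans (𝕀-+ _ _) (+-congˡ reindex))) ⟩
        ι 2 * (ι (D ℕ.^ M) * (Eφ + Eψ))
          ≈⟨ solve 4 (λ t d x y → t :* (d :* (x :+ y)) := t :* (d :* x) :+ t :* (d :* y)) refl (ι 2) (ι (D ℕ.^ M)) Eφ Eψ ⟩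
        ι 2 * (ι (D ℕ.^ M) * Eφ) + ι 2 * (ι (D ℕ.^ M) * Eψ)
          ≲⟨ +-mono (one-loss (φ a) (ψ a) (λ r x → 0≤f r _) (λ r y → 0≤g r _) (slack₀ a val))
                    (one-loss (ψ a) (φ a) (λ r y → 0≤g r _) (λ r x → 0≤f r _) (slack₀′ a val)) ⟩
        ι 16 * (volume * G) + ι 16 * (volume * G)
          ≈⟨ solve 1 (λ x → con 16 :* x :+ con 16 :* x := con 32 :* x) refl (volume * G) ⟩
        ι 32 * (volume * G) ∎
        where
        Eφ = excessTotal R (φ a) (ψ a) (λ r x → 0≤f r _) (λ r y → 0≤g r _) (slack₀ a val)
        Eψ = excessTotal R (ψ a) (φ a) (λ r y → 0≤g r _) (λ r x → 0≤f r _) (slack₀′ a val)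
        -- Complementing the mask exchanges the roles of φ and ψ.
        reindex : 𝕀 (λ i A r → lossψ i A r a) ≈ Eψ
        reindex = ∑-cong (allFin M) (λ i → trans
          (∑-cong (cube m) (λ A → ∑-cong rs (λ r → *-congˡ (reflexive (cong (slice (φ a r) i false) (≡.sym (∁-involutive A)))))))
          (∑-cube-∁ (λ A → ∑ rs (λ r → surplus (ψ a r) (insertAt A i true) i * slice (φ a r) i false (∁ A)))))

      𝕊-mono : ∀ {τ υ} → (∀ a → Valid (proj₁ a) (proj₂ a) → τ a ≤ υ a) → 𝕊 τ ≤ 𝕊 υ
      𝕊-mono h = ∑-mono arrs (λ a → onValid a (h a))

      𝕊-*ˡ : ∀ k τ → 𝕊 (λ a → k * τ a) ≈ k * 𝕊 τ
      𝕊-*ˡ k τ = trans (∑-cong arrs (λ a → solve 3 (λ x y z → x :* (y :* z) := y :* (x :* z)) refl (χ a) k _)) (∑-*ˡ arrs k _)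

      w : Carrier
      w = ∑ arrs χ

      𝕊-const : ∀ {τ} l → (∀ a → Valid (proj₁ a) (proj₂ a) → τ a ≈ l) → 𝕊 τ ≈ w * l
      𝕊-const l h = trans (≤-antisym (𝕊-mono (λ a v → ≤-reflexive (h a v))) (𝕊-mono (λ a v → ≤-reflexive (sym (h a v))))) (∑-*ʳ arrs l χ)

      -- One valid arrangement suffices for the total weight to be positive, which is what permits
      -- cancelling it.
      1≤w : 1# ≤ w
      1≤w = ≤-trans (≤-reflexive (sym (reflexive (cong (ι ∘ bit) (dec-true (valid? h₀ B₀) valid₀)))))
                    (∑-term {φ = χ} 0≤χ (∈P.∈-cartesianProduct⁺ h₀∈ B₀∈))

      scale : Carrier
      scale = ι 4 * (w * volume)

      -- The averaged inequality with the actual entries 2 and 4: 5 · 2 · s² against 2 · 4 · (s+1)²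
      -- and the loss. `scale` collects the common factors.
      combined : scale * (ι 5 * (k² * ι (D ℕ.^ M))) ≤ scale * (ι 4 * (l² * ι (D ℕ.^ M)) + ι 40 * (ι s * G))
      combined = begin
        scale * (ι 5 * (k² * DM))
          ≈⟨ solve 4 (λ w v k d → con 4 :* (w :* v) :* (con 5 :* (k :* d)) := con 2 :* (d :* (con 5 :* (k :* (w :* (v :* con 2))))))
               refl w volume k² DM ⟩
        ι 2 * (DM * (ι 5 * (k² * (w * (volume * ι 2)))))
          ≈⟨ *-congˡ (*-congˡ (*-congˡ (*-congˡ (sym (𝕊-const _ sum-off))))) ⟩
        ι 2 * (DM * (ι 5 * (k² * 𝕊 (λ a → 𝕀 (λ i A r → off i A r a)))))
          ≲⟨ *-monoˡ (ι-nonneg 2) (*-monoˡ (ι-nonneg (D ℕ.^ M)) total) ⟩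
        ι 2 * (DM * (ι 2 * (l² * 𝕊 (λ a → 𝕀 (λ i A r → on i A r a))) + ι 5 * (ι s * X)))
          ≈⟨ *-congˡ (*-congˡ (+-congʳ (*-congˡ (*-congˡ (𝕊-const _ sum-on))))) ⟩
        ι 2 * (DM * (ι 2 * (l² * (w * (volume * ι 4))) + ι 5 * (ι s * X)))
          ≈⟨ solve 6 (λ d l w v s x → con 2 :* (d :* (con 2 :* (l :* (w :* (v :* con 4))) :+ con 5 :* (s :* x)))
                        := con 4 :* (w :* v) :* (con 4 :* (l :* d)) :+ con 5 :* (s :* (con 2 :* (d :* x))))
               refl DM l² w volume (ι s) X ⟩
        scale * (ι 4 * (l² * DM)) + ι 5 * (ι s * (ι 2 * (DM * X)))
          ≲⟨ +-mono (≤-refl _) (*-monoˡ (ι-nonneg 5) (*-monoˡ (ι-nonneg s) loss-part)) ⟩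
        scale * (ι 4 * (l² * DM)) + ι 5 * (ι s * (w * (ι 32 * (volume * G))))
          ≈⟨ solve 5 (λ e w v s g → con 4 :* (w :* v) :* e :+ con 5 :* (s :* (w :* (con 32 :* (v :* g))))
                        := con 4 :* (w :* v) :* (e :+ con 40 :* (s :* g)))
               refl (ι 4 * (l² * DM)) w volume (ι s) G ⟩
        scale * (ι 4 * (l² * DM) + ι 40 * (ι s * G)) ∎
        where
        DM = ι (D ℕ.^ M)
        X = 𝕊 (λ a → 𝕀 (λ i A r → loss i A r a))
        loss-part : ι 2 * (DM * X) ≤ w * (ι 32 * (volume * G))
        loss-part = begin
          ι 2 * (DM * X)
            ≈⟨ sym (trans (𝕊-*ˡ (ι 2) _) (*-congˡ (𝕊-*ˡ DM _))) ⟩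
          𝕊 (λ a → ι 2 * (DM * 𝕀 (λ i A r → loss i A r a)))
            ≲⟨ 𝕊-mono sum-loss ⟩
          𝕊 (λ a → ι 32 * (volume * G))
            ≈⟨ 𝕊-const _ (λ a _ → refl) ⟩
          w * (ι 32 * (volume * G)) ∎

      1≤product : ∀ {x y} → 1# ≤ x → 1# ≤ y → 1# ≤ x * y
      1≤product p q = ≤-trans (≤-reflexive (sym (*-identityˡ 1#))) (*-mono 0≤1 (≤-trans 0≤1 q) p q)

      1≤k : 1# ≤ k
      1≤k = ι-mono (ℕP.m^n>0 2 m)

      1≤scale : 1# ≤ scale
      1≤scale = 1≤product (ι-mono {1} {4} (ℕ.s≤s ℕ.z≤n)) (1≤product 1≤w
        (1≤product (ι-mono {1} {M} (ℕ.s≤s ℕ.z≤n)) (1≤product 1≤k (1≤product 1≤k 1≤k))))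

    -- After cancellation both sides are numerals, so the inequality descends to the natural numbers
    -- and no trace of the field is left.
    rank-bound : 5 ℕ.* (s ℕ.* s ℕ.* D ℕ.^ suc m)
                 ℕ.≤ 4 ℕ.* (suc s ℕ.* suc s ℕ.* D ℕ.^ suc m) ℕ.+ 40 ℕ.* (s ℕ.* (D ℕ.^ suc m ℕ.+ s ℕ.* (R ℕ.* c ℕ.^ suc m)))
    rank-bound = ι-cancel-≤ (≤-resp-≈ (sym lhs) (sym rhs)
      (*-cancelˡ-pos (≤-trans 0≤1 1≤scale) (λ p → 1≰0 (≤-trans 1≤scale (≤-reflexive p))) combined))
      where
      DM sR : ℕ
      DM = D ℕ.^ M
      sR = s ℕ.* (R ℕ.* c ℕ.^ M)
      lhs : ι (5 ℕ.* (s ℕ.* s ℕ.* DM)) ≈ ι 5 * (k² * ι DM)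
      lhs = trans (ι-* 5 (s ℕ.* s ℕ.* DM)) (*-congˡ (trans (ι-* (s ℕ.* s) DM) (*-congʳ (ι-* s s))))
      rhs : ι (4 ℕ.* (suc s ℕ.* suc s ℕ.* DM) ℕ.+ 40 ℕ.* (s ℕ.* (DM ℕ.+ sR)))
            ≈ ι 4 * (l² * ι DM) + ι 40 * (ι s * G)
      rhs = trans (ι-+ (4 ℕ.* (suc s ℕ.* suc s ℕ.* DM)) (40 ℕ.* (s ℕ.* (DM ℕ.+ sR)))) (+-cong
        (trans (ι-* 4 (suc s ℕ.* suc s ℕ.* DM)) (*-congˡ (trans (ι-* (suc s ℕ.* suc s) DM) (*-congʳ (ι-* (suc s) (suc s))))))
        (trans (ι-* 40 (s ℕ.* (DM ℕ.+ sR))) (*-congˡ (trans (ι-* s (DM ℕ.+ sR)) (*-congˡ (trans (ι-+ DM sR)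
          (+-congˡ (trans (ι-* s (R ℕ.* c ℕ.^ M)) (*-congˡ (ι-* R (c ℕ.^ M)))))))))))

-- Farkas' lemma

module Farkas (F : OrderedField) (stable : ∀ x y → ¬ ¬ (OrderedField._≤_ F x y) → OrderedField._≤_ F x y) where

  open Ordered F

  module _ {V : Set} (_⊞[_]_ : V → Carrier → V → V) where

    -- `y ⊞[ t ] z` plays the role of y + t z; with t chosen suitably it also supplies negatives and
    -- multiples.
    Linear : (V → Carrier) → Set
    Linear φ = ∀ y t z → φ (y ⊞[ t ] z) ≈ φ y + t * φ z

    -- Drop the first functional.  If c is then no longer a consequence of the
    -- others, a witness y₀ is positive at it, and the induction hypothesis applies
    -- after projecting along y₀ onto its kernel.
    farkas : ∀ k (a : Fin k → V → Carrier) → (∀ i → Linear (a i)) → (c : V → Carrier) → Linear c →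
             (∀ y → (∀ i → a i y ≤ 0#) → c y ≤ 0#) →
             ¬ ¬ (Σ (Fin k → Carrier) λ l → (∀ i → 0# ≤ l i) × (∀ y → c y ≈ ∑ (allFin k) (λ i → l i * a i y)))
    farkas zero a lin-a c lin-c hyp contra = contra ((λ ()) , (λ ()) , λ y → ≤-antisym (hyp y (λ ())) (lower y))
      where
      two : Carrier
      two = 1# + 1#
      lower : ∀ y → 0# ≤ c y
      -- The vector y - 2 y serves as -y.
      lower y = ≤-resp-≈ eq (+-identityˡ _) (+-mono-≤ (c y) (≤-resp-≈ (lin-c y (- two) y) refl (hyp (y ⊞[ - two ] y) (λ ()))))
        where
        eq : (c y + - two * c y) + c y ≈ 0#
        eq = begin-equality
          (c y + - two * c y) + c y     ≈⟨ solve 2 (λ x u → (x :+ u) :+ x := con 2 :* x :+ u) refl (c y) (- two * c y) ⟩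
          ι 2 * c y + - two * c y       ≈⟨ sym (distribʳ (c y) _ _) ⟩
          (ι 2 + - two) * c y           ≈⟨ *-congʳ (-‿inverseʳ two) ⟩
          0# * c y                      ≈⟨ zeroˡ _ ⟩
          0# ∎
    farkas (suc k) a lin-a c lin-c hyp contra = ¬¬-excluded-middle {A = Separator} by-cases
      where
      Separator : Set
      Separator = Σ V λ y → (∀ i → a (suc i) y ≤ 0#) × ¬ (c y ≤ 0#)
      by-cases : ¬ Dec Separator
      by-cases (no none) = farkas k (a ∘ suc) (lin-a ∘ suc) c lin-c
        (λ y h → stable _ _ (λ n → none (y , h , n)))
        (λ { (l , 0≤l , eq) → contra
          ( (λ { zero → 0# ; (suc i) → l i })
          , (λ { zero → ≤-refl 0# ; (suc i) → 0≤l i })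
          , λ y → trans (eq y) (sym (trans (∑-allFin-suc k _) (trans (+-congʳ (zeroˡ _)) (+-identityˡ _))))) })
      by-cases (yes (y₀ , h₀ , n₀)) = farkas k (λ i y → a (suc i) (T y)) (λ i → lin-∘T (lin-a (suc i))) (c ∘ T) (lin-∘T lin-c) hyp′ conclude
        where
        θ : Carrier
        θ = a zero y₀
        θ≰0 : ¬ (θ ≤ 0#)
        θ≰0 p = n₀ (hyp y₀ (λ { zero → p ; (suc i) → h₀ i }))
        0≤θ : 0# ≤ θ
        0≤θ = Sum.[ (λ p → p) , (λ p → ⊥-elim (θ≰0 p)) ]′ (≤-total 0# θ)
        inv = inverse θ (λ p → θ≰0 (≤-reflexive p))
        η = proj₁ inv
        0≤η : 0# ≤ η
        0≤η = inverse-nonneg 0≤θ (proj₂ inv)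
        T : V → V
        T y = y ⊞[ - (a zero y * η) ] y₀
        lin-∘T : ∀ {φ} → Linear φ → Linear (φ ∘ T)
        lin-∘T {φ} lin y t z = begin-equality
          φ (T (y ⊞[ t ] z))
            ≈⟨ trans (lin _ _ _) (+-cong (lin _ _ _) (*-congʳ eq)) ⟩
          (φ y + t * φ z) + (- (a zero y * η) + t * - (a zero z * η)) * φ y₀
            ≈⟨ solve 6 (λ p t q u v r → (p :+ t :* q) :+ (u :+ t :* v) :* r := (p :+ u :* r) :+ t :* (q :+ v :* r)) refl
                 (φ y) t (φ z) (- (a zero y * η)) (- (a zero z * η)) (φ y₀) ⟩
          (φ y + - (a zero y * η) * φ y₀) + t * (φ z + - (a zero z * η) * φ y₀)
            ≈⟨ sym (+-cong (lin _ _ _) (*-congˡ (lin _ _ _))) ⟩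
          φ (T y) + t * φ (T z) ∎
          where
          eq : - (a zero (y ⊞[ t ] z) * η) ≈ - (a zero y * η) + t * - (a zero z * η)
          eq = begin-equality
            - (a zero (y ⊞[ t ] z) * η)                      ≈⟨ -‿cong (trans (*-congʳ (lin-a zero y t z)) (trans (distribʳ _ _ _) (+-congˡ (*-assoc _ _ _)))) ⟩
            - (a zero y * η + t * (a zero z * η))            ≈⟨ sym (-‿+-comm _ _) ⟩
            - (a zero y * η) + - (t * (a zero z * η))        ≈⟨ +-congˡ (-‿distribʳ-* _ _) ⟩
            - (a zero y * η) + t * - (a zero z * η)          ∎
        kernel : ∀ y → a zero (T y) ≈ 0#
        kernel y = begin-equality
          a zero (T y)                                 ≈⟨ lin-a zero _ _ _ ⟩
          a zero y + - (a zero y * η) * θ              ≈⟨ +-congˡ (trans (sym (-‿distribˡ-* _ _)) (-‿cong (trans (*-assoc _ _ _)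
                                                            (trans (*-congˡ (trans (*-comm _ _) (proj₂ inv))) (*-identityʳ _))))) ⟩
          a zero y + - a zero y                        ≈⟨ -‿inverseʳ _ ⟩
          0# ∎
        hyp′ : ∀ y → (∀ i → a (suc i) (T y) ≤ 0#) → c (T y) ≤ 0#
        hyp′ y h = hyp (T y) (λ { zero → ≤-reflexive (kernel y) ; (suc i) → h i })
        conclude : ¬ (Σ (Fin k → Carrier) λ l → (∀ i → 0# ≤ l i) × (∀ y → c (T y) ≈ ∑ (allFin k) (λ i → l i * a (suc i) (T y))))
        conclude (l , 0≤l , eq) = contra
          ( (λ { zero → l₀ ; (suc i) → l i })
          , (λ { zero → *-nonneg 0≤η (≤-diff S≤c) ; (suc i) → 0≤l i })
          , λ y → sym (trans (∑-allFin-suc k _) (identity y)))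
          where
          S : V → Carrier
          S y = ∑ (allFin k) (λ i → l i * a (suc i) y)
          S-nonpos : S y₀ ≤ 0#
          S-nonpos = ≤-trans (∑-mono (allFin k) (λ i → ≤-trans (*-monoˡ (0≤l i) (h₀ i)) (≤-reflexive (zeroʳ _)))) (≤-reflexive (∑-zero (allFin k) (λ _ → refl)))
          S≤c : S y₀ ≤ c y₀
          S≤c = ≤-trans S-nonpos (Sum.[ (λ p → p) , (λ p → ⊥-elim (n₀ p)) ]′ (≤-total 0# (c y₀)))
          -- The missing multiplier is forced by the identity at y₀, as η inverts a₀(y₀). It is
          -- nonnegative because S y₀ ≤ 0 ≤ c y₀.
          l₀ : Carrier
          l₀ = η * (c y₀ + - S y₀)
          S-linear : ∀ y t z → S (y ⊞[ t ] z) ≈ S y + t * S z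
          S-linear y t z = begin-equality
            S (y ⊞[ t ] z)
              ≈⟨ ∑-cong (allFin k) (λ i → trans (*-congˡ (lin-a (suc i) y t z))
                   (solve 4 (λ l p t q → l :* (p :+ t :* q) := l :* p :+ t :* (l :* q)) refl (l i) _ t _)) ⟩
            ∑ (allFin k) (λ i → l i * a (suc i) y + t * (l i * a (suc i) z))
              ≈⟨ trans (∑-distrib-+ (allFin k) _ _) (+-congˡ (∑-*ˡ (allFin k) t _)) ⟩
            S y + t * S z ∎
          identity : ∀ y → l₀ * a zero y + S y ≈ c y
          identity y = +-cancelʳ-≈ (u * c y₀) (begin-equality
            (l₀ * a zero y + S y) + u * c y₀
              ≈⟨ +-congʳ (+-comm _ _) ⟩
            (S y + l₀ * a zero y) + u * c y₀
              ≈⟨ +-congʳ (+-congˡ swap-l₀) ⟩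
            (S y + - u * (c y₀ + - S y₀)) + u * c y₀
              ≈⟨ +-congʳ (+-congˡ (trans (distribˡ _ _ _) (+-congˡ (trans (sym (-‿distribˡ-* _ _))
                   (trans (-‿distribʳ-* _ _) (*-congˡ (-‿involutive _))))))) ⟩
            (S y + (- u * c y₀ + u * S y₀)) + u * c y₀
              ≈⟨ solve 4 (λ s p q r → (s :+ (p :+ q)) :+ r := (s :+ q) :+ (p :+ r)) refl (S y) (- u * c y₀) (u * S y₀) (u * c y₀) ⟩
            (S y + u * S y₀) + (- u * c y₀ + u * c y₀)
              ≈⟨ trans (+-congˡ (trans (+-congʳ (sym (-‿distribˡ-* _ _))) (-‿inverseˡ _))) (+-identityʳ _) ⟩
            S y + u * S y₀
              ≈⟨ sym (S-linear y u y₀) ⟩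
            S (T y)
              ≈⟨ sym (eq y) ⟩
            c (T y)
              ≈⟨ lin-c y u y₀ ⟩
            c y + u * c y₀ ∎)
            where
            u : Carrier
            u = - (a zero y * η)
            swap-l₀ : l₀ * a zero y ≈ - u * (c y₀ + - S y₀)
            swap-l₀ = trans (solve 3 (λ e d z → e :* d :* z := z :* e :* d) refl η _ (a zero y)) (*-congʳ (sym (-‿involutive _)))

-- Factoring a valid inequality through the slacks of the extension

module Factorisation (F : OrderedField) (stable : ∀ x y → ¬ ¬ (OrderedField._≤_ F x y) → OrderedField._≤_ F x y) where

  open Ordered F
  open Farkas F stable

  ∑-allFin-+ : ∀ m n (φ : Fin (m ℕ.+ n) → Carrier) →
               ∑ (allFin (m ℕ.+ n)) φ ≈ ∑ (allFin m) (λ i → φ (i Fin.↑ˡ n)) + ∑ (allFin n) (λ i → φ (m Fin.↑ʳ i))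
  ∑-allFin-+ zero    n φ = sym (+-identityˡ _)
  ∑-allFin-+ (suc m) n φ = begin-equality
    ∑ (allFin (suc m ℕ.+ n)) φ
      ≈⟨ ∑-allFin-suc (m ℕ.+ n) φ ⟩
    φ zero + ∑ (allFin (m ℕ.+ n)) (φ ∘ suc)
      ≈⟨ +-congˡ (∑-allFin-+ m n (φ ∘ suc)) ⟩
    φ zero + (∑ (allFin m) (λ i → φ (suc i Fin.↑ˡ n)) + ∑ (allFin n) (λ i → φ (suc m Fin.↑ʳ i)))
      ≈⟨ trans (sym (+-assoc _ _ _)) (+-congʳ (sym (∑-allFin-suc m (λ i → φ (i Fin.↑ˡ n))))) ⟩
    ∑ (allFin (suc m)) (λ i → φ (i Fin.↑ˡ n)) + ∑ (allFin n) (λ i → φ (suc m Fin.↑ʳ i)) ∎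

  module _ {Y : Set} (_⊞[_]_ : Y → Carrier → Y → Y)
           {size neq : ℕ}
           (α : Fin size → Y → Carrier) (lin-α : ∀ r → Linear _⊞[_]_ (α r)) (b : Fin size → Carrier)
           (ε : Fin neq → Y → Carrier) (lin-ε : ∀ r → Linear _⊞[_]_ (ε r)) (d : Fin neq → Carrier) where

    InQ : Y → Set
    InQ y = (∀ r → α r y ≤ b r) × (∀ r → ε r y ≈ d r)

    -- The constant slack 1 carries the multiplier of 0 ≤ u, that is, the amount by which the
    -- combined inequality is stronger than the given one. It accounts for the + 1 in the size of
    -- the factorisation.
    slackOf : Y → Fin (suc size) → Carrier
    slackOf y zero    = 1#
    slackOf y (suc r) = b r + - α r y

    slackOf-nonneg : ∀ y → InQ y → ∀ r → 0# ≤ slackOf y r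
    slackOf-nonneg y q zero    = 0≤1
    slackOf-nonneg y q (suc r) = ≤-diff (proj₁ q r)

    module _ (γ : Y → Carrier) (lin-γ : Linear _⊞[_]_ γ) (y₀ : Y) (y₀∈Q : InQ y₀)
             (valid : ∀ y → InQ y → 1# ≤ γ y) where

      private
        V : Set
        V = Y × Carrier

        _⊞′[_]_ : V → Carrier → V → V
        (y , u) ⊞′[ t ] (z , v) = (y ⊞[ t ] z) , (u + t * v)

        -- Farkas' lemma is homogeneous, so the polyhedron is replaced by its cone with u as the
        -- scale; the inequality 1 ≤ γ y becomes u ≤ γ y, i.e. `target` ≤ 0.
        homogenise : (Y → Carrier) → Carrier → V → Carrier
        homogenise φ β (y , u) = φ y + - (β * u)

        -- One row for each inequality, two for each equation, and 0 ≤ u.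
        K : ℕ
        K = size ℕ.+ (neq ℕ.+ (neq ℕ.+ 1))

        rows : Fin size ⊎ Fin (neq ℕ.+ (neq ℕ.+ 1)) → V → Carrier
        rows₁ : Fin neq ⊎ Fin (neq ℕ.+ 1) → V → Carrier
        rows₂ : Fin neq ⊎ Fin 1 → V → Carrier
        rows (inj₁ r) = homogenise (α r) (b r)
        rows (inj₂ j) = rows₁ (Fin.splitAt neq j)
        rows₁ (inj₁ r) = homogenise (ε r) (d r)
        rows₁ (inj₂ j) = rows₂ (Fin.splitAt neq j)
        rows₂ (inj₁ r) yu = - homogenise (ε r) (d r) yu
        rows₂ (inj₂ _) (y , u) = - u

        row : Fin K → V → Carrier
        row j = rows (Fin.splitAt size j)

        lin-homogenise : ∀ {φ} β → Linear _⊞[_]_ φ → Linear _⊞′[_]_ (homogenise φ β)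
        lin-homogenise {φ} β lin (y , u) t (z , v) = begin-equality
          φ (y ⊞[ t ] z) + - (β * (u + t * v))
            ≈⟨ +-cong (lin y t z) (trans (-‿cong (trans (distribˡ _ _ _) (+-congˡ
                 (solve 3 (λ a b c → a :* (b :* c) := b :* (a :* c)) refl β t v)))) (sym (-‿+-comm _ _))) ⟩
          (φ y + t * φ z) + (- (β * u) + - (t * (β * v)))
            ≈⟨ +-congˡ (+-congˡ (-‿distribʳ-* t (β * v))) ⟩
          (φ y + t * φ z) + (- (β * u) + t * - (β * v))
            ≈⟨ solve 5 (λ a t b c d → (a :+ t :* b) :+ (c :+ t :* d) := (a :+ c) :+ t :* (b :+ d)) refl (φ y) t (φ z) _ _ ⟩
          homogenise φ β (y , u) + t * homogenise φ β (z , v) ∎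

        lin-neg : ∀ {φ} → Linear _⊞′[_]_ φ → Linear _⊞′[_]_ (λ y → - φ y)
        lin-neg lin y t z = trans (-‿cong (lin y t z)) (trans (sym (-‿+-comm _ _)) (+-congˡ (-‿distribʳ-* _ _)))

        lin-rows : ∀ j → Linear _⊞′[_]_ (rows j)
        lin-rows₁ : ∀ j → Linear _⊞′[_]_ (rows₁ j)
        lin-rows₂ : ∀ j → Linear _⊞′[_]_ (rows₂ j)
        lin-rows (inj₁ r) = lin-homogenise (b r) (lin-α r)
        lin-rows (inj₂ j) = lin-rows₁ (Fin.splitAt neq j)
        lin-rows₁ (inj₁ r) = lin-homogenise (d r) (lin-ε r)
        lin-rows₁ (inj₂ j) = lin-rows₂ (Fin.splitAt neq j)
        lin-rows₂ (inj₁ r) = lin-neg (lin-homogenise (d r) (lin-ε r))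
        lin-rows₂ (inj₂ _) = lin-neg {φ = proj₂} (λ _ _ _ → refl)

        target : V → Carrier
        target (y , u) = u + - γ y

        lin-target : Linear _⊞′[_]_ target
        lin-target (y , u) t (z , v) = begin-equality
          (u + t * v) + - γ (y ⊞[ t ] z)
            ≈⟨ +-congˡ (trans (-‿cong (lin-γ y t z)) (trans (sym (-‿+-comm _ _)) (+-congˡ (-‿distribʳ-* _ _)))) ⟩
          (u + t * v) + (- γ y + t * - γ z)
            ≈⟨ solve 5 (λ a t b c d → (a :+ t :* b) :+ (c :+ t :* d) := (a :+ c) :+ t :* (b :+ d)) refl u t v _ _ ⟩
          target (y , u) + t * target (z , v) ∎

        at-α : ∀ yu r → row (r Fin.↑ˡ _) yu ≈ rows (inj₁ r) yu
        at-α yu r = reflexive (cong (λ j → rows j yu) (FinP.splitAt-↑ˡ size r _))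

        at₁ : ∀ yu j → row (size Fin.↑ʳ j) yu ≈ rows₁ (Fin.splitAt neq j) yu
        at₁ yu j = reflexive (cong (λ j → rows j yu) (FinP.splitAt-↑ʳ size _ j))

        at-ε : ∀ yu r → row (size Fin.↑ʳ (r Fin.↑ˡ _)) yu ≈ rows₁ (inj₁ r) yu
        at-ε yu r = trans (at₁ yu (r Fin.↑ˡ _)) (reflexive (cong (λ j → rows₁ j yu) (FinP.splitAt-↑ˡ neq r _)))

        at₂ : ∀ yu j → row (size Fin.↑ʳ (neq Fin.↑ʳ j)) yu ≈ rows₂ (Fin.splitAt neq j) yu
        at₂ yu j = trans (at₁ yu (neq Fin.↑ʳ j)) (reflexive (cong (λ j → rows₁ j yu) (FinP.splitAt-↑ʳ neq _ j)))

        at-ε⁻ : ∀ yu r → row (size Fin.↑ʳ (neq Fin.↑ʳ (r Fin.↑ˡ 1))) yu ≈ rows₂ (inj₁ r) yu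
        at-ε⁻ yu r = trans (at₂ yu (r Fin.↑ˡ 1)) (reflexive (cong (λ j → rows₂ j yu) (FinP.splitAt-↑ˡ neq r 1)))

        at-u : ∀ yu → row (size Fin.↑ʳ (neq Fin.↑ʳ (neq Fin.↑ʳ zero))) yu ≈ - proj₂ yu
        at-u yu = trans (at₂ yu (neq Fin.↑ʳ zero)) (reflexive (cong (λ j → rows₂ j yu) (FinP.splitAt-↑ʳ neq 1 zero)))

        module Conic (y : Y) (u : Carrier) (h : ∀ j → row j (y , u) ≤ 0#) where

          x-x≤0 : ∀ {x z} → x + - z ≤ 0# → x ≤ z
          x-x≤0 {x} {z} p = ≤-resp-≈ (diff-+ z x) (+-identityˡ z) (+-mono-≤ z p)

          α≤ : ∀ r → α r y ≤ b r * u
          α≤ r = x-x≤0 (≤-resp-≈ (at-α _ r) refl (h _))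

          ε≈ : ∀ r → ε r y ≈ d r * u
          ε≈ r = ≤-antisym (x-x≤0 (≤-resp-≈ (at-ε _ r) refl (h _)))
                           (diff-≤ (≤-resp-≈ refl (-‿involutive _) (neg-flip (≤-resp-≈ (at-ε⁻ _ r) refl (h _)))))

          0≤u : 0# ≤ u
          0≤u = ≤-resp-≈ refl (-‿involutive u) (neg-flip (≤-resp-≈ (at-u _) refl (h _)))

          goal : u ≤ γ y → target (y , u) ≤ 0#
          goal p = neg-flip′ (≤-resp-≈ refl (sym (trans (sym (-‿+-comm _ _)) (trans (+-congˡ (-‿involutive _)) (+-comm _ _)))) (≤-diff p))

          finite : ¬ (u ≈ 0#) → u ≤ γ y
          finite u≉0 = ≤-resp-≈ (*-identityʳ u) (trans (*-congˡ (value lin-γ)) cancel) (*-monoˡ 0≤u (valid y₁ y₁∈Q))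
            where
            inv = inverse u u≉0
            η = proj₁ inv
            0≤η : 0# ≤ η
            0≤η = inverse-nonneg 0≤u (proj₂ inv)
            y₁ : Y
            -- This is η y, the point at scale 1 on the ray through (y, u).
            y₁ = y ⊞[ η + - 1# ] y
            value : ∀ {φ} → Linear _⊞[_]_ φ → φ y₁ ≈ η * φ y
            value {φ} lin = begin-equality
              φ y₁                              ≈⟨ lin _ _ _ ⟩
              φ y + (η + - 1#) * φ y            ≈⟨ +-congʳ (sym (*-identityˡ _)) ⟩
              1# * φ y + (η + - 1#) * φ y       ≈⟨ sym (distribʳ _ _ _) ⟩
              (1# + (η + - 1#)) * φ y           ≈⟨ *-congʳ (trans (+-comm _ _) (diff-+ 1# η)) ⟩
              η * φ y                           ∎
            cancel : ∀ {x} → u * (η * x) ≈ x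
            cancel = trans (sym (*-assoc _ _ _)) (trans (*-congʳ (proj₂ inv)) (*-identityˡ _))
            rescale : ∀ β → η * (β * u) ≈ β
            rescale β = trans (solve 3 (λ e b u → e :* (b :* u) := u :* (e :* b)) refl η β u) cancel
            y₁∈Q : InQ y₁
            y₁∈Q = (λ r → ≤-resp-≈ (sym (value (lin-α r))) (rescale (b r)) (*-monoˡ 0≤η (α≤ r)))
                 , (λ r → trans (value (lin-ε r)) (trans (*-congˡ (ε≈ r)) (rescale (d r))))

          -- At scale 0, y is a recession direction. If γ decreased along it, moving from y₀ within
          -- the polyhedron would reach a point with γ = 0, against 1 ≤ γ.
          recession : u ≈ 0# → u ≤ γ y
          recession u≈0 = ≤-trans (≤-reflexive u≈0) (stable _ _ absurd)
            where
            absurd : ¬ ¬ (0# ≤ γ y)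
            absurd n = 1≰0 (≤-resp-≈ refl cancel (valid y₂ y₂∈Q))
              where
              γ≤0 : γ y ≤ 0#
              γ≤0 = Sum.[ (λ p → p) , (λ p → ⊥-elim (n p)) ]′ (≤-total (γ y) 0#)
              inv = inverse (- γ y) (λ p → n (≤-reflexive (sym (trans (sym (-‿involutive _)) (trans (-‿cong p) -0#≈0#)))))
              t : Carrier
              -- The step length at which γ becomes exactly 0, namely γ y₀ / (- γ y).
              t = γ y₀ * proj₁ inv
              0≤t : 0# ≤ t
              0≤t = *-nonneg (≤-trans 0≤1 (valid y₀ y₀∈Q)) (inverse-nonneg (neg-flip γ≤0) (proj₂ inv))
              y₂ : Y
              y₂ = y₀ ⊞[ t ] y
              vanish : ∀ {β} → β * u ≈ 0#
              vanish = trans (*-congˡ u≈0) (zeroʳ _)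
              y₂∈Q : InQ y₂
              y₂∈Q = (λ r → ≤-resp-≈ (sym (lin-α r _ _ _)) (trans (+-congˡ (zeroʳ t)) (+-identityʳ _))
                                (+-mono (proj₁ y₀∈Q r) (*-monoˡ 0≤t (≤-trans (α≤ r) (≤-reflexive vanish)))))
                   , (λ r → trans (lin-ε r _ _ _) (trans (+-cong (proj₂ y₀∈Q r) (trans (*-congˡ (trans (ε≈ r) vanish)) (zeroʳ t))) (+-identityʳ _)))
              cancel : γ y₂ ≈ 0#
              cancel = begin-equality
                γ y₂                                    ≈⟨ lin-γ _ _ _ ⟩
                γ y₀ + γ y₀ * proj₁ inv * γ y           ≈⟨ +-congˡ (trans (*-assoc _ _ _) (*-congˡ (trans (*-comm _ _)
                                                             (trans (*-congʳ (sym (-‿involutive _))) (sym (-‿distribˡ-* _ _)))))) ⟩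
                γ y₀ + γ y₀ * - (- γ y * proj₁ inv)     ≈⟨ +-congˡ (trans (*-congˡ (-‿cong (proj₂ inv))) (trans (sym (-‿distribʳ-* _ _)) (-‿cong (*-identityʳ _)))) ⟩
                γ y₀ + - γ y₀                           ≈⟨ -‿inverseʳ _ ⟩
                0#                                      ∎

          conic : target (y , u) ≤ 0#
          conic = goal (stable _ _ (¬¬-map by-cases ¬¬-excluded-middle))
            where
            by-cases : Dec (u ≈ 0#) → u ≤ γ y
            by-cases (yes p) = recession p
            by-cases (no p)  = finite p

      Factors : Set
      Factors = Σ (Fin (suc size) → Carrier) λ g → (∀ r → 0# ≤ g r) ×
                  (∀ y → InQ y → γ y ≈ 1# + ∑ (allFin (suc size)) (λ r → slackOf y r * g r))

      slack-factors : ¬ ¬ Factors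
      slack-factors = ¬¬-map finish (farkas _⊞′[_]_ K row (λ j → lin-rows (Fin.splitAt size j)) target lin-target
                                       (λ yu h → Conic.conic (proj₁ yu) (proj₂ yu) h))
        where
        finish : (Σ (Fin K → Carrier) λ l → (∀ i → 0# ≤ l i) × (∀ yu → target yu ≈ ∑ (allFin K) (λ i → l i * row i yu))) → Factors
        -- The identity is read at u = 1. Both groups of equation rows vanish on the polyhedron, so
        -- the number of equations does not enter the size.
        finish (l , 0≤l , eq) = g , 0≤g , identity
          where
          jα : Fin size → Fin K
          jα r = r Fin.↑ˡ _
          ju : Fin K
          ju = size Fin.↑ʳ (neq Fin.↑ʳ (neq Fin.↑ʳ zero))
          g : Fin (suc size) → Carrier
          g zero    = l ju
          g (suc r) = l (jα r)
          0≤g : ∀ r → 0# ≤ g r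
          0≤g zero    = 0≤l _
          0≤g (suc r) = 0≤l _
          module _ (y : Y) (q : InQ y) where
            tight-row : ∀ r → homogenise (ε r) (d r) (y , 1#) ≈ 0#
            tight-row r = trans (+-cong (proj₂ q r) (-‿cong (*-identityʳ _))) (-‿inverseʳ _)
            A S : Carrier
            A = ∑ (allFin size) (λ r → l (jα r) * (α r y + - (b r * 1#)))
            S = ∑ (allFin size) (λ r → (b r + - α r y) * l (jα r))
            expand : ∑ (allFin K) (λ i → l i * row i (y , 1#)) ≈ A + l ju * - 1#
            expand = begin-equality
              ∑ (allFin K) (λ i → l i * row i (y , 1#))
                ≈⟨ ∑-allFin-+ size _ _ ⟩
              _ ≈⟨ +-cong (∑-cong (allFin size) (λ r → *-congˡ (at-α _ r)))
                     (trans (∑-allFin-+ neq _ _) (trans (+-cong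
                        (∑-zero (allFin neq) (λ r → trans (*-congˡ (trans (at-ε _ r) (tight-row r))) (zeroʳ _)))
                        (trans (∑-allFin-+ neq 1 _) (trans (+-cong
                          (∑-zero (allFin neq) (λ r → trans (*-congˡ (trans (at-ε⁻ _ r) (trans (-‿cong (tight-row r)) -0#≈0#))) (zeroʳ _)))
                          (+-identityʳ _)) (+-identityˡ _)))) (+-identityˡ _))) ⟩
              A + l ju * row ju (y , 1#)
                ≈⟨ +-congˡ (*-congˡ (at-u _)) ⟩
              A + l ju * - 1# ∎
            cancel : S + A ≈ 0#
            cancel = trans (sym (∑-distrib-+ (allFin size) _ _)) (∑-zero (allFin size) (λ r → begin-equality
              (b r + - α r y) * l (jα r) + l (jα r) * (α r y + - (b r * 1#))
                ≈⟨ +-congˡ (*-congˡ (+-congˡ (-‿cong (*-identityʳ _)))) ⟩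
              (b r + - α r y) * l (jα r) + l (jα r) * (α r y + - b r)
                ≈⟨ solve 5 (λ b a n m l → (b :+ n) :* l :+ l :* (a :+ m) := ((b :+ m) :+ (a :+ n)) :* l) refl (b r) (α r y) (- α r y) (- b r) (l (jα r)) ⟩
              ((b r + - b r) + (α r y + - α r y)) * l (jα r)
                ≈⟨ *-congʳ (trans (+-cong (-‿inverseʳ _) (-‿inverseʳ _)) (+-identityˡ _)) ⟩
              0# * l (jα r)
                ≈⟨ zeroˡ _ ⟩
              0# ∎))
            identity : γ y ≈ 1# + ∑ (allFin (suc size)) (λ r → slackOf y r * g r)
            identity = sym (+-cancelʳ-≈ (A + l ju * - 1#) (begin-equality
              (1# + ∑ (allFin (suc size)) (λ r → slackOf y r * g r)) + (A + l ju * - 1#)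
                ≈⟨ +-congʳ (+-congˡ (∑-allFin-suc size _)) ⟩
              (1# + (1# * l ju + S)) + (A + l ju * - 1#)
                ≈⟨ solve 5 (λ o l s a n → (o :+ (o :* l :+ s)) :+ (a :+ l :* n) := o :+ (l :* (o :+ n) :+ (s :+ a))) refl 1# (l ju) S A (- 1#) ⟩
              1# + (l ju * (1# + - 1#) + (S + A))
                ≈⟨ +-congˡ (trans (+-cong (trans (*-congˡ (-‿inverseʳ 1#)) (zeroʳ _)) cancel) (+-identityʳ _)) ⟩
              1# + 0#
                ≈⟨ +-identityʳ 1# ⟩
              1#
                ≈⟨ sym (trans (+-comm _ _) (diff-+ (γ y) 1#)) ⟩
              γ y + target (y , 1#)
                ≈⟨ +-congˡ (trans (eq (y , 1#)) expand) ⟩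
              γ y + (A + l ju * - 1#) ∎))

-- Double negation

return : {A : Set} → A → ¬ ¬ A
return a k = k a

¬¬-map₂ : {A B C : Set} → (A → B → C) → ¬ ¬ A → ¬ ¬ B → ¬ ¬ C
¬¬-map₂ f a b k = a (λ x → b (λ y → k (f x y)))

¬¬-∀Fin : ∀ {n} {P : Fin n → Set} → (∀ i → ¬ ¬ P i) → ¬ ¬ (∀ i → P i)
¬¬-∀Fin {zero}  h k = k (λ ())
¬¬-∀Fin {suc n} h k = h zero (λ p → ¬¬-∀Fin (h ∘ suc) (λ ps → k (λ { zero → p ; (suc i) → ps i })))

-- An ordered field with the same carrier whose relations are stable under
-- double negation, so that order statements can be proved by classical case
-- distinctions.
stabilise : OrderedField → OrderedField
stabilise F = record
  { cring = record
    { Carrier = Carrier ; _≈_ = λ x y → ¬ ¬ (x ≈ y) ; _+_ = _+_ ; _*_ = _*_ ; -_ = -_ ; 0# = 0# ; 1# = 1#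
    ; isCommutativeRing = record
      { isRing = record
        { +-isAbelianGroup = record
          { isGroup = record
            { isMonoid = record
              { isSemigroup = record
                { isMagma = record
                  { isEquivalence = record { refl = return refl ; sym = ¬¬-map sym ; trans = ¬¬-map₂ trans }
                  ; ∙-cong = ¬¬-map₂ +-cong }
                ; assoc = λ x y z → return (+-assoc x y z) }
              ; identity = (λ x → return (+-identityˡ x)) , (λ x → return (+-identityʳ x)) }
            ; inverse = (λ x → return (-‿inverseˡ x)) , (λ x → return (-‿inverseʳ x))
            ; ⁻¹-cong = ¬¬-map -‿cong }
          ; comm = λ x y → return (+-comm x y) }
        ; *-cong = ¬¬-map₂ *-cong
        ; *-assoc = λ x y z → return (*-assoc x y z)
        ; *-identity = (λ x → return (*-identityˡ x)) , (λ x → return (*-identityʳ x))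
        ; distrib = (λ x y z → return (distribˡ x y z)) , (λ x y z → return (distribʳ x y z)) }
      ; *-comm = λ x y → return (*-comm x y) } }
  ; _≤_ = λ x y → ¬ ¬ (x ≤ y)
  ; ≤-refl = λ x → return (≤-refl x)
  ; ≤-trans = ¬¬-map₂ ≤-trans
  ; ≤-antisym = ¬¬-map₂ ≤-antisym
  ; ≤-total = λ x y → Sum.map return return (≤-total x y)
  ; ≤-resp-≈ = λ p q r k → p (λ p′ → q (λ q′ → r (λ r′ → k (≤-resp-≈ p′ q′ r′))))
  ; +-mono-≤ = λ z → ¬¬-map (+-mono-≤ z)
  ; *-nonneg = ¬¬-map₂ *-nonneg
  ; 0≉1 = λ p → p 0≉1
  ; inverse = λ x n → Product.map₂ return (inverse x (λ p → n (return p)))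
  }
  where open OrderedField F

stabilise-stable : ∀ F x y → ¬ ¬ (OrderedField._≤_ (stabilise F) x y) → OrderedField._≤_ (stabilise F) x y
stabilise-stable F x y h k = h (λ p → p k)

-- The geometry of the T-cut polyhedron

Unique-resp-↭ : {A : Set} {xs ys : List A} → xs ↭ ys → Unique xs → Unique ys
Unique-resp-↭ {A} p = SetoidPerm.Unique-resp-↭ (≡.setoid A) (Perm.↭⇒↭ₛ p)

module Geometry (F : OrderedField) (n : ℕ) where

  open Ordered F
  open OF F

  sumF-∑ : ∀ k (φ : Fin k → Carrier) → sumF k φ ≈ ∑ (allFin k) φ
  sumF-∑ zero    φ = refl
  sumF-∑ (suc k) φ = trans (+-congˡ (sumF-∑ k (φ ∘ suc))) (sym (∑-allFin-suc k φ))

  δ : Fin n → Fin n → Carrier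
  δ p i = ι (bit (does (p FinP.≟ i)))

  δ-same : ∀ p → δ p p ≈ 1#
  δ-same p = reflexive (cong (ι ∘ bit) (dec-true (p FinP.≟ p) ≡.refl))

  δ-distinct : ∀ {p i} → p ≢ i → δ p i ≈ 0#
  δ-distinct {p} {i} p≢i = reflexive (cong (ι ∘ bit) (dec-false (p FinP.≟ i) p≢i))

  ∑-δ : ∀ p (φ : Fin n → Carrier) → ∑ (allFin n) (λ i → δ p i * φ i) ≈ φ p
  ∑-δ p φ = trans (∑-↭ split _) (trans (+-cong (trans (*-congʳ (δ-same p)) (*-identityˡ _)) (others others-distinct)) (+-identityʳ _))
    where
    split-at = ∈P.∈-∃++ (∈P.∈-allFin p)
    xs = proj₁ split-at
    ys = proj₁ (proj₂ split-at)
    split : allFin n ↭ p ∷ xs ++ ys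
    split = Perm.trans (Perm.↭-reflexive (proj₂ (proj₂ split-at))) (PermP.shift p xs ys)
    others-distinct : All (p ≢_) (xs ++ ys)
    others-distinct with Unique-resp-↭ split (UniqueP.allFin⁺ n)
    ... | d ∷ _ = d
    others : ∀ {zs} → All (p ≢_) zs → ∑ zs (λ i → δ p i * φ i) ≈ 0#
    others []       = refl
    others (d ∷ ds) = trans (+-cong (trans (*-congʳ (δ-distinct d)) (zeroˡ _)) (others ds)) (+-identityʳ 0#)

  edgeTerm-total : (A : Fin n → Fin n → Carrier) (x : VecE n) → ∀ i j →
                   edgeTerm (λ e → A (proj₁ e) (proj₁ (proj₂ e)) * x e) i j ≈ A i j * edgeTerm x i j
  edgeTerm-total A x i j with i FinP.<? j
  ... | yes p = refl
  ... | no  _ = sym (zeroʳ _)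

  -- Edges are stored with their ends in increasing order. At most one summand is nonzero, so this
  -- is x as a symmetric function of the two ends, with value 0 on the diagonal.
  ext : VecE n → Fin n → Fin n → Carrier
  ext x p q = edgeTerm x p q + edgeTerm x q p

  value : List (Fin n × Fin n) → VecE n → Carrier
  value E x = ∑ E (λ e → ext x (proj₁ e) (proj₂ e))

  multiplicity : List (Fin n × Fin n) → Fin n → Fin n → Carrier
  multiplicity E i j = ∑ E (λ e → δ (proj₁ e) i * δ (proj₂ e) j + δ (proj₂ e) i * δ (proj₁ e) j)

  -- The sign adapts the lower bound on `value` to the radial cone, which is defined by upper
  -- bounds.
  opposite : List (Fin n × Fin n) → VecE n
  opposite E e = - multiplicity E (proj₁ e) (proj₁ (proj₂ e))

  dot-opposite : ∀ E x → dotE (opposite E) x ≈ - value E x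
  dot-opposite E x = begin-equality
    dotE (opposite E) x
      ≈⟨ trans (sumF-∑ n _) (∑-cong (allFin n) (λ i → trans (sumF-∑ n _) (∑-cong (allFin n) (λ j →
           trans (edgeTerm-total (λ i j → - multiplicity E i j) x i j) (trans (sym (-‿distribˡ-* _ _)) (sym (neg-one _))))))) ⟩
    ∑ (allFin n) (λ i → ∑ (allFin n) (λ j → - 1# * (multiplicity E i j * t i j)))
      ≈⟨ trans (∑-cong (allFin n) (λ i → ∑-*ˡ (allFin n) (- 1#) _)) (∑-*ˡ (allFin n) (- 1#) _) ⟩
    - 1# * ∑ (allFin n) (λ i → ∑ (allFin n) (λ j → multiplicity E i j * t i j))
      ≈⟨ neg-one _ ⟩
    - ∑ (allFin n) (λ i → ∑ (allFin n) (λ j → multiplicity E i j * t i j))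
      ≈⟨ -‿cong (∑-cong (allFin n) (λ i → trans (∑-cong (allFin n) (λ j → sym (∑-*ʳ E (t i j) _))) (∑-swap (allFin n) E _))) ⟩
    - ∑ (allFin n) (λ i → ∑ E (λ e → ∑ (allFin n) (λ j → (δ (proj₁ e) i * δ (proj₂ e) j + δ (proj₂ e) i * δ (proj₁ e) j) * t i j)))
      ≈⟨ -‿cong (trans (∑-swap (allFin n) E _) (∑-cong E (λ e → per-edge (proj₁ e) (proj₂ e)))) ⟩
    - value E x ∎
    where
    t : Fin n → Fin n → Carrier
    t = edgeTerm x
    neg-one : ∀ y → - 1# * y ≈ - y
    neg-one y = trans (sym (-‿distribˡ-* _ _)) (-‿cong (*-identityˡ y))
    single : ∀ p q → ∑ (allFin n) (λ i → ∑ (allFin n) (λ j → δ p i * (δ q j * t i j))) ≈ t p q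
    single p q = trans (∑-cong (allFin n) (λ i → trans (∑-*ˡ (allFin n) _ _) (*-congˡ (∑-δ q (t i))))) (∑-δ p (λ i → t i q))
    per-edge : ∀ p q → ∑ (allFin n) (λ i → ∑ (allFin n) (λ j → (δ p i * δ q j + δ q i * δ p j) * t i j)) ≈ ext x p q
    per-edge p q = begin-equality
      ∑ (allFin n) (λ i → ∑ (allFin n) (λ j → (δ p i * δ q j + δ q i * δ p j) * t i j))
        ≈⟨ ∑-cong (allFin n) (λ i → trans (∑-cong (allFin n) (λ j → trans (distribʳ _ _ _) (+-cong (*-assoc _ _ _) (*-assoc _ _ _)))) (∑-distrib-+ (allFin n) _ _)) ⟩
      ∑ (allFin n) (λ i → ∑ (allFin n) (λ j → δ p i * (δ q j * t i j)) + ∑ (allFin n) (λ j → δ q i * (δ p j * t i j)))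
        ≈⟨ trans (∑-distrib-+ (allFin n) _ _) (+-cong (single p q) (single q p)) ⟩
      ext x p q ∎

  ext-mono : ∀ {x y} → (∀ e → x e ≤ y e) → ∀ p q → ext x p q ≤ ext y p q
  ext-mono {x} {y} h p q = +-mono (term p q) (term q p)
    where
    term : ∀ i j → edgeTerm x i j ≤ edgeTerm y i j
    term i j with i FinP.<? j
    ... | yes _ = h _
    ... | no  _ = ≤-refl 0#

  value-mono : ∀ E {x y} → (∀ e → x e ≤ y e) → value E x ≤ value E y
  value-mono E h = ∑-mono E (λ e → ext-mono h (proj₁ e) (proj₂ e))

  value-cong : ∀ E {x y} → (∀ e → x e ≈ y e) → value E x ≈ value E y
  value-cong E h = ≤-antisym (value-mono E (λ e → ≤-reflexive (h e))) (value-mono E (λ e → ≤-reflexive (sym (h e))))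

  value-linear : ∀ E (x y z : VecE n) t → (∀ e → z e ≈ x e + t * y e) → value E z ≈ value E x + t * value E y
  value-linear E x y z t h = begin-equality
    value E z
      ≈⟨ ∑-cong E (λ e → trans (+-cong (term (proj₁ e) (proj₂ e)) (term (proj₂ e) (proj₁ e)))
           (solve 5 (λ a t b c d → (a :+ t :* b) :+ (c :+ t :* d) := (a :+ c) :+ t :* (b :+ d)) refl _ t _ _ _)) ⟩
    ∑ E (λ e → ext x (proj₁ e) (proj₂ e) + t * ext y (proj₁ e) (proj₂ e))
      ≈⟨ trans (∑-distrib-+ E _ _) (+-congˡ (∑-*ˡ E t _)) ⟩
    value E x + t * value E y ∎
    where
    term : ∀ i j → edgeTerm z i j ≈ edgeTerm x i j + t * edgeTerm y i j
    term i j with i FinP.<? j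
    ... | yes _ = h _
    ... | no  _ = sym (trans (+-identityˡ _) (zeroʳ t))

  side≠-xor : ∀ a b → side≠ a b ≈ ι (bit (a xor b))
  side≠-xor true  true  = refl
  side≠-xor true  false = refl
  side≠-xor false true  = refl
  side≠-xor false false = refl

  ext-χδ : ∀ (S : Subset n) p q → ext (χδ S) p q ≈ ι (bit (lookup S p xor lookup S q))
  ext-χδ S p q with p FinP.<? q | q FinP.<? p
  ... | yes p<q | yes q<p = ⊥-elim (FinP.<-asym p<q q<p)
  ... | yes _   | no _    = trans (+-identityʳ _) (side≠-xor (lookup S p) (lookup S q))
  ... | no _    | yes _   = trans (+-identityˡ _) (trans (side≠-xor (lookup S q) (lookup S p))
    (reflexive (cong (ι ∘ bit) (BoolP.xor-comm (lookup S q) (lookup S p)))))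
  ... | no p≮q  | no q≮p  rewrite FinP.≤-antisym (ℕP.≮⇒≥ q≮p) (ℕP.≮⇒≥ p≮q) | BoolP.xor-same (lookup S q) = +-identityʳ 0#

  value-χδ : ∀ E (S : Subset n) → value E (χδ S) ≈ ∑ E (λ e → ι (bit (lookup S (proj₁ e) xor lookup S (proj₂ e))))
  value-χδ E S = ∑-cong E (λ e → ext-χδ S (proj₁ e) (proj₂ e))

  value-0 : ∀ E {x : VecE n} → (∀ e → x e ≈ 0#) → value E x ≈ 0#
  value-0 E {x} h = ∑-zero E (λ e → trans (+-cong (term (proj₁ e) (proj₂ e)) (term (proj₂ e) (proj₁ e))) (+-identityʳ 0#))
    where
    term : ∀ i j → edgeTerm x i j ≈ 0#
    term i j with i FinP.<? j
    ... | yes _ = h _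
    ... | no  _ = refl

  value-combo : ∀ E T (L : List (Subset n × Carrier)) →
                (∀ S → IsTCutShore T S → 1# ≤ value E (χδ S)) →
                All (λ Sw → IsTCutShore T (proj₁ Sw)) L → All (λ Sw → 0# ≤ proj₂ Sw) L →
                weightSum L ≤ value E (combo L)
  value-combo E T []            h []       []        = ≤-reflexive (sym (value-0 E (λ _ → refl)))
  value-combo E T ((S , w) ∷ L) h (s ∷ ss) (p ∷ ps) = begin
    w + weightSum L
      ≲⟨ +-mono (≤-trans (≤-reflexive (sym (*-identityʳ w))) (*-monoˡ p (h S s))) (value-combo E T L h ss ps) ⟩
    w * value E (χδ S) + value E (combo L)
      ≈⟨ +-comm _ _ ⟩
    value E (combo L) + w * value E (χδ S)
      ≈⟨ sym (value-linear E (combo L) (χδ S) _ w (λ e → +-comm _ _)) ⟩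
    value E (combo ((S , w) ∷ L)) ∎

  value-valid : ∀ E T → (∀ S → IsTCutShore T S → 1# ≤ value E (χδ S)) → ∀ y → InP n T y → 1# ≤ value E y
  value-valid E T h y (L , ss , ps , sum , dom) = begin
    1#                  ≈⟨ sym sum ⟩
    weightSum L         ≲⟨ value-combo E T L h ss ps ⟩
    value E (combo L)   ≲⟨ value-mono E dom ⟩
    value E y           ∎

  -- An inequality valid for the polyhedron is one of those defining the cone precisely when it is
  -- tight at v.
  radial-valid : ∀ E T v → (∀ S → IsTCutShore T S → 1# ≤ value E (χδ S)) → value E v ≈ 1# →
                 ∀ x → InRadialCone n T v x → 1# ≤ value E x
  radial-valid E T v h tight x inK = unflip (≤-resp-≈ (dot-opposite E x) refl
    (inK (opposite E) (- 1#) (λ y y∈P → ≤-resp-≈ (sym (dot-opposite E y)) refl (flip (value-valid E T h y y∈P)))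
      (trans (dot-opposite E v) (-‿cong tight))))
    where
    flip : ∀ {y z} → y ≤ z → - z ≤ - y
    flip {y} {z} p = ≤-resp-≈
      (trans (+-comm _ _) (trans (+-assoc _ _ _) (trans (+-congˡ (-‿inverseˡ y)) (+-identityʳ _))))
      (trans (sym (+-assoc _ _ _)) (trans (+-congʳ (-‿inverseʳ z)) (+-identityˡ _)))
      (+-mono-≤ (- z + - y) p)
    unflip : ∀ {y z} → - y ≤ - z → z ≤ y
    unflip p = ≤-resp-≈ (-‿involutive _) (-‿involutive _) (flip p)

  shore-in-P : ∀ T S → IsTCutShore T S → InP n T (χδ S)
  shore-in-P T S s = ((S , 1#) ∷ []) , (s ∷ []) , (0≤1 ∷ []) , +-identityʳ 1#
    , (λ e → ≤-reflexive (trans (+-identityʳ _) (*-identityˡ _)))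

  P-in-radial : ∀ T v y → InP n T y → InRadialCone n T v y
  P-in-radial T v y y∈P a β valid _ = valid y y∈P

  private
    record Extraction (T : Subset n) (L : List (Subset n × Carrier)) : Set where
      field
        S      : Subset n
        w      : Carrier
        rest   : List (Subset n × Carrier)
        shore  : IsTCutShore T S
        0≤w    : 0# ≤ w
        w≉0    : ¬ (w ≈ 0#)
        shores : All (λ Sw → IsTCutShore T (proj₁ Sw)) rest
        nonneg : All (λ Sw → 0# ≤ proj₂ Sw) rest
        sum    : weightSum L ≈ w + weightSum {n} rest
        comb   : ∀ e → combo L e ≈ w * χδ S e + combo rest e

    -- Not all weights can be 0 if their sum is not; since zero tests are undecidable, a positive
    -- one is found only up to double negation.
    extract : ∀ T L → All (λ Sw → IsTCutShore T (proj₁ Sw)) L → All (λ Sw → 0# ≤ proj₂ Sw) L →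
              ¬ (weightSum L ≈ 0#) → ¬ ¬ Extraction T L
    extract T []            []       []       h _ = h refl
    extract T ((S , w) ∷ L) (s ∷ ss) (p ∷ ps) h k = ¬¬-excluded-middle {A = w ≈ 0#} λ
      { (no w≉0)  → k record { S = S ; w = w ; rest = L ; shore = s ; 0≤w = p ; w≉0 = w≉0
                             ; shores = ss ; nonneg = ps ; sum = refl ; comb = λ _ → refl }
      ; (yes w≈0) → extract T L ss ps (λ q → h (trans (+-cong w≈0 q) (+-identityʳ 0#))) (λ X → k (record
          { S = Extraction.S X ; w = Extraction.w X ; rest = (S , w) ∷ Extraction.rest X
          ; shore = Extraction.shore X ; 0≤w = Extraction.0≤w X ; w≉0 = Extraction.w≉0 X
          ; shores = s ∷ Extraction.shores X ; nonneg = p ∷ Extraction.nonneg X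
          ; sum = trans (+-congˡ (Extraction.sum X)) (swap₃ _ _ _)
          ; comb = λ e → trans (+-congˡ (Extraction.comb X e)) (swap₃ _ _ _) })) }
      where
      swap₃ : ∀ a b c → a + (b + c) ≈ b + (a + c)
      swap₃ = solve 3 (λ a b c → a :+ (b :+ c) := b :+ (a :+ c)) refl

    scaled : Carrier → List (Subset n × Carrier) → List (Subset n × Carrier)
    scaled t = List.map (Product.map₂ (t *_))

    scaled-sum : ∀ t L → weightSum {n} (scaled t L) ≈ t * weightSum L
    scaled-sum t []      = sym (zeroʳ t)
    scaled-sum t (_ ∷ L) = trans (+-congˡ (scaled-sum t L)) (sym (distribˡ t _ _))

    scaled-combo : ∀ t L e → combo (scaled t L) e ≈ t * combo L e
    scaled-combo t []      e = sym (zeroʳ t)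
    scaled-combo t (_ ∷ L) e = trans (+-cong (*-assoc _ _ _) (scaled-combo t L e)) (sym (distribˡ t _ _))

    weightSum-nonneg : {L : List (Subset n × Carrier)} → All (λ Sw → 0# ≤ proj₂ Sw) L → 0# ≤ weightSum {n} L
    weightSum-nonneg []       = ≤-refl 0#
    weightSum-nonneg (p ∷ ps) = +-nonneg p (weightSum-nonneg ps)

  -- If S occurs with weight w > 0 in a convex combination dominated by v, then
  -- v ± w (χδ S − v) both lie in P, so extremality forces v = χδ S.
  vertex-is-cut : ∀ T v → IsVertex n T v → ¬ ¬ (Σ (Subset n) λ S → IsTCutShore T S × (∀ e → v e ≈ χδ S e))
  vertex-is-cut T v ((L , ss , ps , sumL , dom) , extreme) =
    ¬¬-map conclude (extract T L ss ps (λ p → 0≉1 (trans (sym p) sumL)))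
    where
    conclude : Extraction T L → Σ (Subset n) λ S → IsTCutShore T S × (∀ e → v e ≈ χδ S e)
    conclude X = S , shore , (λ e → sym (trans (sym (*-identityˡ _)) (trans (*-congʳ (sym (trans (*-comm _ _) (proj₂ inv))))
                   (trans (*-assoc _ _ _) (trans (*-congˡ (equal e)) (trans (sym (*-assoc _ _ _))
                   (trans (*-congʳ (trans (*-comm _ _) (proj₂ inv))) (*-identityˡ _))))))))
      where
      open Extraction X
      inv = inverse w w≉0
      total : w + weightSum {n} rest ≈ 1#
      total = trans (sym sum) sumL
      ρ : Carrier
      ρ = weightSum {n} rest
      0≤ρ : 0# ≤ ρ
      0≤ρ = weightSum-nonneg {rest} nonneg
      y z : VecE n
      y e = ρ * v e + w * χδ S e
      z e = (1# + w) * v e + - (w * χδ S e)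
      y∈P : InP n T y
      y∈P = ((S , w) ∷ scaled ρ L) , (shore ∷ AllP.map⁺ ss) , (0≤w ∷ AllP.map⁺ (All.map (*-nonneg 0≤ρ) ps))
        , trans (+-congˡ (trans (scaled-sum ρ L) (trans (*-congˡ sumL) (*-identityʳ ρ)))) total
        , (λ e → ≤-trans (+-mono (≤-refl _) (≤-trans (≤-reflexive (scaled-combo ρ L e)) (*-monoˡ 0≤ρ (dom e)))) (≤-reflexive (+-comm _ _)))
      0≤1+w : 0# ≤ 1# + w
      0≤1+w = +-nonneg 0≤1 0≤w
      z∈P : InP n T z
      -- By (1 + w) (w χ + rest) - w χ = w² χ + (1 + w) rest, the weight of S stays nonnegative and
      -- the subtraction disappears.
      z∈P = ((S , w * w) ∷ scaled (1# + w) rest) , (shore ∷ AllP.map⁺ shores)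
        , (*-nonneg 0≤w 0≤w ∷ AllP.map⁺ (All.map (*-nonneg 0≤1+w) nonneg))
        , sum-z , below
        where
        sum-z : w * w + weightSum {n} (scaled (1# + w) rest) ≈ 1#
        sum-z = begin-equality
          w * w + weightSum {n} (scaled (1# + w) rest)     ≈⟨ +-congˡ (scaled-sum (1# + w) rest) ⟩
          w * w + (1# + w) * ρ                         ≈⟨ solve 2 (λ w r → w :* w :+ (con 1 :+ w) :* r := w :* (w :+ r) :+ r) refl w ρ ⟩
          w * (w + ρ) + ρ                              ≈⟨ +-congʳ (trans (*-congˡ total) (*-identityʳ w)) ⟩
          w + ρ                                        ≈⟨ total ⟩
          1#                                           ∎
        below : ∀ e → w * w * χδ S e + combo (scaled (1# + w) rest) e ≤ z e
        below e = +-cancelʳ (w * χδ S e) (begin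
          (w * w * χδ S e + combo (scaled (1# + w) rest) e) + w * χδ S e
            ≈⟨ +-congʳ (+-congˡ (scaled-combo (1# + w) rest e)) ⟩
          (w * w * χδ S e + (1# + w) * combo rest e) + w * χδ S e
            ≈⟨ solve 3 (λ w x c → (w :* w :* x :+ (con 1 :+ w) :* c) :+ w :* x := (con 1 :+ w) :* (w :* x :+ c)) refl w (χδ S e) (combo rest e) ⟩
          (1# + w) * (w * χδ S e + combo rest e)
            ≲⟨ *-monoˡ 0≤1+w (≤-trans (≤-reflexive (sym (comb e))) (dom e)) ⟩
          (1# + w) * v e
            ≈⟨ sym (trans (+-assoc _ _ _) (trans (+-congˡ (-‿inverseˡ _)) (+-identityʳ _))) ⟩
          z e + w * χδ S e ∎)
      midpoint : ∀ e → v e + v e ≈ y e + z e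
      midpoint e = sym (begin-equality
        (ρ * v e + w * χδ S e) + ((1# + w) * v e + - (w * χδ S e))
          ≈⟨ solve 5 (λ r v x w u → (r :* v :+ x) :+ ((con 1 :+ w) :* v :+ u) := (v :+ (w :+ r) :* v) :+ (x :+ u)) refl ρ (v e) (w * χδ S e) w (- (w * χδ S e)) ⟩
        (v e + (w + ρ) * v e) + (w * χδ S e + - (w * χδ S e))
          ≈⟨ trans (+-cong (+-congˡ (trans (*-congʳ total) (*-identityˡ _))) (-‿inverseʳ _)) (+-identityʳ _) ⟩
        v e + v e ∎)
      equal : ∀ e → w * χδ S e ≈ w * v e
      equal e = +-cancelʳ-≈ (ρ * v e) (begin-equality
        w * χδ S e + ρ * v e        ≈⟨ +-comm _ _ ⟩
        y e                         ≈⟨ extreme y z y∈P z∈P midpoint e ⟩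
        v e                         ≈⟨ sym (trans (*-congʳ total) (*-identityˡ _)) ⟩
        (w + ρ) * v e               ≈⟨ distribʳ _ _ _ ⟩
        w * v e + ρ * v e           ∎)

-- T-joins

elements : ∀ {n} → Subset n → List (Fin n)
elements []          = []
elements (true ∷ T)  = zero ∷ List.map suc (elements T)
elements (false ∷ T) = List.map suc (elements T)

length-elements : ∀ {n} (T : Subset n) → length (elements T) ≡ ∣ T ∣
length-elements []          = ≡.refl
length-elements (true ∷ T)  = cong suc (≡.trans (ListP.length-map suc (elements T)) (length-elements T))
length-elements (false ∷ T) = ≡.trans (ListP.length-map suc (elements T)) (length-elements T)

elements-unique : ∀ {n} (T : Subset n) → Unique (elements T)
elements-unique []          = []
elements-unique (true ∷ T)  = AllP.map⁺ (All.universal (λ _ ()) (elements T)) ∷ UniqueP.map⁺ FinP.suc-injective (elements-unique T)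
elements-unique (false ∷ T) = UniqueP.map⁺ FinP.suc-injective (elements-unique T)

isOdd : ℕ → Bool
isOdd zero    = false
isOdd (suc k) = not (isOdd k)

isOdd⇒% : ∀ k → isOdd k ≡ true → k ℕ.% 2 ≡ 1
isOdd⇒% (suc zero)    p = ≡.refl
isOdd⇒% (suc (suc k)) p = isOdd⇒% k (≡.trans (≡.sym (BoolP.not-involutive (isOdd k))) p)

%⇒isOdd : ∀ k → k ℕ.% 2 ≡ 1 → isOdd k ≡ true
%⇒isOdd (suc zero)    p = ≡.refl
%⇒isOdd (suc (suc k)) p = ≡.trans (BoolP.not-involutive (isOdd k)) (%⇒isOdd k p)

%⇒isEven : ∀ k → k ℕ.% 2 ≡ 0 → isOdd k ≡ false
%⇒isEven zero          p = ≡.refl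
%⇒isEven (suc (suc k)) p = ≡.trans (BoolP.not-involutive (isOdd k)) (%⇒isEven k p)

parity : {A : Set} → (A → Bool) → List A → Bool
parity μ []       = false
parity μ (x ∷ xs) = μ x xor parity μ xs

parity-map : {A B : Set} (h : A → B) (μ : B → Bool) (xs : List A) → parity μ (List.map h xs) ≡ parity (μ ∘ h) xs
parity-map h μ []       = ≡.refl
parity-map h μ (x ∷ xs) = cong (μ (h x) xor_) (parity-map h μ xs)

parity-++ : {A : Set} (μ : A → Bool) (xs ys : List A) → parity μ (xs ++ ys) ≡ parity μ xs xor parity μ ys
parity-++ μ []       ys = ≡.refl
parity-++ μ (x ∷ xs) ys = ≡.trans (cong (μ x xor_) (parity-++ μ xs ys)) (≡.sym (BoolP.xor-assoc (μ x) _ _))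

parity-↭ : {A : Set} (μ : A → Bool) {xs ys : List A} → xs ↭ ys → parity μ xs ≡ parity μ ys
parity-↭ μ Perm.refl        = ≡.refl
parity-↭ μ (prep x p)       = cong (μ x xor_) (parity-↭ μ p)
parity-↭ μ (swap x y p) = ≡.trans (≡.sym (BoolP.xor-assoc (μ x) (μ y) _))
  (≡.trans (cong₂ _xor_ (BoolP.xor-comm (μ x) (μ y)) (parity-↭ μ p)) (BoolP.xor-assoc (μ y) (μ x) _))
parity-↭ μ (Perm.trans p q) = ≡.trans (parity-↭ μ p) (parity-↭ μ q)

parity-const : {A : Set} (μ : A → Bool) (b : Bool) {xs : List A} → All (λ x → μ x ≡ b) xs → parity μ xs ≡ b Bool.∧ isOdd (length xs)
parity-const μ true  []       = ≡.refl
parity-const μ false []       = ≡.refl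
parity-const μ true  (p ∷ ps) = cong₂ _xor_ p (parity-const μ true ps)
parity-const μ false (p ∷ ps) = cong₂ _xor_ p (parity-const μ false ps)

-- Parities over lists are invariant under permutation and additive under splitting, so the
-- terminals can be regrouped by arrangement.
parity-∩ : ∀ {n} (S T : Subset n) → isOdd ∣ S ∩ T ∣ ≡ parity (lookup S) (elements T)
parity-∩ []      []      = ≡.refl
parity-∩ (a ∷ S) (b ∷ T) = ≡.trans (head-case a b) (≡.sym (tail-case b))
  where
  rest : Bool
  rest = parity (lookup S) (elements T)
  shift : parity (lookup (a ∷ S)) (List.map suc (elements T)) ≡ rest
  shift = parity-map suc (lookup (a ∷ S)) (elements T)
  head-case : ∀ a b → isOdd ∣ (a ∷ S) ∩ (b ∷ T) ∣ ≡ (a Bool.∧ b) xor rest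
  head-case true  true  = cong not (parity-∩ S T)
  head-case true  false = parity-∩ S T
  head-case false b     = parity-∩ S T
  tail-case : ∀ b → parity (lookup (a ∷ S)) (elements (b ∷ T)) ≡ (a Bool.∧ b) xor rest
  tail-case true  rewrite BoolP.∧-identityʳ a = cong (a xor_) shift
  tail-case false rewrite BoolP.∧-zeroʳ a = shift

∈-∷-↭ : {A : Set} {x : A} {xs : List A} → x ∈ xs → ∃ λ ys → xs ↭ x ∷ ys
∈-∷-↭ {x = x} x∈xs with ∈P.∈-∃++ x∈xs
... | us , vs , ≡.refl = us ++ vs , PermP.shift x us vs

-- Pigeonhole: a list that covers as many distinct elements as it has places has no room for
-- repetitions.
covering-↭ : {A : Set} {xs : List A} → Unique xs → ∀ ys → All (_∈ ys) xs → length ys ≡ length xs → xs ↭ ys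
covering-↭ []         []  []       _   = Perm.refl
covering-↭ {xs = x ∷ xs} (x∉ ∷ u) ys (x∈ ∷ ms) len with ∈-∷-↭ x∈
... | zs , p = Perm.trans (prep x (covering-↭ u zs (remove x∉ ms) (ℕP.suc-injective (≡.trans (≡.sym (PermP.↭-length p)) len)))) (Perm.↭-sym p)
  where
  remove : ∀ {ws} → All (x ≢_) ws → All (_∈ ys) ws → All (_∈ zs) ws
  remove []       []       = []
  remove (d ∷ ds) (m ∷ ms) with PermP.∈-resp-↭ p m
  ... | here w≡x  = ⊥-elim (d (≡.sym w≡x))
  ... | there w∈zs = w∈zs ∷ remove ds ms

unique-++ˡ : {A : Set} (xs : List A) {ys : List A} → Unique (xs ++ ys) → Unique xs
unique-++ˡ []       u       = []
unique-++ˡ (x ∷ xs) (d ∷ u) = AllP.++⁻ˡ xs d ∷ unique-++ˡ xs u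

pairUp : {A : Set} → List A → List (A × A)
pairUp (a ∷ b ∷ xs) = (a , b) ∷ pairUp xs
pairUp _            = []

cut : {A : Set} → (A → Bool) → A × A → ℕ
cut μ (p , q) = bit (μ p xor μ q)

crossing : {A : Set} → (A → Bool) → List (A × A) → ℕ
crossing μ []      = 0
crossing μ (e ∷ E) = cut μ e ℕ.+ crossing μ E

crossing-++ : {A : Set} (μ : A → Bool) (E E′ : List (A × A)) → crossing μ (E ++ E′) ≡ crossing μ E ℕ.+ crossing μ E′
crossing-++ μ []      E′ = ≡.refl
crossing-++ μ (e ∷ E) E′ = ≡.trans (cong (cut μ e ℕ.+_) (crossing-++ μ E E′)) (≡.sym (ℕP.+-assoc (cut μ e) _ _))

Uncut : {A : Set} → (A → Bool) → List (A × A) → Set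
Uncut μ = All (λ e → μ (proj₁ e) ≡ μ (proj₂ e))

cut-zero : ∀ {a b} → bit (a xor b) ≡ 0 → a ≡ b
cut-zero {true}  {true}  _ = ≡.refl
cut-zero {false} {false} _ = ≡.refl

zero-cut : ∀ {a b} → a ≡ b → bit (a xor b) ≡ 0
zero-cut {true}  ≡.refl = ≡.refl
zero-cut {false} ≡.refl = ≡.refl

crossing-zero : {A : Set} (μ : A → Bool) (E : List (A × A)) → crossing μ E ≡ 0 → Uncut μ E
crossing-zero μ []            p = []
crossing-zero μ ((a , b) ∷ E) p = cut-zero (ℕP.m+n≡0⇒m≡0 (cut μ (a , b)) p) ∷ crossing-zero μ E (ℕP.m+n≡0⇒n≡0 (cut μ (a , b)) p)

zero-crossing : {A : Set} (μ : A → Bool) {E : List (A × A)} → Uncut μ E → crossing μ E ≡ 0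
zero-crossing μ []       = ≡.refl
zero-crossing μ (p ∷ ps) = cong₂ ℕ._+_ (zero-cut p) (zero-crossing μ ps)

pairUp-const : {A : Set} {μ : A → Bool} {b : Bool} (xs : List A) → All (λ x → μ x ≡ b) xs → Uncut μ (pairUp xs)
pairUp-const []           ps           = []
pairUp-const (_ ∷ [])     ps           = []
pairUp-const (_ ∷ _ ∷ xs) (p ∷ q ∷ ps) = ≡.trans p (≡.sym q) ∷ pairUp-const xs ps

pairUp-parity : {A : Set} {μ : A → Bool} (xs : List A) → isOdd (length xs) ≡ false → Uncut μ (pairUp xs) → parity μ xs ≡ false
pairUp-parity []           even []       = ≡.refl
pairUp-parity {μ = μ} (a ∷ b ∷ xs) even (p ∷ ps)
  rewrite pairUp-parity {μ = μ} xs (≡.trans (≡.sym (BoolP.not-involutive _)) even) ps | p | BoolP.xor-identityʳ (μ b) = BoolP.xor-same (μ b)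

module TJoin (n m : ℕ) (T : Subset n) (ts os : List (Fin n)) (hub u w : Fin n)
             (elements-↭ : elements T ↭ (hub ∷ u ∷ ts) ++ (w ∷ os))
             (length-ts : length ts ≡ 3 ℕ.+ 2 ℕ.* m)
             (even-os : isOdd (length os) ≡ false) where

  open Nodes n

  Covers : Triple → Blocks m → Set
  Covers h B = All (_∈ h ◂ blockNodes B) ts

  -- It will run through the fixed list `ts` instead of an arrangement, so that the edges of a join
  -- depend only on its encoding.
  star : Subset n → List Node → List (Node × Node)
  star S []       = []
  star S (c ∷ cs) = if lookup S c then (c , hub) ∷ star S cs else star S cs

  matched : ∀ {k} → Matching k → List (Node × Node)
  matched []            = []
  matched (nothing ∷ p) = matched p
  matched (just e ∷ p)  = e ∷ matched p

  -- For a valid arrangement the hub has degree 3 plus twice the number of chosen blocks, which is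
  -- odd, and every other terminal has degree 1.
  joinEdges : ∀ {k} → Subset n × Matching k → List (Node × Node)
  joinEdges (S , p) = star S ts ++ matched p ++ (u , w) ∷ pairUp os

  terminals-unique : Unique ((hub ∷ u ∷ ts) ++ (w ∷ os))
  terminals-unique = Unique-resp-↭ elements-↭ (elements-unique T)

  ts-unique : Unique ts
  ts-unique with terminals-unique
  ... | _ ∷ _ ∷ q = unique-++ˡ ts q

  blockNodes-length : ∀ {k} (B : Blocks k) → length (blockNodes B) ≡ 2 ℕ.* k
  blockNodes-length {zero}  []            = ≡.refl
  blockNodes-length {suc k} ((a , b) ∷ B) =
    ≡.trans (cong (λ t → suc (suc t)) (blockNodes-length B)) (cong suc (≡.sym (ℕP.+-suc k (k ℕ.+ 0))))

  covers-↭ : ∀ h B → Covers h B → ts ↭ h ◂ blockNodes B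
  covers-↭ h B cov = covering-↭ ts-unique (h ◂ blockNodes B) cov
    (≡.trans (cong (λ t → 3 ℕ.+ t) (blockNodes-length B)) (≡.sym length-ts))

  Agree : ∀ {k} → (Node → Bool) → Vec Bool k → Blocks k → Set
  Agree μ []      []            = ⊤
  Agree μ (b ∷ x) ((p , q) ∷ B) = μ p ≡ b × μ q ≡ b × Agree μ x B

  agree-insertAt : ∀ {k} {μ} (x : Vec Bool k) (B : Blocks k) i {b p q} → μ p ≡ b → μ q ≡ b → Agree μ x B →
                   Agree μ (insertAt x i b) (insertAt B i (p , q))
  agree-insertAt x       B       zero    hp hq ag = hp , hq , ag
  agree-insertAt (_ ∷ x) (_ ∷ B) (suc i) hp hq (gp , gq , ag) = gp , gq , agree-insertAt x B i hp hq ag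

  agree-removeAt : ∀ {k} {μ} (x : Vec Bool k) (B : Blocks k) i {b p q} → Agree μ (insertAt x i b) (insertAt B i (p , q)) →
                   μ p ≡ b × μ q ≡ b × Agree μ x B
  agree-removeAt x       B       zero    ag = ag
  agree-removeAt (_ ∷ x) (_ ∷ B) (suc i) (gp , gq , ag) with agree-removeAt x B i ag
  ... | hp , hq , ag′ = hp , hq , gp , gq , ag′

  member : ∀ {c} {xs : List Node} → c ∈ xs → lookup (setOf xs) c ≡ true
  member {c} {xs} c∈ = ≡.trans (VecP.lookup∘tabulate _ c) (dec-true (_∈?_ FinP._≟_ c xs) c∈)

  nonmember : ∀ {c} {xs : List Node} → c ∉ xs → lookup (setOf xs) c ≡ false
  nonmember {c} {xs} c∉ = ≡.trans (VecP.lookup∘tabulate _ c) (dec-false (_∈?_ FinP._≟_ c xs) c∉)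

  chosen⊆ : ∀ {k} (x : Vec Bool k) (B : Blocks k) {c} → c ∈ chosen x B → c ∈ blockNodes B
  chosen⊆ []          []      ()
  chosen⊆ (true ∷ x)  (_ ∷ B) (here p)          = here p
  chosen⊆ (true ∷ x)  (_ ∷ B) (there (here p))  = there (here p)
  chosen⊆ (true ∷ x)  (_ ∷ B) (there (there p)) = there (there (chosen⊆ x B p))
  chosen⊆ (false ∷ x) (_ ∷ B) p                 = there (there (chosen⊆ x B p))

  agree-setOf : ∀ {k} (l : List Node) (x : Vec Bool k) (B : Blocks k) → (∀ {c} → c ∈ chosen x B → c ∈ l) →
                (∀ {c} → c ∈ blockNodes B → c ∈ l → c ∈ chosen x B) → Unique (blockNodes B) →
                Agree (lookup (setOf l)) x B
  agree-setOf l []          []            sub sup uniq = tt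
  agree-setOf l (true ∷ x)  ((p , q) ∷ B) sub sup ((_ ∷ p∉) ∷ q∉ ∷ uniq) =
    member (sub (here ≡.refl)) , member (sub (there (here ≡.refl))) , agree-setOf l x B (sub ∘ there ∘ there) sup′ uniq
    where
    sup′ : ∀ {c} → c ∈ blockNodes B → c ∈ l → c ∈ chosen x B
    sup′ c∈ c∈l with sup (there (there c∈)) c∈l
    ... | here ≡.refl         = ⊥-elim (All.lookup p∉ c∈ ≡.refl)
    ... | there (here ≡.refl) = ⊥-elim (All.lookup q∉ c∈ ≡.refl)
    ... | there (there r)     = r
  agree-setOf l (false ∷ x) ((p , q) ∷ B) sub sup ((_ ∷ p∉) ∷ q∉ ∷ uniq) =
    nonmember (λ r → All.lookup p∉ (chosen⊆ x B (sup (here ≡.refl) r)) ≡.refl) ,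
    nonmember (λ r → All.lookup q∉ (chosen⊆ x B (sup (there (here ≡.refl)) r)) ≡.refl) ,
    agree-setOf l x B sub (λ c∈ c∈l → sup (there (there c∈)) c∈l) uniq

  module _ (h : Triple) (B : Blocks m) (cov : Covers h B) where

    private
      h₁ = proj₁ h
      h₂ = proj₁ (proj₂ h)
      h₃ = proj₂ (proj₂ h)

      flat-unique : Unique (h ◂ blockNodes B)
      flat-unique = Unique-resp-↭ (covers-↭ h B cov) ts-unique

    flat⊆ts : ∀ {c} → c ∈ h ◂ blockNodes B → c ∈ ts
    flat⊆ts = PermP.∈-resp-↭ (Perm.↭-sym (covers-↭ h B cov))

    agree-shore : ∀ x → Agree (lookup (shore h B x)) x B
    agree-shore x with flat-unique
    ... | (_ ∷ _ ∷ d₁) ∷ (_ ∷ d₂) ∷ d₃ ∷ uniq =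
      agree-setOf (h ◂ chosen x B) x B (λ c∈ → there (there (there c∈))) sup uniq
      where
      sup : ∀ {c} → c ∈ blockNodes B → c ∈ h ◂ chosen x B → c ∈ chosen x B
      sup c∈ (here ≡.refl)                  = ⊥-elim (All.lookup d₁ c∈ ≡.refl)
      sup c∈ (there (here ≡.refl))          = ⊥-elim (All.lookup d₂ c∈ ≡.refl)
      sup c∈ (there (there (here ≡.refl)))  = ⊥-elim (All.lookup d₃ c∈ ≡.refl)
      sup c∈ (there (there (there r)))      = r

    shore⊆ts : ∀ x {c} → c ∈ h ◂ chosen x B → c ∈ ts
    shore⊆ts x (here p)                  = flat⊆ts (here p)
    shore⊆ts x (there (here p))          = flat⊆ts (there (here p))
    shore⊆ts x (there (there (here p)))  = flat⊆ts (there (there (here p)))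
    shore⊆ts x (there (there (there r))) = flat⊆ts (there (there (there (chosen⊆ x B r))))

    outside-ts : ∀ x {c} → c ∉ ts → lookup (shore h B x) c ≡ false
    outside-ts x c∉ = nonmember (λ c∈ → c∉ (shore⊆ts x c∈))

    head-member : ∀ x → lookup (shore h B x) h₁ ≡ true × lookup (shore h B x) h₂ ≡ true × lookup (shore h B x) h₃ ≡ true
    head-member x = member {xs = l} (here ≡.refl) , member {xs = l} (there (here ≡.refl)) , member {xs = l} (there (there (here ≡.refl)))
      where
      l = h ◂ chosen x B

    starCount : (Node → Bool) → (Node → Bool) → List Node → ℕ
    starCount μ ν []       = 0
    starCount μ ν (c ∷ cs) = bit (μ c Bool.∧ ν c) ℕ.+ starCount μ ν cs

    starCount-↭ : ∀ μ ν {xs ys} → xs ↭ ys → starCount μ ν xs ≡ starCount μ ν ys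
    starCount-↭ μ ν Perm.refl        = ≡.refl
    starCount-↭ μ ν (prep x p)       = cong (bit (μ x Bool.∧ ν x) ℕ.+_) (starCount-↭ μ ν p)
    starCount-↭ μ ν (swap x y p)     = ≡.trans (≡.sym (ℕP.+-assoc (bit (μ x Bool.∧ ν x)) _ _))
      (≡.trans (cong₂ ℕ._+_ (ℕP.+-comm (bit (μ x Bool.∧ ν x)) _) (starCount-↭ μ ν p)) (ℕP.+-assoc (bit (μ y Bool.∧ ν y)) _ _))
    starCount-↭ μ ν (Perm.trans p q) = ≡.trans (starCount-↭ μ ν p) (starCount-↭ μ ν q)

    crossing-star : ∀ S μ cs → μ hub ≡ false → crossing μ (star S cs) ≡ starCount μ (lookup S) cs
    crossing-star S μ []       p = ≡.refl
    crossing-star S μ (c ∷ cs) p with lookup S c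
    ... | true  rewrite p | BoolP.xor-identityʳ (μ c) | BoolP.∧-identityʳ (μ c) = cong (bit (μ c) ℕ.+_) (crossing-star S μ cs p)
    ... | false rewrite BoolP.∧-zeroʳ (μ c) = crossing-star S μ cs p

    -- A block joined to the hub contributes two cut edges if it lies in the shore and none
    -- otherwise; a block used as an edge is never cut, since both ends lie on the same side.
    block-crossing : ∀ {k} (μ ν : Node → Bool) (ξ y : Vec Bool k) (B : Blocks k) → Agree μ ξ B → Agree ν y B →
                     starCount μ ν (blockNodes B) ℕ.+ crossing μ (matched (unchosen y B)) ≡ 2 ℕ.* ones ξ y
    block-crossing μ ν []      []          []            _            _            = ≡.refl
    block-crossing μ ν (b ∷ ξ) (true ∷ y)  ((p , q) ∷ B) (mp , mq , ag) (np , nq , ag′)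
      rewrite mp | mq | np | nq | BoolP.∧-identityʳ b
      = ≡.trans (regroup (bit b) (starCount μ ν (blockNodes B)) _)
                (≡.trans (cong (2 ℕ.* bit b ℕ.+_) (block-crossing μ ν ξ y B ag ag′)) (≡.sym (ℕP.*-distribˡ-+ 2 (bit b) (ones ξ y))))
      where
      open import Data.Nat.Solver
      open +-*-Solver
      regroup : ∀ a s t → a ℕ.+ (a ℕ.+ s) ℕ.+ t ≡ 2 ℕ.* a ℕ.+ (s ℕ.+ t)
      regroup = solve 3 (λ a s t → a :+ (a :+ s) :+ t := con 2 :* a :+ (s :+ t)) ≡.refl
    block-crossing μ ν (b ∷ ξ) (false ∷ y) ((p , q) ∷ B) (mp , mq , ag) (np , nq , ag′)
      rewrite mp | mq | np | nq | BoolP.∧-zeroʳ b | BoolP.xor-same b = block-crossing μ ν ξ y B ag ag′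

    -- `ξ` describes how the cut meets the blocks of this arrangement, and the cut may come from
    -- another one. The bits of the triple are left open for the same reason: this covers both the
    -- slack within one arrangement and the rotated pairs.
    join-crossing : ∀ (μ : Node → Bool) ξ y → μ hub ≡ false → μ u ≡ false → μ w ≡ false → All (λ o → μ o ≡ false) os →
                    Agree μ ξ B →
                    crossing μ (joinEdges (join h B y)) ≡ bit (μ h₁) ℕ.+ (bit (μ h₂) ℕ.+ (bit (μ h₃) ℕ.+ 2 ℕ.* ones ξ y))
    join-crossing μ ξ y μhub μu μw μos ag = begin
      crossing μ (star S ts ++ matched pr ++ (u , w) ∷ pairUp os)
        ≡⟨ ≡.trans (crossing-++ μ (star S ts) _) (cong (crossing μ (star S ts) ℕ.+_) (crossing-++ μ (matched pr) _)) ⟩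
      crossing μ (star S ts) ℕ.+ (crossing μ (matched pr) ℕ.+ crossing μ ((u , w) ∷ pairUp os))
        ≡⟨ cong₂ (λ s t → s ℕ.+ (crossing μ (matched pr) ℕ.+ t))
             (≡.trans (crossing-star S μ ts μhub) (starCount-↭ μ ν (covers-↭ h B cov)))
             (zero-crossing μ (≡.trans μu (≡.sym μw) ∷ pairUp-const os μos)) ⟩
      starCount μ ν (h ◂ blockNodes B) ℕ.+ (crossing μ (matched pr) ℕ.+ 0)
        ≡⟨ cong₂ ℕ._+_ heads (ℕP.+-identityʳ _) ⟩
      (bit (μ h₁) ℕ.+ (bit (μ h₂) ℕ.+ (bit (μ h₃) ℕ.+ starCount μ ν (blockNodes B)))) ℕ.+ crossing μ (matched pr)
        ≡⟨ regroup (bit (μ h₁)) (bit (μ h₂)) (bit (μ h₃)) (starCount μ ν (blockNodes B)) _ ⟩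
      bit (μ h₁) ℕ.+ (bit (μ h₂) ℕ.+ (bit (μ h₃) ℕ.+ (starCount μ ν (blockNodes B) ℕ.+ crossing μ (matched pr))))
        ≡⟨ cong (λ t → bit (μ h₁) ℕ.+ (bit (μ h₂) ℕ.+ (bit (μ h₃) ℕ.+ t))) (block-crossing μ ν ξ y B ag (agree-shore y)) ⟩
      bit (μ h₁) ℕ.+ (bit (μ h₂) ℕ.+ (bit (μ h₃) ℕ.+ 2 ℕ.* ones ξ y)) ∎
      where
      open ≡.≡-Reasoning
      S = shore h B y
      ν = lookup S
      pr = unchosen y B
      heads : starCount μ ν (h ◂ blockNodes B) ≡ bit (μ h₁) ℕ.+ (bit (μ h₂) ℕ.+ (bit (μ h₃) ℕ.+ starCount μ ν (blockNodes B)))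
      heads with head-member y
      ... | p₁ , p₂ , p₃ rewrite p₁ | p₂ | p₃ | BoolP.∧-identityʳ (μ h₁) | BoolP.∧-identityʳ (μ h₂) | BoolP.∧-identityʳ (μ h₃) = ≡.refl
      regroup : ∀ a b c d e → (a ℕ.+ (b ℕ.+ (c ℕ.+ d))) ℕ.+ e ≡ a ℕ.+ (b ℕ.+ (c ℕ.+ (d ℕ.+ e)))
      regroup a b c d e = ≡.trans (ℕP.+-assoc a _ e) (cong (a ℕ.+_) (≡.trans (ℕP.+-assoc b _ e) (cong (b ℕ.+_) (ℕP.+-assoc c d e))))

    block-parity : ∀ {k} {μ : Node → Bool} {x : Vec Bool k} (B : Blocks k) → Agree μ x B → parity μ (blockNodes B) ≡ false
    block-parity {x = []}    []            _              = ≡.refl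
    block-parity {μ = μ} {x = b ∷ x} ((p , q) ∷ B) (mp , mq , ag)
      rewrite mp | mq | block-parity {μ = μ} {x} B ag | BoolP.xor-identityʳ b = BoolP.xor-same b

    flat-parity : ∀ (μ : Node → Bool) → parity μ (blockNodes B) ≡ false → ∀ b → μ h₁ ≡ b → μ h₂ ≡ b → μ h₃ ≡ b → parity μ ts ≡ b
    flat-parity μ p b p₁ p₂ p₃ rewrite parity-↭ μ (covers-↭ h B cov) | p | p₁ | p₂ | p₃
      | BoolP.xor-identityʳ b | BoolP.xor-same b = BoolP.xor-identityʳ b

    terminals-parity : ∀ (μ : Node → Bool) → parity μ (elements T) ≡ μ hub xor (μ u xor (parity μ ts xor (μ w xor parity μ os)))
    terminals-parity μ = ≡.trans (parity-↭ μ elements-↭) (cong (λ t → μ hub xor (μ u xor t)) (parity-++ μ ts (w ∷ os)))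

    -- The blocks contribute evenly and the remaining terminals lie outside, so the parity is that
    -- of the three nodes.
    shore-odd : ∀ x → (∀ {c} → c ∈ hub ∷ u ∷ w ∷ os → c ∉ ts) → IsTCutShore T (shore h B x)
    shore-odd x disjoint = isOdd⇒% ∣ shore h B x ∩ T ∣ (≡.trans (parity-∩ (shore h B x) T) (begin
      parity μ (elements T)                                          ≡⟨ terminals-parity μ ⟩
      μ hub xor (μ u xor (parity μ ts xor (μ w xor parity μ os)))    ≡⟨ cong₂ (λ s t → s xor t) (out (here ≡.refl)) (cong₂ _xor_ (out (there (here ≡.refl)))
                                                                          (cong₂ _xor_ (flat-parity μ (block-parity B (agree-shore x)) true (proj₁ hs) (proj₁ (proj₂ hs)) (proj₂ (proj₂ hs)))
                                                                            (cong₂ _xor_ (out (there (there (here ≡.refl)))) (parity-const μ false (All.tabulate (λ o∈ → out (there (there (there o∈))))))))) ⟩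
      true                                                           ∎))
      where
      open ≡.≡-Reasoning
      μ = lookup (shore h B x)
      hs = head-member x
      out : ∀ {c} → c ∈ hub ∷ u ∷ w ∷ os → μ c ≡ false
      out c∈ = outside-ts x (disjoint c∈)

    -- If no edge of the join is cut by S, then every vertex of T is paired off
    -- inside S or inside its complement.
    join-crosses : ∀ y (S : Subset n) → IsTCutShore T S → 1 ℕ.≤ crossing (lookup S) (joinEdges (join h B y))
    join-crosses y S odd with crossing (lookup S) (joinEdges (join h B y)) in eq
    ... | suc _ = ℕ.s≤s ℕ.z≤n
    ... | zero  = ⊥-elim (true≢false (≡.trans (≡.sym (%⇒isOdd ∣ S ∩ T ∣ odd)) (≡.trans (parity-∩ S T) even)))
      where
      true≢false : true ≢ false
      true≢false ()
      μ = lookup S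
      ν = lookup (shore h B y)
      uncut : Uncut μ (joinEdges (join h B y))
      uncut = crossing-zero μ _ eq
      star-uncut : Uncut μ (star (shore h B y) ts)
      star-uncut = AllP.++⁻ˡ _ uncut
      rest-uncut : Uncut μ (matched (unchosen y B) ++ (u , w) ∷ pairUp os)
      rest-uncut = AllP.++⁻ʳ (star (shore h B y) ts) uncut
      at-star : ∀ cs → Uncut μ (star (shore h B y) cs) → ∀ {c} → c ∈ cs → ν c ≡ true → μ c ≡ μ hub
      at-star (c ∷ cs) un (here ≡.refl) p rewrite p with un
      ... | e ∷ _ = e
      at-star (c ∷ cs) un (there c∈) p with ν c
      ... | false = at-star cs un c∈ p
      ... | true with un
      ...   | _ ∷ un′ = at-star cs un′ c∈ p
      joined : ∀ {c} → c ∈ h ◂ blockNodes B → ν c ≡ true → μ c ≡ μ hub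
      joined c∈ = at-star ts star-uncut (flat⊆ts c∈)
      blocks-even : ∀ {k} (y : Vec Bool k) (B : Blocks k) → Agree ν y B → (∀ {c} → c ∈ blockNodes B → ν c ≡ true → μ c ≡ μ hub) →
                    Uncut μ (matched (unchosen y B)) → parity μ (blockNodes B) ≡ false
      blocks-even []          []            _              _ _  = ≡.refl
      blocks-even (true ∷ y)  ((p , q) ∷ B) (np , nq , ag) j un
        rewrite j (here ≡.refl) np | j (there (here ≡.refl)) nq | blocks-even y B ag (j ∘ there ∘ there) un
          | BoolP.xor-identityʳ (μ hub) = BoolP.xor-same (μ hub)
      blocks-even (false ∷ y) ((p , q) ∷ B) (np , nq , ag) j (e ∷ un)
        rewrite e | blocks-even y B ag (j ∘ there ∘ there) un | BoolP.xor-identityʳ (μ q) = BoolP.xor-same (μ q)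
      hs = head-member y
      ts-parity : parity μ ts ≡ μ hub
      ts-parity = flat-parity μ (blocks-even y B (agree-shore y) (λ c∈ → joined (there (there (there c∈)))) (AllP.++⁻ˡ _ rest-uncut)) (μ hub)
        (joined (here ≡.refl) (proj₁ hs)) (joined (there (here ≡.refl)) (proj₁ (proj₂ hs))) (joined (there (there (here ≡.refl))) (proj₂ (proj₂ hs)))
      last-uncut : Uncut μ ((u , w) ∷ pairUp os)
      last-uncut = AllP.++⁻ʳ (matched (unchosen y B)) rest-uncut
      even : parity μ (elements T) ≡ false
      even with last-uncut
      ... | uw ∷ un rewrite terminals-parity μ | ts-parity | pairUp-parity {μ = μ} os even-os un | uw
        | BoolP.xor-identityʳ (μ w) = collapse (μ hub) (μ w)
        where
        collapse : ∀ a b → a xor (b xor (a xor b)) ≡ false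
        collapse true  true  = ≡.refl
        collapse true  false = ≡.refl
        collapse false true  = ≡.refl
        collapse false false = ≡.refl

    -- Everything that varies with the arrangement and with y lies on one side of the cut, and `os`
    -- is paired on the other. This makes all the joins tight at the vertex.
    join-tight : ∀ y (μ : Node → Bool) (σ : Bool) → All (λ c → μ c ≡ σ) (hub ∷ u ∷ ts) → All (λ c → μ c ≡ not σ) (w ∷ os) →
                 crossing μ (joinEdges (join h B y)) ≡ 1
    join-tight y μ σ (ph ∷ pu ∷ pts) (pw ∷ pos) = begin
      crossing μ (star S ts ++ matched pr ++ (u , w) ∷ pairUp os)
        ≡⟨ ≡.trans (crossing-++ μ (star S ts) _) (cong (crossing μ (star S ts) ℕ.+_) (crossing-++ μ (matched pr) _)) ⟩
      crossing μ (star S ts) ℕ.+ (crossing μ (matched pr) ℕ.+ (cut μ (u , w) ℕ.+ crossing μ (pairUp os)))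
        ≡⟨ cong₂ ℕ._+_ (zero-crossing μ (star-uncut ts pts)) (cong₂ ℕ._+_
             (zero-crossing μ (matched-uncut y B (λ c∈ → All.lookup pts (flat⊆ts (there (there (there c∈)))))))
             (cong₂ ℕ._+_ uw (zero-crossing μ (pairUp-const os pos)))) ⟩
      1 ∎
      where
      open ≡.≡-Reasoning
      S = shore h B y
      pr = unchosen y B
      star-uncut : ∀ cs → All (λ c → μ c ≡ σ) cs → Uncut μ (star S cs)
      star-uncut []       []       = []
      star-uncut (c ∷ cs) (p ∷ ps) with lookup S c
      ... | true  = ≡.trans p (≡.sym ph) ∷ star-uncut cs ps
      ... | false = star-uncut cs ps
      matched-uncut : ∀ {k} (y : Vec Bool k) (B : Blocks k) → (∀ {c} → c ∈ blockNodes B → μ c ≡ σ) → Uncut μ (matched (unchosen y B))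
      matched-uncut []          []            p = []
      matched-uncut (true ∷ y)  (_ ∷ B)       p = matched-uncut y B (p ∘ there ∘ there)
      matched-uncut (false ∷ y) (_ ∷ B)       p = ≡.trans (p (here ≡.refl)) (≡.sym (p (there (here ≡.refl)))) ∷ matched-uncut y B (p ∘ there ∘ there)
      uw : cut μ (u , w) ≡ 1
      uw = ≡.trans (cong₂ (λ a b → bit (a xor b)) pu pw) (opposite-sides σ)
        where
        opposite-sides : ∀ b → bit (b xor not b) ≡ 1
        opposite-sides true  = ≡.refl
        opposite-sides false = ≡.refl

-- From extensions to factorisations

-- Double-negation shift; it is what allows Farkas multipliers to be chosen for
-- all T-joins at once.
Shift : Set → Set₁
Shift A = (P : A → Set) → (∀ a → ¬ ¬ P a) → ¬ ¬ (∀ a → P a)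

shift-Fin : ∀ n → Shift (Fin n)
shift-Fin n P = ¬¬-∀Fin

shift-Bool : Shift Bool
shift-Bool P h k = h true (λ t → h false (λ f → k (λ { true → t ; false → f })))

shift-× : ∀ {A B} → Shift A → Shift B → Shift (A × B)
shift-× sA sB P h = ¬¬-map (λ f ab → f (proj₁ ab) (proj₂ ab)) (sA _ (λ a → sB _ (λ b → h (a , b))))

shift-Maybe : ∀ {A} → Shift A → Shift (Maybe A)
shift-Maybe sA P h k = h nothing (λ n → sA (P ∘ just) (h ∘ just) (λ j → k (λ { nothing → n ; (just a) → j a })))

shift-Vec : ∀ {A} n → Shift A → Shift (Vec A n)
shift-Vec zero    sA P h = ¬¬-map (λ p → λ { [] → p }) (h [])
shift-Vec (suc n) sA P h = ¬¬-map (λ f → λ { (a ∷ v) → f a v }) (sA _ (λ a → shift-Vec n sA _ (λ v → h (a ∷ v))))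

unique-++-disjoint : {A : Set} (xs : List A) {ys : List A} → Unique (xs ++ ys) → ∀ {c} → c ∈ xs → c ∈ ys → ⊥
unique-++-disjoint (x ∷ xs) (d ∷ u) (here ≡.refl) c∈ys = All.lookup d (∈P.∈-++⁺ʳ xs c∈ys) ≡.refl
unique-++-disjoint (x ∷ xs) (d ∷ u) (there c∈xs)  c∈ys = unique-++-disjoint xs u c∈xs c∈ys

module Assembly (F : OrderedField) (n m : ℕ) (T : Subset n) (v : OF.VecE F n) (v∈P : OF.InP F n T v)
                (X : OF.Extension F n) (ext-of : OF.IsExtensionOf F X (OF.InRadialCone F n T v))
                (ts os : List (Fin n)) (hub u w : Fin n)
                (elements-↭ : elements T ↭ (hub ∷ u ∷ ts) ++ (w ∷ os))
                (length-ts : length ts ≡ 3 ℕ.+ 2 ℕ.* suc m)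
                (even-os : isOdd (length os) ≡ false)
                (V : Subset n) (v≈V : ∀ e → OrderedField._≈_ F (v e) (OF.χδ F V e))
                (σ : Bool) (side : All (λ c → lookup V c ≡ σ) (hub ∷ u ∷ ts)) (other : All (λ c → lookup V c ≡ not σ) (w ∷ os))
                (W : Weights) where

  open OF F using (VecE; χδ; InP; InRadialCone; Extension; sumF; extSize)
  module E = OF.Extension X
  module O = Ordered F
  open Geometry F n
  open TJoin n (suc m) T ts os hub u w elements-↭ length-ts even-os
  open Nodes n

  F′ : OrderedField
  F′ = stabilise F

  stable : ∀ x y → ¬ ¬ (OrderedField._≤_ F′ x y) → OrderedField._≤_ F′ x y
  stable = stabilise-stable F

  open Ordered F′
  open Farkas F′ stable using (Linear)

  Point : Set
  Point = Fin E.dim → Carrier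

  R : ℕ
  R = suc E.size

  _⊞[_]_ : Point → Carrier → Point → Point
  (y ⊞[ t ] z) k = y k + t * z k

  sumF-linear : ∀ k (a y z : Fin k → Carrier) t →
                sumF k (λ i → a i * (y i + t * z i)) O.≈ (sumF k (λ i → a i * y i) + t * sumF k (λ i → a i * z i))
  sumF-linear zero    a y z t = O.sym (O.trans (O.+-congˡ (O.zeroʳ t)) (O.+-identityʳ O.0#))
  sumF-linear (suc k) a y z t = O.trans (O.+-congˡ (sumF-linear k (a ∘ suc) (y ∘ suc) (z ∘ suc) t))
    (O.solve 6 (λ a y t z p q → a O.:* (y O.:+ t O.:* z) O.:+ (p O.:+ t O.:* q) O.:= (a O.:* y O.:+ p) O.:+ t O.:* (a O.:* z O.:+ q))
      O.refl (a zero) (y zero) t (z zero) _ _)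

  α : Fin E.size → Point → Carrier
  α r y = sumF E.dim (λ k → E.A r k * y k)

  ε : Fin E.neq → Point → Carrier
  ε r y = sumF E.dim (λ k → E.Ceq r k * y k)

  lin-α : ∀ r → Linear _⊞[_]_ (α r)
  lin-α r y t z = return (sumF-linear E.dim (E.A r) y z t)

  lin-ε : ∀ r → Linear _⊞[_]_ (ε r)
  lin-ε r y t z = return (sumF-linear E.dim (E.Ceq r) y z t)

  open Factorisation F′ stable using (Factors; slack-factors)

  InQ′ : Point → Set
  InQ′ = Factorisation.InQ F′ stable _⊞[_]_ α lin-α E.b ε lin-ε E.deq

  slackOf : Point → Fin R → Carrier
  slackOf = Factorisation.slackOf F′ stable _⊞[_]_ α lin-α E.b ε lin-ε E.deq

  γ : List (Node × Node) → Point → Carrier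
  γ E y = value E (E.π y)

  lin-γ : ∀ E → Linear _⊞[_]_ (γ E)
  lin-γ E y t z = return (value-linear E (E.π y) (E.π z) _ t (λ e → sumF-linear E.dim (E.M e) y z t))

  InQ⇒InQ′ : ∀ {y} → E.InQ y → InQ′ y
  InQ⇒InQ′ (p , q) = (λ r → return (p r)) , (λ r → return (q r))

  InQ′⇒¬¬InQ : ∀ {y} → InQ′ y → ¬ ¬ E.InQ y
  InQ′⇒¬¬InQ (p , q) = ¬¬-map₂ _,_ (¬¬-∀Fin p) (¬¬-∀Fin q)

  lift : ∀ y → InRadialCone n T v y → Σ Point λ z → E.InQ z × (∀ e → E.π z e O.≈ y e)
  lift = proj₁ ext-of

  Good : Subset n × Matching (suc m) → Set
  Good J = (∀ S → IsTCutShore T S → 1# O.≤ value (joinEdges J) (χδ S)) × (value (joinEdges J) v O.≈ 1#)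

  cutPoint : ∀ U → IsTCutShore T U → Point
  cutPoint U odd = proj₁ (lift (χδ U) (P-in-radial T v (χδ U) (shore-in-P T U odd)))

  cutPoint-InQ : ∀ U odd → E.InQ (cutPoint U odd)
  cutPoint-InQ U odd = proj₁ (proj₂ (lift (χδ U) (P-in-radial T v (χδ U) (shore-in-P T U odd))))

  cutPoint-π : ∀ U odd e → E.π (cutPoint U odd) e O.≈ χδ U e
  cutPoint-π U odd = proj₂ (proj₂ (lift (χδ U) (P-in-radial T v (χδ U) (shore-in-P T U odd))))

  ι-agree : ∀ k → ι k ≈ O.ι k
  ι-agree zero    = refl
  ι-agree (suc k) = trans (ι-suc k) (trans (+-congˡ {1#} (ι-agree k)) (return (O.sym (O.ι-suc k))))

  value-crossing : ∀ E S → value E (χδ S) O.≈ O.ι (crossing (lookup S) E)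
  value-crossing E S = O.trans (value-χδ E S) (count E)
    where
    count : ∀ E → O.∑ E (λ e → O.ι (bit (lookup S (proj₁ e) xor lookup S (proj₂ e)))) O.≈ O.ι (crossing (lookup S) E)
    count []      = O.refl
    count (e ∷ E) = O.trans (O.+-congˡ (count E)) (O.sym (O.ι-+ (cut (lookup S) e) (crossing (lookup S) E)))

  good : ∀ h B → Covers h B → ∀ y → Good (join h B y)
  good h B cov y =
    (λ S odd → O.≤-trans (O.ι-mono (join-crosses h B cov y S odd)) (O.≤-reflexive (O.sym (value-crossing (joinEdges (join h B y)) S)))) ,
    O.trans (value-cong (joinEdges (join h B y)) v≈V)
      (O.trans (value-crossing (joinEdges (join h B y)) V) (O.reflexive (cong O.ι (join-tight h B cov y (lookup V) σ side other))))

  -- The condition `Good J` is placed inside so that a certificate exists, up to double negation,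
  -- for every element of the finite type of encodings, with multipliers 0 where J is not good. Only
  -- then can the double-negation shift select all of them together.
  Certificate : Subset n × Matching (suc m) → Set
  Certificate J = Σ (Fin R → Carrier) λ g → (∀ r → 0# ≤ g r) ×
    (Good J → ∀ y → E.InQ y → γ (joinEdges J) y ≈ 1# + ∑ (allFin R) (λ r → slackOf y r * g r))

  certificate : ∀ J → ¬ ¬ Certificate J
  certificate J k = ¬¬-excluded-middle {A = Good J} λ
    { (no bad)  → k ((λ _ → 0#) , (λ _ → ≤-refl 0#) , (λ gd → ⊥-elim (bad gd)))
    ; (yes gd) → slack-factors _⊞[_]_ α lin-α E.b ε lin-ε E.deq (γ (joinEdges J)) (lin-γ (joinEdges J))
        (proj₁ initial) (InQ⇒InQ′ (proj₁ (proj₂ initial)))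
        (λ y q → ¬¬-map (λ q′ → radial-valid (joinEdges J) T v (proj₁ gd) (proj₂ gd) (E.π y) (proj₂ ext-of y q′)) (InQ′⇒¬¬InQ q))
        (λ fs → k (proj₁ fs , proj₁ (proj₂ fs) , λ _ y q → proj₂ (proj₂ fs) y (InQ⇒InQ′ q))) }
    where
    initial = lift v (P-in-radial T v v v∈P)

  -- The value 0 on other sets makes f a total nonnegative function; shores of valid arrangements
  -- are always T-cut shores.
  f-dec : ∀ U → Dec (IsTCutShore T U) → Fin R → Carrier
  f-dec U (yes odd) r = slackOf (cutPoint U odd) r
  f-dec U (no _)    r = 0#

  f : Fin R → Subset n → Carrier
  f r U = f-dec U (∣ U ∩ T ∣ ℕ.% 2 ℕ.≟ 1) r

  0≤f : ∀ r U → 0# ≤ f r U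
  0≤f r U with ∣ U ∩ T ∣ ℕ.% 2 ℕ.≟ 1
  ... | yes odd = Factorisation.slackOf-nonneg F′ stable _⊞[_]_ α lin-α E.b ε lin-ε E.deq _ (InQ⇒InQ′ (cutPoint-InQ U odd)) r
  ... | no _    = ≤-refl 0#

  module _ (cert : ∀ J → Certificate J) where

    g : Fin R → Subset n × Matching (suc m) → Carrier
    g r J = proj₁ (cert J) r

    -- The factorisation describes γ - 1, so it gives one less than the number of crossings.
    slack-from-crossing : ∀ U → IsTCutShore T U → ∀ h B → Covers h B → ∀ y k →
                          crossing (lookup U) (joinEdges (join h B y)) ≡ suc k →
                          ∑ (allFin R) (λ r → f r U * g r (join h B y)) ≈ ι k
    slack-from-crossing U odd h B cov y k eq with ∣ U ∩ T ∣ ℕ.% 2 ℕ.≟ 1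
    ... | no ¬odd  = ⊥-elim (¬odd odd)
    ... | yes odd′ = +-cancelʳ-≈ 1# (trans (+-comm _ 1#) (trans (sym (proj₂ (proj₂ (cert J)) (good h B cov y) yU (cutPoint-InQ U odd′)))
      (trans (return (O.trans (value-cong (joinEdges J) (cutPoint-π U odd′)) (value-crossing (joinEdges J) U)))
        (trans (sym (ι-agree (crossing (lookup U) (joinEdges J)))) (trans (reflexive (cong ι eq)) (trans (ι-suc k) (+-comm 1# _)))))))
      where
      J = join h B y
      yU = cutPoint U odd′

    private
      disjoint : ∀ {c} → c ∈ hub ∷ u ∷ w ∷ os → c ∉ ts
      disjoint c∈ c∈ts with terminals-unique
      disjoint (here ≡.refl) c∈ts         | (_ ∷ d) ∷ _ = All.lookup d (∈P.∈-++⁺ˡ c∈ts) ≡.refl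
      disjoint (there (here ≡.refl)) c∈ts | _ ∷ d ∷ _ = All.lookup d (∈P.∈-++⁺ˡ c∈ts) ≡.refl
      disjoint (there (there c∈)) c∈ts    | _ ∷ _ ∷ uniq = unique-++-disjoint ts uniq c∈ts c∈

      module C = Core F′ stable W n ts m R f g

      cross : ∀ h B → Covers h B → ∀ h′ B′ → Covers h′ B′ → ∀ x ξ y → Agree (lookup (shore h B x)) ξ B′ →
              crossing (lookup (shore h B x)) (joinEdges (join h′ B′ y))
              ≡ bit (lookup (shore h B x) (proj₁ h′)) ℕ.+ (bit (lookup (shore h B x) (proj₁ (proj₂ h′)))
                  ℕ.+ (bit (lookup (shore h B x) (proj₂ (proj₂ h′))) ℕ.+ 2 ℕ.* ones ξ y))
      cross h B cov h′ B′ cov′ x ξ y ag = join-crossing h′ B′ cov′ (lookup (shore h B x)) ξ y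
        (out (here ≡.refl)) (out (there (here ≡.refl))) (out (there (there (here ≡.refl)))) (All.tabulate (λ o∈ → out (there (there (there o∈))))) ag
        where
        out : ∀ {c} → c ∈ hub ∷ u ∷ w ∷ os → lookup (shore h B x) c ≡ false
        out c∈ = outside-ts h B cov x (disjoint c∈)

      slack : ∀ h B → Covers h B → ∀ x y → ∑ (allFin R) (λ r → f r (shore h B x) * g r (join h B y)) ≈ ι (2 ℕ.+ 2 ℕ.* ones x y)
      slack h B cov x y = slack-from-crossing (shore h B x) (shore-odd h B cov x disjoint) h B cov y _ eq
        where
        eq : crossing (lookup (shore h B x)) (joinEdges (join h B y)) ≡ 3 ℕ.+ 2 ℕ.* ones x y
        eq with cross h B cov h B cov x x y (agree-shore h B cov x) | head-member h B cov x
        ... | r | p , q , s rewrite p | q | s = r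

      tight : ∀ B i v → Covers (front v) (insertAt B i (back v)) → ∀ x y → ones x y ≡ 0 →
        ∑ (allFin R) (λ r → f r (shore (front v) (insertAt B i (back v)) (insertAt x i false))
                            * g r (join (front (rot (rot v))) (insertAt B i (back (rot (rot v)))) (insertAt y i false))) ≈ 0#
      tight B i v@(a , b , c , d , e) cov x y disj =
        slack-from-crossing (shore h B₁ x₁) (shore-odd h B₁ cov x₁ disjoint) h₂ B₂ cov₂ (insertAt y i false) 0 eq
        where
        h = front v
        B₁ = insertAt B i (back v)
        x₁ = insertAt x i false
        h₂ = front (rot (rot v))
        B₂ = insertAt B i (back (rot (rot v)))
        cov₂ : Covers h₂ B₂
        cov₂ = C.valid-resp-↭ (C.arrange-rot-↭ B i (rot v)) (C.valid-resp-↭ (C.arrange-rot-↭ B i v) cov)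
        eq : crossing (lookup (shore h B₁ x₁)) (joinEdges (join h₂ B₂ (insertAt y i false))) ≡ 1
        -- The rotated join has triple (c, d, e) and block (a, b). The shore contains a, b, c and
        -- neither d nor e: c gives the only crossing, and the block lies inside, so its bit is
        -- `true` while the join uses it as an edge.
        eq with head-member h B₁ cov x₁ | agree-removeAt x B i (agree-shore h B₁ cov x₁)
        ... | pa , pb , pc | pd , pe , ag
          with cross h B₁ cov h₂ B₂ cov₂ x₁ (insertAt x i true) (insertAt y i false) (agree-insertAt x B i pa pb ag)
        ... | r rewrite pc | pd | pe | ones-insertAt x y i true false | disj = r

      rebuild : ∀ k (l : List Node) → length l ≡ 2 ℕ.* k → Σ (Blocks k) λ B → blockNodes B ≡ l
      rebuild zero    []          p = [] , ≡.refl
      rebuild (suc k) (a ∷ b ∷ l) p with rebuild k l (ℕP.suc-injective (≡.trans (ℕP.suc-injective p) (ℕP.+-suc k (k ℕ.+ 0))))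
      ... | B , q = (a , b) ∷ B , cong (λ l → a ∷ b ∷ l) q
      rebuild (suc k) (a ∷ []) p with ≡.trans (ℕP.suc-injective p) (ℕP.+-suc k (k ℕ.+ 0))
      ... | ()

      Initial : Set
      Initial = Σ Triple λ h → Σ (Blocks (suc m)) λ B → ts ≡ h ◂ blockNodes B

      initial : Initial
      initial = go ts length-ts
        where
        go : ∀ l → length l ≡ 3 ℕ.+ 2 ℕ.* suc m → Σ Triple λ h → Σ (Blocks (suc m)) λ B → l ≡ h ◂ blockNodes B
        go (a ∷ b ∷ c ∷ l) p with rebuild (suc m) l (ℕP.suc-injective (ℕP.suc-injective (ℕP.suc-injective p)))
        ... | B , q = (a , b , c) , B , cong (λ l → a ∷ b ∷ c ∷ l) (≡.sym q)

      opaque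
        unfolding vecs

        blocks∈ : ∀ {k} (B : Blocks k) → (∀ {c} → c ∈ blockNodes B → c ∈ ts) → B ∈ vecs (List.cartesianProduct ts ts) k
        blocks∈ []            h = here ≡.refl
        blocks∈ ((a , b) ∷ B) h = ∈P.∈-concatMap⁺ (λ p → List.map (p ∷_) _) (Any.map (λ { ≡.refl → ∈P.∈-map⁺ ((a , b) ∷_) (blocks∈ B (h ∘ there ∘ there)) })
          (∈P.∈-cartesianProduct⁺ (h (here ≡.refl)) (h (there (here ≡.refl)))))

    rank-bound : let open Weights W in
                 5 ℕ.* (s ℕ.* s ℕ.* D ℕ.^ suc m)
                 ℕ.≤ 4 ℕ.* (suc s ℕ.* suc s ℕ.* D ℕ.^ suc m) ℕ.+ 40 ℕ.* (s ℕ.* (D ℕ.^ suc m ℕ.+ s ℕ.* (R ℕ.* c ℕ.^ suc m)))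
    rank-bound = C.rank-bound 0≤f (λ r J → proj₁ (proj₂ (cert J)) r) slack tight
      h₀ (∈P.∈-cartesianProduct⁺ (inTs (here ≡.refl)) (∈P.∈-cartesianProduct⁺ (inTs (there (here ≡.refl))) (inTs (there (there (here ≡.refl))))))
      B₀ (blocks∈ B₀ (λ c∈ → inTs (there (there (there c∈)))))
      (All.tabulate (subst (_ ∈_) ts≡))
      where
      h₀ = proj₁ initial
      B₀ = proj₁ (proj₂ initial)
      ts≡ = proj₂ (proj₂ initial)
      inTs : ∀ {c} → c ∈ h₀ ◂ blockNodes B₀ → c ∈ ts
      inTs = subst (_ ∈_) (≡.sym ts≡)

  ¬¬-rank-bound : let open Weights W in
                  ¬ ¬ (5 ℕ.* (s ℕ.* s ℕ.* D ℕ.^ suc m)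
                       ℕ.≤ 4 ℕ.* (suc s ℕ.* suc s ℕ.* D ℕ.^ suc m) ℕ.+ 40 ℕ.* (s ℕ.* (D ℕ.^ suc m ℕ.+ s ℕ.* (R ℕ.* c ℕ.^ suc m))))
  ¬¬-rank-bound = ¬¬-map rank-bound (shift-× (shift-Vec n shift-Bool) (shift-Vec (suc m) (shift-Maybe (shift-× (shift-Fin n) (shift-Fin n)))) Certificate certificate)

-- Numerical estimates

open import Data.Nat using (_+_; _*_; _^_; _≤_; _<_)

-- With s = s₁ + 1, taking D = q^(s-1) p^(s+2) makes c, P and Q integers. For t = p/q the hypothesis
-- is t^(2s+1) + 1 ≤ 2 t^(s+1); it is an equality at t = 1 and holds just above 1, because 2s+1 < 2
-- (s+1).
weights : (s₁ q : ℕ) → 0 < q →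
          suc q ^ suc s₁ * suc q ^ suc (suc s₁) + q ^ suc s₁ * q ^ suc (suc s₁)
            ≤ 2 * (q ^ suc s₁ * suc q ^ suc (suc s₁)) →
          Weights
weights s₁ q 0<q P+Q≤2c = record
  { s = suc s₁ ; p = suc q ; q = q
  ; c = q ^ suc s₁ * suc q ^ suc (suc s₁)
  ; P = suc q ^ suc s₁ * suc q ^ suc (suc s₁)
  ; Q = q ^ suc s₁ * q ^ suc (suc s₁)
  ; D = q ^ s₁ * suc q ^ suc (suc (suc s₁))
  ; 0<q = 0<q
  ; 0<c = ℕ.>-nonZero⁻¹ _ {{ℕP.m*n≢0 (q ^ suc s₁) (suc q ^ suc (suc s₁)) {{ℕP.m^n≢0 q (suc s₁) {{ℕ.>-nonZero 0<q}}}} {{ℕP.m^n≢0 (suc q) (suc (suc s₁))}}}}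
  ; q≤p = ℕP.n≤1+n q
  ; c-law = law₁ (suc q) q (q ^ s₁) (suc q ^ suc (suc s₁))
  ; P-law = law₂ (suc q) q (q ^ s₁) (suc q ^ suc s₁)
  ; Q-law = law₃ (suc q) q (q ^ s₁) (suc q ^ suc (suc s₁))
  ; P+Q≤2c = P+Q≤2c }
  where
  open import Data.Nat.Solver
  open +-*-Solver
  law₁ : ∀ p q r x → q * r * x * p ≡ r * (p * x) * q
  law₁ = solve 4 (λ p q r x → q :* r :* x :* p := r :* (p :* x) :* q) ≡.refl
  law₂ : ∀ p q r x → x * (p * x) * (p * (q * r)) ≡ r * (p * (p * x)) * (q * x)
  law₂ = solve 4 (λ p q r x → x :* (p :* x) :* (p :* (q :* r)) := r :* (p :* (p :* x)) :* (q :* x)) ≡.refl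
  law₃ : ∀ p q r x → q * r * (q * (q * r)) * (p * x) ≡ r * (p * x) * (q * (q * (q * r)))
  law₃ = solve 4 (λ p q r x → q :* r :* (q :* (q :* r)) :* (p :* x) := r :* (p :* x) :* (q :* (q :* (q :* r)))) ≡.refl

-- The ratio 1 + 1/base is small enough for t²⁰¹ + 1 ≤ 2 t¹⁰¹.
opaque
  base : ℕ
  base = 20000

  0<base : 0 < base
  0<base = ℕ.s≤s ℕ.z≤n

  base-condition : suc base ^ 100 * suc base ^ 101 + base ^ 100 * base ^ 101
                   ≤ 2 * (base ^ 100 * suc base ^ 101)
  base-condition = ℕP.≤ᵇ⇒≤ _ _ tt

  sharpWeights : Weights
  sharpWeights = weights 99 base 0<base base-condition

  sharpWeights-s : Weights.s sharpWeights ≡ 100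
  sharpWeights-s = ≡.refl

  sharpWeights-q : Weights.q sharpWeights ≡ base
  sharpWeights-q = ≡.refl

  sharpWeights-ratio : Weights.p sharpWeights ≡ suc (Weights.q sharpWeights)
  sharpWeights-ratio = ≡.refl

-- Bernoulli's inequality for (1 + 1/q)^k, multiplied by q^(k+1).
bernoulli : ∀ q k → q ^ k * (q + k) ≤ suc q ^ k * q
bernoulli q zero    = ℕP.≤-reflexive (cong (1 *_) (ℕP.+-identityʳ q))
bernoulli q (suc k) = begin
  q * q ^ k * (q + suc k)                  ≤⟨ ℕP.m≤m+n _ (q ^ k * k) ⟩
  q * q ^ k * (q + suc k) + q ^ k * k ≡⟨ regroup q k (q ^ k) ⟩
  suc q * (q ^ k * (q + k))                ≤⟨ ℕP.*-monoʳ-≤ (suc q) (bernoulli q k) ⟩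
  suc q * (suc q ^ k * q)                    ≡⟨ ℕP.*-assoc (suc q) (suc q ^ k) q ⟨
  suc q * suc q ^ k * q                      ∎
  where
  open ℕP.≤-Reasoning
  open import Data.Nat.Solver
  open +-*-Solver
  regroup : ∀ q k x → q * x * (q + suc k) + x * k ≡ suc q * (x * (q + k))
  regroup = solve 3 (λ q k x → q :* x :* (q :+ (con 1 :+ k)) :+ x :* k := (con 1 :+ q) :* (x :* (q :+ k))) ≡.refl

doubling : ∀ q → 0 < q → 2 * q ^ q ≤ suc q ^ q
doubling q 0<q = ℕP.*-cancelʳ-≤ (2 * q ^ q) (suc q ^ q) q {{ℕ.>-nonZero 0<q}} (begin
  2 * q ^ q * q        ≡⟨ regroup (q ^ q) q ⟩
  q ^ q * (q + q)      ≤⟨ bernoulli q q ⟩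
  suc q ^ q * q          ∎)
  where
  open ℕP.≤-Reasoning
  open import Data.Nat.Solver
  open +-*-Solver
  regroup : ∀ x q → 2 * x * q ≡ x * (q + q)
  regroup = solve 2 (λ x q → con 2 :* x :* q := x :* (q :+ q)) ≡.refl

-- For s = 100 the coefficients of a are 50000 on the left and 40804 + 4000 on the right, leaving
-- 5196 a ≤ 400000 b; 77 is 400000/5196 rounded up.
absorb : ∀ s → s ≡ 100 → ∀ a b → 5 * (s * s * a) ≤ 4 * (suc s * suc s * a) + 40 * (s * (a + s * b)) →
         a ≤ 77 * b
absorb .100 ≡.refl a b p = ℕP.*-cancelˡ-≤ 5196 (begin
  5196 * a            ≤⟨ ℕP.+-cancelʳ-≤ (44804 * a) (5196 * a) (400000 * b) (≡.subst₂ ℕ._≤_ (lhs a) (rhs a b) p) ⟩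
  400000 * b          ≤⟨ ℕP.*-monoˡ-≤ b (ℕP.≤ᵇ⇒≤ 400000 400092 tt) ⟩
  400092 * b          ≡⟨ ℕP.*-assoc 5196 77 b ⟩
  5196 * (77 * b)   ∎)
  where
  open ℕP.≤-Reasoning
  open import Data.Nat.Solver
  open +-*-Solver
  lhs : ∀ a → 5 * (100 * 100 * a) ≡ 5196 * a + 44804 * a
  lhs = solve 1 (λ a → con 5 :* (con 100 :* con 100 :* a) := con 5196 :* a :+ con 44804 :* a) ≡.refl
  rhs : ∀ a b → 4 * (101 * 101 * a) + 40 * (100 * (a + 100 * b)) ≡ 400000 * b + 44804 * a
  rhs = solve 2 (λ a b → con 4 :* (con 101 :* con 101 :* a) :+ con 40 :* (con 100 :* (a :+ con 100 :* b))
                       := con 400000 :* b :+ con 44804 :* a) ≡.refl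

-- D/c equals p/q = 1 + 1/q, whose q-th power is at least 2; so the hypothesis is raised to the
-- power q.
growth : (W : Weights) → let open Weights W in p ≡ suc q → ∀ R M →
         D ^ M ≤ 77 * (R * c ^ M) → 2 ^ M ≤ (77 * R) ^ q
growth W p≡ R M bound = ℕP.*-cancelʳ-≤ (2 ^ M) ((77 * R) ^ q) ((q ^ q) ^ M) (begin
  2 ^ M * (q ^ q) ^ M                ≡⟨ ^-distribʳ-* M 2 (q ^ q) ⟨
  (2 * q ^ q) ^ M                      ≤⟨ ℕP.^-monoˡ-≤ M (doubling q 0<q) ⟩
  (suc q ^ q) ^ M                        ≡⟨ cong (λ t → (t ^ q) ^ M) p≡ ⟨
  (p ^ q) ^ M                            ≡⟨ ^-exchange p q M ⟩
  (p ^ M) ^ q                            ≤⟨ ℕP.^-monoˡ-≤ q ratio ⟩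
  (77 * R * q ^ M) ^ q               ≡⟨ ^-distribʳ-* q (77 * R) (q ^ M) ⟩
  (77 * R) ^ q * (q ^ M) ^ q       ≡⟨ cong ((77 * R) ^ q *_) (^-exchange q M q) ⟩
  (77 * R) ^ q * (q ^ q) ^ M       ∎)
  where
  open ℕP.≤-Reasoning
  open Weights W using (p; q; D; c; c-law; 0<q; 0<c)
  ^-exchange : ∀ a i j → (a ^ i) ^ j ≡ (a ^ j) ^ i
  ^-exchange a i j = ≡.trans (ℕP.^-*-assoc a i j) (≡.trans (cong (a ^_) (ℕP.*-comm i j)) (≡.sym (ℕP.^-*-assoc a j i)))
  instance
    q^q≢0 : ℕ.NonZero ((q ^ q) ^ M)
    q^q≢0 = ℕP.m^n≢0 (q ^ q) M {{ℕP.m^n≢0 q q {{ℕ.>-nonZero 0<q}}}}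
    c^M≢0 : ℕ.NonZero (c ^ M)
    c^M≢0 = ℕP.m^n≢0 c M {{ℕ.>-nonZero 0<c}}
  ratio : p ^ M ≤ 77 * R * q ^ M
  ratio = ℕP.*-cancelˡ-≤ (c ^ M) (begin
    c ^ M * p ^ M                        ≡⟨ ^-distribʳ-* M c p ⟨
    (c * p) ^ M                            ≡⟨ cong (_^ M) c-law ⟩
    (D * q) ^ M                            ≡⟨ ^-distribʳ-* M D q ⟩
    D ^ M * q ^ M                        ≤⟨ ℕP.*-monoˡ-≤ (q ^ M) bound ⟩
    77 * (R * c ^ M) * q ^ M         ≡⟨ regroup 77 R (c ^ M) (q ^ M) ⟩
    c ^ M * (77 * R * q ^ M)         ∎)
    where
    open import Data.Nat.Solver
    open +-*-Solver
    regroup : ∀ k r c q → k * (r * c) * q ≡ c * (k * r * q)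
    regroup = solve 4 (λ k r c q → k :* (r :* c) :* q := c :* (k :* r :* q)) ≡.refl

-- The factor 77 and the + 1 must be absorbed. If size ≤ 153, then 77 · 154 ≤ 2^14 forces M ≤ 14 q,
-- and t is at most 14 · 14 q = 196 q. Otherwise 77 (size + 1) ≤ 154 size ≤ size², which makes the
-- exponent 2 · 14 q.
final-bound : ∀ q t M size → 0 < M → t ≤ 14 * M → 196 * q < t →
              2 ^ M ≤ (77 * suc size) ^ q → 2 ^ (1 * t) ≤ size ^ (28 * q)
final-bound q t M size 0<M t≤14M large bound with size ℕ.≤? 153
... | yes small = ⊥-elim (ℕP.<⇒≱ large (begin
  t                       ≤⟨ t≤14M ⟩
  14 * M                ≤⟨ ℕP.*-monoʳ-≤ 14 M≤14q ⟩
  14 * (14 * q)       ≡⟨ ℕP.*-assoc 14 14 q ⟨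
  196 * q               ∎))
  where
  open ℕP.≤-Reasoning
  M≤14q : M ≤ 14 * q
  M≤14q = ℕP.≮⇒≥ (λ lt → ℕP.<⇒≱ (ℕP.^-monoʳ-< 2 (ℕ.s≤s (ℕ.s≤s ℕ.z≤n)) lt) (begin
    2 ^ M                     ≤⟨ bound ⟩
    (77 * suc size) ^ q     ≤⟨ ℕP.^-monoˡ-≤ q (ℕP.≤-trans (ℕP.*-monoʳ-≤ 77 (ℕ.s≤s small)) (ℕP.≤ᵇ⇒≤ (77 * 154) (2 ^ 14) tt)) ⟩
    (2 ^ 14) ^ q            ≡⟨ ℕP.^-*-assoc 2 14 q ⟩
    2 ^ (14 * q)            ∎))
... | no big = begin
  2 ^ (1 * t)               ≡⟨ cong (2 ^_) (ℕP.*-identityˡ t) ⟩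
  2 ^ t                       ≤⟨ ℕP.^-monoʳ-≤ 2 (ℕP.≤-trans t≤14M (ℕP.≤-reflexive (ℕP.*-comm 14 M))) ⟩
  2 ^ (M * 14)              ≡⟨ ℕP.^-*-assoc 2 M 14 ⟨
  (2 ^ M) ^ 14              ≤⟨ ℕP.^-monoˡ-≤ 14 bound ⟩
  ((77 * suc size) ^ q) ^ 14 ≤⟨ ℕP.^-monoˡ-≤ 14 (ℕP.^-monoˡ-≤ q square) ⟩
  ((size ^ 2) ^ q) ^ 14   ≡⟨ ≡.trans (cong (_^ 14) (ℕP.^-*-assoc size 2 q)) (ℕP.^-*-assoc size (2 * q) 14) ⟩
  size ^ (2 * q * 14)     ≡⟨ cong (size ^_) (regroup q) ⟩
  size ^ (28 * q)           ∎
  where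
  open ℕP.≤-Reasoning
  open import Data.Nat.Solver
  open +-*-Solver
  regroup : ∀ q → 2 * q * 14 ≡ 28 * q
  regroup = solve 1 (λ q → con 2 :* q :* con 14 := con 28 :* q) ≡.refl
  154≤size : 154 ≤ size
  154≤size = ℕP.≰⇒> big
  square : 77 * suc size ≤ size ^ 2
  square = begin
    77 * suc size             ≤⟨ ℕP.*-monoʳ-≤ 77 (ℕP.+-monoˡ-≤ size (ℕP.≤-trans (ℕ.s≤s ℕ.z≤n) 154≤size)) ⟩
    77 * (size + size)      ≡⟨ twice size ⟩
    154 * size                ≤⟨ ℕP.*-monoˡ-≤ size 154≤size ⟩
    size * size               ≡⟨ cong (size *_) (ℕP.*-identityʳ size) ⟨
    size ^ 2                  ∎
    where
    twice : ∀ x → 77 * (x + x) ≡ 154 * x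
    twice = solve 1 (λ x → con 77 :* (x :+ x) := con 154 :* x) ≡.refl

-- Splitting the terminals along the cut, and the final constants

isOdd-+ : ∀ a b → isOdd (a + b) ≡ isOdd a xor isOdd b
isOdd-+ zero    b = ≡.refl
isOdd-+ (suc a) b = ≡.trans (cong not (isOdd-+ a b)) (BoolP.not-distribˡ-xor (isOdd a) (isOdd b))

halve : ∀ k → isOdd k ≡ false → Σ ℕ λ j → k ≡ 2 * j
halve zero          p = 0 , ≡.refl
halve (suc (suc k)) p with halve k (≡.trans (≡.sym (BoolP.not-involutive (isOdd k))) p)
... | j , ≡.refl = suc j , cong suc (≡.sym (ℕP.+-suc j (j + 0)))

odd-tail : {A : Set} (xs : List A) → isOdd (length xs) ≡ true → Σ A λ x → Σ (List A) λ ys → xs ≡ x ∷ ys × isOdd (length ys) ≡ false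
odd-tail (x ∷ ys) p = x , ys , ≡.refl , ≡.trans (≡.sym (BoolP.not-involutive _)) (cong not p)

sides : {A : Set} (μ : A → Bool) (xs : List A) → Σ (List A) λ ys → Σ (List A) λ zs →
        xs ↭ ys ++ zs × All (λ x → μ x ≡ true) ys × All (λ x → μ x ≡ false) zs
sides μ []       = [] , [] , Perm.refl , [] , []
sides μ (x ∷ xs) with sides μ xs | μ x in eq
... | ys , zs , p , a , b | true  = x ∷ ys , zs , prep x p , eq ∷ a , b
... | ys , zs , p , a , b | false = ys , x ∷ zs , Perm.trans (prep x p) (Perm.↭-sym (PermP.shift x ys zs)) , a , eq ∷ b

-- σ tells whether the larger side is V or its complement.
record Side-of-cut {n : ℕ} (V T : Subset n) : Set where
  field
    σ           : Bool
    large small : List (Fin n)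
    split       : elements T ↭ large ++ small
    on-large    : All (λ c → lookup V c ≡ σ) large
    on-small    : All (λ c → lookup V c ≡ not σ) small
    odd-large   : isOdd (length large) ≡ true
    odd-small   : isOdd (length small) ≡ true
    dominates   : length small ≤ length large

-- Both sides contain an odd number of terminals, as their total is even; so either may be the large
-- one, and w always exists on the other.
choose-side : ∀ {n} (V T : Subset n) → Even ∣ T ∣ → IsTCutShore T V → Side-of-cut V T
choose-side V T even odd with sides (lookup V) (elements T)
... | ys , zs , p , a , b = pick (ℕP.≤-total (length zs) (length ys))
  where
  open ≡.≡-Reasoning
  odd-ys : isOdd (length ys) ≡ true
  odd-ys = begin
    isOdd (length ys)                                 ≡⟨ BoolP.xor-identityʳ _ ⟨
    isOdd (length ys) xor false                       ≡⟨ cong₂ _xor_ (parity-const (lookup V) true a) (parity-const (lookup V) false b) ⟨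
    parity (lookup V) ys xor parity (lookup V) zs     ≡⟨ parity-++ (lookup V) ys zs ⟨
    parity (lookup V) (ys ++ zs)                      ≡⟨ parity-↭ (lookup V) p ⟨
    parity (lookup V) (elements T)                    ≡⟨ parity-∩ V T ⟨
    isOdd ∣ V ∩ T ∣                                   ≡⟨ %⇒isOdd ∣ V ∩ T ∣ odd ⟩
    true                                              ∎
  total : isOdd (length ys) xor isOdd (length zs) ≡ false
  total = begin
    isOdd (length ys) xor isOdd (length zs)           ≡⟨ isOdd-+ (length ys) (length zs) ⟨
    isOdd (length ys + length zs)                   ≡⟨ cong isOdd (ListP.length-++ ys) ⟨
    isOdd (length (ys ++ zs))                         ≡⟨ cong isOdd (PermP.↭-length p) ⟨
    isOdd (length (elements T))                       ≡⟨ cong isOdd (length-elements T) ⟩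
    isOdd ∣ T ∣                                       ≡⟨ %⇒isEven ∣ T ∣ even ⟩
    false                                             ∎
  odd-zs : isOdd (length zs) ≡ true
  odd-zs = ≡.trans (≡.sym (BoolP.not-involutive _)) (cong not (≡.trans (cong (_xor isOdd (length zs)) (≡.sym odd-ys)) total))
  pick : length zs ≤ length ys ⊎ length ys ≤ length zs → Side-of-cut V T
  pick (inj₁ le) = record { σ = true ; large = ys ; small = zs ; split = p ; on-large = a ; on-small = b
                          ; odd-large = odd-ys ; odd-small = odd-zs ; dominates = le }
  pick (inj₂ le) = record { σ = false ; large = zs ; small = ys ; split = Perm.trans p (PermP.++-comm ys zs)
                          ; on-large = b ; on-small = a ; odd-large = odd-zs ; odd-small = odd-ys ; dominates = le }

record Layout {n : ℕ} (V T : Subset n) : Set where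
  field
    m         : ℕ
    hub u w   : Fin n
    ts os     : List (Fin n)
    σ         : Bool
    split     : elements T ↭ (hub ∷ u ∷ ts) ++ (w ∷ os)
    length-ts : length ts ≡ 3 + 2 * suc m
    even-os   : isOdd (length os) ≡ false
    side      : All (λ c → lookup V c ≡ σ) (hub ∷ u ∷ ts)
    other     : All (λ c → lookup V c ≡ not σ) (w ∷ os)
    -- Since the large side has 2 + 3 + 2 (m + 1) terminals, T has at most 14 + 4 m; the factor 14
    -- is dictated by m = 0.
    size-T    : ∣ T ∣ ≤ 14 * suc m

layout : ∀ {n} (V T : Subset n) → Even ∣ T ∣ → 14 ≤ ∣ T ∣ → IsTCutShore T V → Layout V T
layout V T even 14≤T odd = build (choose-side V T even odd)
  where
  open ℕP.≤-Reasoning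
  size : ∀ xs {ys} → elements T ↭ xs ++ ys → length ys ≤ length xs → ∣ T ∣ ≤ 2 * length xs
  size xs {ys} p le = begin
    ∣ T ∣                       ≡⟨ length-elements T ⟨
    length (elements T)         ≡⟨ PermP.↭-length p ⟩
    length (xs ++ ys)           ≡⟨ ListP.length-++ xs ⟩
    length xs + length ys     ≤⟨ ℕP.+-monoʳ-≤ (length xs) (ℕP.≤-trans le (ℕP.≤-reflexive (≡.sym (ℕP.+-identityʳ _)))) ⟩
    2 * length xs             ∎
  peel : ∀ (ls : List (Fin _)) → isOdd (length ls) ≡ true → 7 ≤ length ls →
         Σ ℕ λ m → Σ (Fin _) λ hub → Σ (Fin _) λ u → Σ (List (Fin _)) λ ts → ls ≡ hub ∷ u ∷ ts × length ts ≡ 3 + 2 * suc m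
  -- Seven nodes are the least possible: hub, u, the triple and one block.
  peel (hub ∷ u ∷ a ∷ b ∷ c ∷ d ∷ e ∷ l) p (ℕ.s≤s (ℕ.s≤s (ℕ.s≤s (ℕ.s≤s (ℕ.s≤s (ℕ.s≤s (ℕ.s≤s _)))))))
    with halve (length l) (≡.trans (≡.sym (strip (isOdd (length l)))) (cong not p))
    where
    strip : ∀ b → not (not (not (not (not (not (not (not b))))))) ≡ b
    strip true  = ≡.refl
    strip false = ≡.refl
  ... | j , q = j , hub , u , a ∷ b ∷ c ∷ d ∷ e ∷ l , ≡.refl ,
    cong (3 +_) (≡.trans (cong (2 +_) q) (cong suc (≡.sym (ℕP.+-suc j (j + 0)))))
  build : Side-of-cut V T → Layout V T
  build record { σ = σ ; large = ls ; small = ss ; split = p ; on-large = a ; on-small = b ; odd-large = ol ; odd-small = os ; dominates = le }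
    with peel ls ol (ℕP.*-cancelˡ-≤ 2 (ℕP.≤-trans 14≤T (size ls p le))) | odd-tail ss os
  ... | m , hub , u , ts , ≡.refl , len | w , rest , ≡.refl , ev = record
    { m = m ; hub = hub ; u = u ; w = w ; ts = ts ; os = rest ; σ = σ ; split = p ; length-ts = len ; even-os = ev
    ; side = a ; other = b ; size-T = begin
        ∣ T ∣                                 ≤⟨ size (hub ∷ u ∷ ts) p le ⟩
        2 * (2 + length ts)               ≡⟨ cong (λ t → 2 * (2 + t)) len ⟩
        2 * (2 + (3 + 2 * suc m))     ≤⟨ ℕP.m≤m+n _ (10 * m) ⟩
        2 * (2 + (3 + 2 * suc m)) + 10 * m ≡⟨ regroup m ⟩
        14 * suc m                          ∎ }
    where
    open import Data.Nat.Solver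
    open +-*-Solver
    regroup : ∀ m → 2 * (2 + (3 + 2 * suc m)) + 10 * m ≡ 14 * suc m
    regroup = solve 1 (λ m → con 2 :* (con 2 :+ (con 3 :+ con 2 :* (con 1 :+ m))) :+ con 10 :* m := con 14 :* (con 1 :+ m)) ≡.refl

extension-bound : (F : OrderedField) (n : ℕ) (T : Subset n) → Even ∣ T ∣ → 196 * base + 14 ≤ ∣ T ∣ →
                  (v : OF.VecE F n) → OF.IsVertex F n T v →
                  (X : OF.Extension F n) → OF.IsExtensionOf F X (OF.InRadialCone F n T v) →
                  ¬ ¬ (2 ^ (1 * ∣ T ∣) ≤ OF.extSize F X ^ (28 * base))
extension-bound F n T even large v vertex X ext-of k =
  Geometry.vertex-is-cut F n T v vertex λ { (V , odd , v≈V) → conclude V v≈V (layout V T even (ℕP.≤-trans (ℕP.m≤n+m 14 (196 * base)) large) odd) }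
  where
  conclude : ∀ V → (∀ e → OrderedField._≈_ F (v e) (OF.χδ F V e)) → ¬ Layout V T
  conclude V v≈V L = Assembly.¬¬-rank-bound F n m T v (proj₁ vertex) X ext-of ts os hub u w split length-ts even-os
    V v≈V σ side other sharpWeights (λ bound → k (final-bound base ∣ T ∣ (suc m) (OF.extSize F X) (ℕ.s≤s ℕ.z≤n) size-T
      (ℕP.<-≤-trans (ℕP.m<m+n (196 * base) (ℕ.s≤s ℕ.z≤n)) large)
      (subst (λ t → 2 ^ suc m ≤ (77 * R) ^ t) sharpWeights-q (growth sharpWeights sharpWeights-ratio R (suc m) 
        (absorb (Weights.s sharpWeights) sharpWeights-s (D ^ suc m) (R * c ^ suc m) bound)))))
    where
    open Layout L
    open Weights sharpWeights using (D; c)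
    R : ℕ
    R = suc (OF.extSize F X)

theorem10 : Σ ℕ λ p → Σ ℕ λ q → Σ ℕ λ k₀ → 1 ≤ p × 1 ≤ q ×
    ((F : OrderedField) (n : ℕ) (T : Subset n) → Even ∣ T ∣ → k₀ ≤ ∣ T ∣ →
    (v : OF.VecE F n) → OF.IsVertex F n T v →
    (X : OF.Extension F n) → OF.IsExtensionOf F X (OF.InRadialCone F n T v) →
    2 ^ (p * ∣ T ∣) ≤ OF.extSize F X ^ q)
-- The summand 14 of k₀ guarantees seven terminals on the large side and makes |T| strictly larger
-- than 196 · base, as `final-bound` requires.
theorem10 = 1 , 28 * base , 196 * base + 14 , ℕP.≤-refl , ℕP.≤-trans 0<base (ℕP.m≤n*m base 28) ,
  -- The order of natural numbers is decidable, so here the double negation is removed.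
  λ F n T even large v vertex X ext-of → decidable-stable (2 ^ (1 * ∣ T ∣) ℕ.≤? OF.extSize F X ^ (28 * base))
    (extension-bound F n T even large v vertex X ext-of)
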